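{- (i) For each odd integer $D\geq 1$, every $\left(\frac{4D+3}{2D+2},\frac{1}{2(D+1)}\right)$-sparse multigraph $G$ has a $(D,\mathrm{F})_e$-coloring. (ii) For each even integer $D\geq 2$, every $\left(\frac{4D+1}{2D+1},\frac{1}{2D+1}\right)$-sparse multigraph $G$ has a $(D,\mathrm{F})_e$-coloring. Here a $(D,\mathrm{F})_e$-coloring of $G$ is a partition $(M,F)$ of $V(G)$ such that $G[M]$ is a forest in which every connected component has at most $D$ edges, and $G[F]$ is a forest.
   Context: All multigraphs are loopless. For $a>0$ and real $b$, a multigraph $H$ is $(a,b)$-sparse if it is loopless and for every $A\subseteq V(H)$ with $|A|\geq 2$, the induced subgraph $H[A]$ has at most $a|A|+b$ edges (counted with multiplicity). A forest is an acyclic multigraph; a pair of parallel edges counts as a cycle, so forests have no multiple edges. -}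

module Defs where

open import Data.Nat as ℕ using (ℕ; zero; suc; _%_; _*_)
open import Data.Nat.DivMod using (m%n<n)
open import Data.Integer using (+_)
open import Data.Rational as ℚ using (ℚ; _/_)
open import Data.Fin using (Fin; toℕ; fromℕ<)
open import Data.Fin.Subset using (Subset; ∣_∣; _∈_; ∁)
open import Data.Bool using (Bool; true; false; _∧_; if_then_else_)
open import Data.Vec using (lookup)
open import Data.List using (List; length)
open import Data.List.Relation.Unary.All using (All)
open import Data.Product using (_×_; _,_; proj₁; proj₂)
open import Data.Sum using (_⊎_)
open import Relation.Binary.PropositionalEquality using (_≡_; _≢_)
open import Relation.Nullary using (¬_)
open import Function.Definitions using (Injective)

-- A finite loopless multigraph on vertex set Fin n.  Edges form a list of
-- (unordered) endpoint pairs; repeated entries are parallel edges.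
record Multigraph : Set where
  field
    n        : ℕ
    edges    : List (Fin n × Fin n)
    loopless : All (λ e → proj₁ e ≢ proj₂ e) edges
open Multigraph public

Vertex : Multigraph → Set
Vertex G = Fin (n G)

EdgeId : Multigraph → Set
EdgeId G = Fin (length (edges G))

endpoints : (G : Multigraph) → EdgeId G → Fin (n G) × Fin (n G)
endpoints G i = Data.List.lookup (edges G) i

Joins : (G : Multigraph) → EdgeId G → Vertex G → Vertex G → Set
Joins G i u v = (endpoints G i ≡ (u , v)) ⊎ (endpoints G i ≡ (v , u))

inducedEdgeCount : {m : ℕ} → Subset m → List (Fin m × Fin m) → ℕ
inducedEdgeCount A List.[] = 0
inducedEdgeCount A ((u , v) List.∷ es) =
  if lookup A u ∧ lookup A v then suc (inducedEdgeCount A es) else inducedEdgeCount A es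

eG : (G : Multigraph) → Subset (n G) → ℕ
eG G A = inducedEdgeCount A (edges G)

-- (a,b)-sparse: for every A ⊆ V(G) with |A| ≥ 2, e(G[A]) ≤ a|A| + b
-- (G is loopless by construction of Multigraph).
Sparse : ℚ → ℚ → Multigraph → Set
Sparse a b G = (A : Subset (n G)) → 2 ℕ.≤ ∣ A ∣ →
  (+ eG G A / 1) ℚ.≤ a ℚ.* (+ ∣ A ∣ / 1) ℚ.+ b

cnext : {k : ℕ} → Fin (suc k) → Fin (suc k)
cnext {k} i = fromℕ< (m%n<n (suc (toℕ i)) (suc k))

-- A cycle of length k+2 in G[A]: distinct vertices v_0..v_{k+1} in A and
-- distinct edges e_i joining v_i and v_{i+1 mod (k+2)}.  For length 2 this is
-- a pair of parallel edges.
record CycleIn (G : Multigraph) (A : Subset (n G)) : Set where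
  field
    k      : ℕ
    vs     : Fin (suc (suc k)) → Vertex G
    es     : Fin (suc (suc k)) → EdgeId G
    vs-inj : Injective _≡_ _≡_ vs
    es-inj : Injective _≡_ _≡_ es
    vs-in  : (i : Fin (suc (suc k))) → vs i ∈ A
    joins  : (i : Fin (suc (suc k))) → Joins G (es i) (vs i) (vs (cnext i))

IsForestIn : (G : Multigraph) → Subset (n G) → Set
IsForestIn G A = ¬ CycleIn G A

data Reach (G : Multigraph) (A : Subset (n G)) (u : Vertex G) : Vertex G → Set where
  here : u ∈ A → Reach G A u u
  step : {w x : Vertex G} (i : EdgeId G) → Reach G A u w → Joins G i w x →
         x ∈ A → Reach G A u x

EdgeInComponent : (G : Multigraph) → Subset (n G) → Vertex G → EdgeId G → Set
EdgeInComponent G A v i =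
  Reach G A v (proj₁ (endpoints G i)) × Reach G A v (proj₂ (endpoints G i))

ComponentsHaveAtMost : (D : ℕ) (G : Multigraph) → Subset (n G) → Set
ComponentsHaveAtMost D G A = (v : Vertex G) → v ∈ A →
  (f : Fin (suc D) → EdgeId G) → Injective _≡_ _≡_ f →
  ¬ ((j : Fin (suc D)) → EdgeInComponent G A v (f j))

DFColoring : (D : ℕ) → Multigraph → Set
DFColoring D G = Data.Product.Σ (Subset (n G)) λ M →
  IsForestIn G M × ComponentsHaveAtMost D G M × IsForestIn G (∁ M)

{-# OPTIONS --safe #-}
-- Give vertices weights ω ≥ 1 and ask for a partition in which F induces a forest and M a forest whose trees have weight at most
-- s = D + 1, so that weights above s force a vertex into F. With ρ(A) = Σ pot(ω v) - K e(A), sparsity says that ρ ≥ -1 on all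
-- sets when ω = 1. By induction on |V|, every weighted instance with ρ ≥ -1 is colourable. A proper set A with |A| ≥ 2 and
-- minimal ρ(A) < K is coloured first and absorbed into the rest: its F-part is contracted, or the weights of its neighbours are
-- raised. If there is no such A, then vertices of small degree and weight are reducible, and for odd s discharging shows that
-- nothing else remains. For even s = 2m the irreducible vertices of negative charge form an independent set T of cubic vertices of
-- weight m, and Σ (3 - d_T(o)) = 3 over the other vertices O. If O is a forest, then M = T and F = O work; otherwise T is still
-- a forest together with one or two vertices of O, the remaining ones having degree at most 1 among themselves.

module Submission where

open import Defs

-- A weight stands for a tree of M that hangs, or may come to hang, at a vertex, so a coloured piece
-- leaves only numbers behind. Going from weight 1 to the forced weight `s + 1` costs exactly `K` in
-- potential, the worth of one edge; thus an edge into a coloured set pays for forcing its outer end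
-- into F. If the two ends of the edge share the budget `s` instead, they spend at most `p + 1` and
-- `K - p`. The bound -1 keeps forced vertices acyclic: `e(A) ≥ |A| ≥ 2` would give
-- `(K - 1)|A| - K e(A) ≤ -2`. The obstacle is a vertex `u` of degree 3 and weight `h ≤ s/2`.
-- Deleting it and reserving `h` at each neighbour is harmless for most sets, but for `V` minus `u`
-- it needs `6h ≤ ρ(V) + K + 2h` when the neighbours are distinct. For odd `s` this always holds,
-- because `4h + 1 ≤ K`; for even `s = 2m` it fails, by one, exactly if `h = m` and `ρ(V) = -1`, and
-- such vertices have negative charge. Forests and trees are expressed by edge counts of vertex sets
-- alone; walks and cycles occur only in the final translation.

module WeightedColoring where

  open import Data.Bool using (Bool; true; false; _∧_; _∨_; not; if_then_else_)
  import Data.Bool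
  open import Data.Bool.Properties using (∧-comm)
  open import Data.Empty using (⊥; ⊥-elim)
  open import Data.Fin using (Fin; zero; suc)
  import Data.Fin as Fin
  import Data.Fin.Properties as FinP
  open import Data.Fin.Subset using (Subset; ∁; ∣_∣) renaming (_∈_ to _∈ₛ_)
  open import Data.Fin.Subset.Properties using (anySubset?; x∈∁p⇒x∉p)
  open import Data.Integer using (ℤ; +_; 0ℤ; 1ℤ; _+_; _*_; _-_; _≤_; +≤+; _≤?_)
  import Data.Integer as ℤ
  import Data.Integer.Properties as ℤP
  open import Data.Integer.Tactic.RingSolver using (solve; solve-∀)
  open import Data.List using (List; []; _∷_; length)
  import Data.List as List
  open import Data.List.Relation.Unary.All as All using (All)
  open import Data.Nat using (ℕ; zero; suc; z≤n; s≤s)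
  import Data.Nat as ℕ
  open import Data.Nat.DivMod using (m≡m%n+[m/n]*n)
  import Data.Nat.Properties as ℕP
  open import Data.Product using (∃; _×_; _,_; proj₁; proj₂)
  import Data.Rational as ℚ
  import Data.Rational.Properties as ℚP
  import Data.Rational.Unnormalised as ℚᵘ
  import Data.Rational.Unnormalised.Properties as ℚᵘP
  open import Data.Sum using (_⊎_; inj₁; inj₂)
  open import Data.Vec using (lookup; tabulate)
  open import Data.Vec.Properties using (lookup∘tabulate; []=⇒lookup; lookup⇒[]=)
  open import Function using (_∘_)
  open import Function.Definitions using (Injective)
  open import Relation.Binary.Definitions using (tri<; tri≈; tri>)
  open import Relation.Binary.PropositionalEquality
  open import Relation.Nullary using (¬_; Dec; yes; no; does; _×-dec_; _⊎-dec_; _→-dec_)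
  import Relation.Nullary.Decidable as Dec
  open import Algebra.Properties.Semiring.Sum ℤP.+-*-semiring using (sum; sum-cong-≗; ∑-distrib-+; ∑-comm; *-distribˡ-sum; sum-replicate-zero)

  -- Linear integer arithmetic and Booleans.

  infixl 5 _⊞_
  _⊞_ : ∀ {a b c d : ℤ} → a ≤ b → c ≤ d → a + c ≤ b + d
  _⊞_ = ℤP.+-mono-≤

  -- Certificate form of linear arithmetic: the hypotheses are added up with `_⊞_` to `a ≤ b`, and
  -- the ring solver confirms that the goal has the same slack.
  by : ∀ {a b x y : ℤ} → a ≤ b → y - x ≡ b - a → x ≤ y
  by h e = ℤP.0≤i-j⇒j≤i (subst (0ℤ ≤_) (sym e) (ℤP.i≤j⇒0≤j-i h))

  eq : ∀ {a b : ℤ} → a ≡ b → a ≤ b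
  eq = ℤP.≤-reflexive

  eq′ : ∀ {a b : ℤ} → a ≡ b → b ≤ a
  eq′ = ℤP.≤-reflexive ∘ sym

  0≤ : ∀ n → 0ℤ ≤ + n
  0≤ n = +≤+ z≤n

  ≰⇒+1≤ : ∀ {a b : ℤ} → ¬ (a ≤ b) → b + 1ℤ ≤ a
  ≰⇒+1≤ {a} {b} h = subst (_≤ a) (ℤP.+-comm 1ℤ b) (ℤP.i<j⇒suc[i]≤j (ℤP.≰⇒> h))

  1≰0 : ¬ (1ℤ ≤ 0ℤ)
  1≰0 (+≤+ ())

  ≤⊎+1≤ : ∀ (a b : ℤ) → a ≤ b ⊎ b + 1ℤ ≤ a
  ≤⊎+1≤ a b with a ≤? b
  ... | yes h = inj₁ h
  ... | no h = inj₂ (≰⇒+1≤ h)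

  *-nn : ∀ {x y} → 0ℤ ≤ x → 0ℤ ≤ y → 0ℤ ≤ x * y
  *-nn {+ m} {+ n} _ _ = subst (0ℤ ≤_) (ℤP.pos-* m n) (0≤ (m ℕ.* n))

  private
    *-monoˡ-eq : ∀ k x y → k * y - k * x ≡ k * (y - x) - 0ℤ
    *-monoˡ-eq = solve-∀

  *-monoˡ : ∀ {k x y} → 0ℤ ≤ k → x ≤ y → k * x ≤ k * y
  *-monoˡ {k} {x} {y} hk h = by (*-nn hk (ℤP.i≤j⇒0≤j-i h)) (*-monoˡ-eq k x y)

  false≢true : false ≢ true
  false≢true ()

  ∧-true : ∀ {a b} → a ∧ b ≡ true → a ≡ true × b ≡ true
  ∧-true {true} {true} _ = refl , refl

  ∧-intro : ∀ {a b} → a ≡ true → b ≡ true → a ∧ b ≡ true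
  ∧-intro refl refl = refl

  not-true : ∀ {a} → not a ≡ true → a ≡ false
  not-true {false} _ = refl

  not-intro : ∀ {a} → a ≡ false → not a ≡ true
  not-intro refl = refl

  ∨-true : ∀ {a b} → a ∨ b ≡ true → a ≡ true ⊎ b ≡ true
  ∨-true {true} _ = inj₁ refl
  ∨-true {false} h = inj₂ h

  true⊎false : ∀ b → b ≡ true ⊎ b ≡ false
  true⊎false true = inj₁ refl
  true⊎false false = inj₂ refl

  ≢true : ∀ {b} → b ≢ true → b ≡ false
  ≢true {true} h = ⊥-elim (h refl)
  ≢true {false} _ = refl

  true≢false : ∀ {b} → b ≡ true → b ≡ false → ⊥
  true≢false refl ()

  -- Vertex sets as Boolean predicates.

  Sub : ℕ → Set
  Sub N = Fin N → Bool

  infix 4 _∈_ _⊆_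
  _∈_ : ∀ {N} → Fin N → Sub N → Set
  v ∈ A = A v ≡ true

  _⊆_ : ∀ {N} → Sub N → Sub N → Set
  A ⊆ B = ∀ v → v ∈ A → v ∈ B

  infixl 7 _∩_ _∖_ _-′_
  infixl 6 _∪_
  _∩_ _∖_ _∪_ : ∀ {N} → Sub N → Sub N → Sub N
  (A ∩ B) v = A v ∧ B v
  (A ∖ B) v = A v ∧ not (B v)
  (A ∪ B) v = A v ∨ B v

  module _ {N : ℕ} (A B : Sub N) {v : Fin N} where

    ∩⁻ : v ∈ A ∩ B → v ∈ A × v ∈ B
    ∩⁻ = ∧-true

    ∩⁺ : v ∈ A → v ∈ B → v ∈ A ∩ B
    ∩⁺ = ∧-intro

    ∖⁻ : v ∈ A ∖ B → v ∈ A × B v ≡ false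
    ∖⁻ h = proj₁ (∧-true h) , not-true (proj₂ (∧-true h))

    ∖⁺ : v ∈ A → B v ≡ false → v ∈ A ∖ B
    ∖⁺ p q = ∧-intro p (not-intro q)

    ∪⁻ : v ∈ A ∪ B → v ∈ A ⊎ v ∈ B
    ∪⁻ = ∨-true

    ∪ˡ : v ∈ A → v ∈ A ∪ B
    ∪ˡ p = cong (_∨ B v) p

    ∪ʳ : v ∈ B → v ∈ A ∪ B
    ∪ʳ p with A v
    ... | true = refl
    ... | false = p

  opaque
    _==_ : ∀ {N} → Fin N → Fin N → Bool
    u == v = does (u FinP.≟ v)

    ==-refl : ∀ {N} (u : Fin N) → (u == u) ≡ true
    ==-refl u with u FinP.≟ u
    ... | yes _ = refl
    ... | no h = ⊥-elim (h refl)

    ==⇒≡ : ∀ {N} {u v : Fin N} → (u == v) ≡ true → u ≡ v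
    ==⇒≡ {u = u} {v} h with u FinP.≟ v
    ... | yes p = p
    ==⇒≡ {u = u} {v} () | no _

    ≢⇒== : ∀ {N} {u v : Fin N} → u ≢ v → (u == v) ≡ false
    ≢⇒== {u = u} {v} h with u FinP.≟ v
    ... | yes p = ⊥-elim (h p)
    ... | no _ = refl

  ==-false : ∀ {N} {u v : Fin N} → (u == v) ≡ false → u ≢ v
  ==-false {u = u} h refl = true≢false (==-refl u) h

  ⁅_⁆ : ∀ {N} → Fin N → Sub N
  ⁅ u ⁆ v = v == u

  _-′_ : ∀ {N} → Sub N → Fin N → Sub N
  A -′ u = A ∖ ⁅ u ⁆

  ∅ : ∀ {N} → Sub N
  ∅ _ = false

  -′-⊆ : ∀ {N} {A : Sub N} u → A -′ u ⊆ A
  -′-⊆ u v h = proj₁ (∧-true h)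

  -′-∉ : ∀ {N} (A : Sub N) u → (A -′ u) u ≡ false
  -′-∉ A u with A u
  ... | false = refl
  ... | true rewrite ==-refl u = refl

  -′-intro : ∀ {N} {A : Sub N} {u v} → v ∈ A → v ≢ u → v ∈ (A -′ u)
  -′-intro h n = ∧-intro h (not-intro (≢⇒== n))

  -′-≢ : ∀ {N} (A : Sub N) {u v} → v ∈ (A -′ u) → v ≢ u
  -′-≢ A {u} h refl = true≢false h (-′-∉ A u)

  module _ {N : ℕ} (A : Sub N) (u : Fin N) where

    ∈-keep : ∀ {v} → v ∈ A → v ∈ A ∪ ⁅ u ⁆
    ∈-keep = ∪ˡ A ⁅ u ⁆

    ∈-new : u ∈ A ∪ ⁅ u ⁆
    ∈-new = ∪ʳ A ⁅ u ⁆ (==-refl u)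

    ∉-add : ∀ {v} → A v ≡ false → v ≢ u → (A ∪ ⁅ u ⁆) v ≡ false
    ∉-add h n = cong₂ _∨_ h (≢⇒== n)

    ⊆-add : ∀ {B} → A ⊆ B → u ∈ B → A ∪ ⁅ u ⁆ ⊆ B
    ⊆-add {B} h p v q with ∪⁻ A ⁅ u ⁆ q
    ... | inj₁ r = h v r
    ... | inj₂ r = subst (_∈ B) (sym (==⇒≡ r)) p

  -- Sums over subsets

  gate : Bool → ℤ → ℤ
  gate true x = x
  gate false x = 0ℤ

  sum-mono : ∀ {n} {f g : Fin n → ℤ} → (∀ v → f v ≤ g v) → sum f ≤ sum g
  sum-mono {zero} h = ℤP.≤-refl
  sum-mono {suc n} h = h zero ⊞ sum-mono (h ∘ suc)

  module _ {N : ℕ} where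

    opaque
      ∑ : Sub N → (Fin N → ℤ) → ℤ
      ∑ A f = sum (λ v → gate (A v) (f v))

    opaque
      unfolding ∑

      ∑-cong : ∀ (A : Sub N) {f g} → (∀ v → v ∈ A → f v ≡ g v) → ∑ A f ≡ ∑ A g
      ∑-cong A {f} {g} h = sum-cong-≗ λ v → go v (A v) refl
        where
        go : ∀ v b → A v ≡ b → gate b (f v) ≡ gate b (g v)
        go v true p = h v p
        go v false _ = refl

      ∑-set : ∀ {A B : Sub N} {f} → (∀ v → A v ≡ B v) → ∑ A f ≡ ∑ B f
      ∑-set {f = f} h = sum-cong-≗ λ v → cong (λ b → gate b (f v)) (h v)

      ∑-mono : ∀ (A : Sub N) {f g} → (∀ v → v ∈ A → f v ≤ g v) → ∑ A f ≤ ∑ A g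
      ∑-mono A {f} {g} h = sum-mono λ v → go v (A v) refl
        where
        go : ∀ v b → A v ≡ b → gate b (f v) ≤ gate b (g v)
        go v true p = h v p
        go v false _ = ℤP.≤-refl

      ∑-+ : ∀ (A : Sub N) f g → ∑ A (λ v → f v + g v) ≡ ∑ A f + ∑ A g
      ∑-+ A f g = trans (sum-cong-≗ λ v → go (A v) (f v) (g v)) (∑-distrib-+ (λ v → gate (A v) (f v)) (λ v → gate (A v) (g v)))
        where
        go : ∀ b x y → gate b (x + y) ≡ gate b x + gate b y
        go true _ _ = refl
        go false _ _ = refl

      ∑-* : ∀ (A : Sub N) k f → ∑ A (λ v → k * f v) ≡ k * ∑ A f
      ∑-* A k f = trans (sum-cong-≗ λ v → go (A v) (f v)) (sym (*-distribˡ-sum k (λ v → gate (A v) (f v))))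
        where
        go : ∀ b x → gate b (k * x) ≡ k * gate b x
        go true _ = refl
        go false _ = sym (ℤP.*-zeroʳ k)

      ∑-0 : ∀ (A : Sub N) → ∑ A (λ _ → 0ℤ) ≡ 0ℤ
      ∑-0 A = trans (sum-cong-≗ λ v → go (A v)) (sum-replicate-zero N)
        where
        go : ∀ b → gate b 0ℤ ≡ 0ℤ
        go true = refl
        go false = refl

      ∑-zero : ∀ (A : Sub N) {f} → (∀ v → v ∈ A → f v ≡ 0ℤ) → ∑ A f ≡ 0ℤ
      ∑-zero A h = trans (∑-cong A h) (∑-0 A)

      ∑-nn : ∀ (A : Sub N) {f} → (∀ v → v ∈ A → 0ℤ ≤ f v) → 0ℤ ≤ ∑ A f
      ∑-nn A {f} h = subst (λ x → x ≤ ∑ A f) (∑-0 A) (∑-mono A h)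

      ∑-split : ∀ (A C : Sub N) f → ∑ A f ≡ ∑ (A ∩ C) f + ∑ (A ∖ C) f
      ∑-split A C f = trans (sum-cong-≗ λ v → go (A v) (C v) (f v)) (∑-distrib-+ (λ v → gate ((A ∩ C) v) (f v)) (λ v → gate ((A ∖ C) v) (f v)))
        where
        go : ∀ a c x → gate a x ≡ gate (a ∧ c) x + gate (a ∧ not c) x
        go true true x = sym (ℤP.+-identityʳ x)
        go true false x = sym (ℤP.+-identityˡ x)
        go false _ _ = refl

      ∑-⊆ : ∀ {A B : Sub N} {f} → A ⊆ B → (∀ v → v ∈ B → 0ℤ ≤ f v) → ∑ A f ≤ ∑ B f
      ∑-⊆ {A} {B} {f} h nn = sum-mono λ v → go v (A v) (B v) refl refl
        where
        go : ∀ v a b → A v ≡ a → B v ≡ b → gate a (f v) ≤ gate b (f v)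
        go v true true p q = ℤP.≤-refl
        go v true false p q = ⊥-elim (true≢false (h v p) q)
        go v false true p q = nn v q
        go v false false p q = ℤP.≤-refl

      ∑-swap : ∀ (A B : Sub N) (g : Fin N → Fin N → ℤ) → ∑ A (λ u → ∑ B (g u)) ≡ ∑ B (λ v → ∑ A (λ u → g u v))
      ∑-swap A B g = trans (sum-cong-≗ λ u → inn (A u) u) (trans (∑-comm λ u v → gate (A u) (gate (B v) (g u v)))
          (sum-cong-≗ λ v → out (B v) v))
        where
        inn : ∀ b u → gate b (∑ B (g u)) ≡ sum (λ v → gate b (gate (B v) (g u v)))
        inn true u = refl
        inn false u = sym (sum-replicate-zero N)
        out : ∀ b v → sum (λ u → gate (A u) (gate b (g u v))) ≡ gate b (∑ A (λ u → g u v))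
        out true v = refl
        out false v = ∑-0 A

      ∑-∅ : ∀ {A : Sub N} {f} → (∀ v → A v ≡ false) → ∑ A f ≡ 0ℤ
      ∑-∅ {A} {f} h = ∑-zero A λ v p → ⊥-elim (true≢false p (h v))

  opaque
    unfolding _==_

    sum-single : ∀ {N} (u : Fin N) (f : Fin N → ℤ) → sum (λ v → gate (v == u) (f v)) ≡ f u
    sum-single {suc N} zero f = trans (cong (λ x → f zero + x) (sum-replicate-zero N)) (ℤP.+-identityʳ _)
    sum-single {suc N} (suc u) f = trans (ℤP.+-identityˡ _) (trans (sum-cong-≗ λ v → cong (λ b → gate b (f (suc v))) (go v)) (sum-single u (f ∘ suc)))
      where
      go : ∀ v → (suc v == suc u) ≡ (v == u)
      go v with v FinP.≟ u
      ... | yes p = refl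
      ... | no _ = refl

  private
    ∑-pos-arith : ∀ x → 0ℤ - x ≡ 1ℤ - (x + 1ℤ)
    ∑-pos-arith = solve-∀

    card-pos-eq : ∀ x → (1ℤ + x) - 1ℤ ≡ x - 0ℤ
    card-pos-eq = solve-∀

  module _ {N : ℕ} where

    opaque
      unfolding ∑

      ∑-⁅⁆ : ∀ (u : Fin N) f → ∑ ⁅ u ⁆ f ≡ f u
      ∑-⁅⁆ = sum-single

    ∩⁅⁆ : ∀ {A : Sub N} {u} → u ∈ A → ∀ v → (A ∩ ⁅ u ⁆) v ≡ ⁅ u ⁆ v
    ∩⁅⁆ {A} {u} p v with v == u in q
    ... | true rewrite ==⇒≡ {u = v} q | p = refl
    ... | false with A v
    ...   | true = refl
    ...   | false = refl

    ∑-pt : ∀ {A : Sub N} {u} f → u ∈ A → ∑ A f ≡ f u + ∑ (A -′ u) f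
    ∑-pt {A} {u} f p = trans (∑-split A ⁅ u ⁆ f) (cong (_+ ∑ (A -′ u) f) (trans (∑-set {A = A ∩ ⁅ u ⁆} (∩⁅⁆ {A} p)) (∑-⁅⁆ u f)))

    ∪∩ : ∀ (A B : Sub N) v → ((A ∪ B) ∩ A) v ≡ A v
    ∪∩ A B v with A v | B v
    ... | true | _ = refl
    ... | false | true = refl
    ... | false | false = refl

    ∪∖ : ∀ (A B : Sub N) → (∀ v → v ∈ A → B v ≡ false) → ∀ v → ((A ∪ B) ∖ A) v ≡ B v
    ∪∖ A B d v with A v in p | B v in q
    ... | true | true = ⊥-elim (true≢false q (d v p))
    ... | true | false = refl
    ... | false | true = refl
    ... | false | false = refl

    ∑-∪ : ∀ (A B : Sub N) f → (∀ v → v ∈ A → B v ≡ false) → ∑ (A ∪ B) f ≡ ∑ A f + ∑ B f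
    ∑-∪ A B f d = trans (∑-split (A ∪ B) A f) (cong₂ _+_ (∑-set (∪∩ A B)) (∑-set (∪∖ A B d)))

    ∑-sub : ∀ {A V : Sub N} f → A ⊆ V → ∑ V f ≡ ∑ A f + ∑ (V ∖ A) f
    ∑-sub {A} {V} f h = trans (∑-split V A f) (cong (_+ ∑ (V ∖ A) f) (∑-set go))
      where
      go : ∀ v → V v ∧ A v ≡ A v
      go v with A v in p
      ... | true rewrite h v p = refl
      ... | false with V v
      ...   | true = refl
      ...   | false = refl

    card : Sub N → ℤ
    card A = ∑ A (λ _ → 1ℤ)

    find : ∀ (A : Sub N) → (∃ λ v → v ∈ A) ⊎ (∀ v → A v ≡ false)
    find A with FinP.any? (λ v → A v Data.Bool.≟ true)
    ... | yes p = inj₁ p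
    ... | no h = inj₂ λ v → ≢true (λ p → h (v , p))

    ∑-pos : ∀ (A : Sub N) {f} → 1ℤ ≤ ∑ A f → ∃ λ v → v ∈ A × 1ℤ ≤ f v
    ∑-pos A {f} h with FinP.any? (λ v → (A v Data.Bool.≟ true) ×-dec (1ℤ ≤? f v))
    ... | yes p = p
    ... | no k = ⊥-elim (1≰0 (ℤP.≤-trans h (subst (∑ A f ≤_) (∑-0 A) (∑-mono A λ v p → by (≰⇒+1≤ (λ q → k (v , p , q))) (∑-pos-arith (f v))))))

    card-pos : ∀ {A : Sub N} {u} → u ∈ A → 1ℤ ≤ card A
    card-pos {A} {u} p = subst (1ℤ ≤_) (sym (∑-pt (λ _ → 1ℤ) p)) (by (∑-nn (A -′ u) {λ _ → 1ℤ} λ _ _ → 0≤ 1) (card-pos-eq (card (A -′ u))))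

    card-nn : ∀ (A : Sub N) → 0ℤ ≤ card A
    card-nn A = ∑-nn A {λ _ → 1ℤ} λ _ _ → 0≤ 1

    card-pos⁻¹ : ∀ {A : Sub N} → 1ℤ ≤ card A → ∃ λ u → u ∈ A
    card-pos⁻¹ {A} h with ∑-pos A {λ _ → 1ℤ} h
    ... | v , p , _ = v , p

  -- Multigraphs as multiplicity matrices

  record Graph (N : ℕ) : Set where
    field
      a : Fin N → Fin N → ℤ
      a-sym : ∀ u v → a u v ≡ a v u
      a-irr : ∀ v → a v v ≡ 0ℤ
      a-nn : ∀ u v → 0ℤ ≤ a u v
  open Graph public

  ⟦_⟧ : Bool → ℤ
  ⟦ b ⟧ = gate b 1ℤ

  ⟦⟧-nn : ∀ b → 0ℤ ≤ ⟦ b ⟧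
  ⟦⟧-nn true = 0≤ 1
  ⟦⟧-nn false = 0≤ 0

  ∑-δ : ∀ {N} (B : Sub N) y k → ∑ B (λ v → gate (v == y) k) ≡ gate (B y) k
  ∑-δ B y k with B y in p
  ... | true = trans (∑-pt (λ v → gate (v == y) k) p) (trans (cong₂ _+_ (cong (λ b → gate b k) (==-refl y))
        (∑-zero (B -′ y) λ v q → cong (λ b → gate b k) (≢⇒== (-′-≢ B q)))) (ℤP.+-identityʳ k))
  ... | false = ∑-zero B λ v q → cong (λ b → gate b k) (≢⇒== λ { refl → true≢false q p })

  private
    2e-arith : ∀ x → x + x ≡ + 2 * x
    2e-arith = solve-∀

    e-split-eq : ∀ {p q r x y z : ℤ} → p ≡ + 2 * x → q ≡ + 2 * y → r ≡ z → (p + z) + (r + q) ≡ + 2 * (x + y + z)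
    e-split-eq {x = x} {y} {z} refl refl refl = solve (x ∷ y ∷ z ∷ [])

  module _ {N : ℕ} (G : Graph N) where

    cr : Fin N → Sub N → ℤ
    cr u B = ∑ B (a G u)

    cross : Sub N → Sub N → ℤ
    cross A B = ∑ A (λ u → cr u B)

    opaque
      e : Sub N → ℤ
      e A = ∑ A (λ u → ∑ A (λ v → gate (does (v Fin.<? u)) (a G u v)))

      e-cong : ∀ {A B : Sub N} → (∀ v → A v ≡ B v) → e A ≡ e B
      e-cong {A} {B} h = trans (∑-set h) (∑-cong B λ u _ → ∑-set h)

      -- Handshake identity. The identities for `e` further on are mostly proved for the symmetric
      -- `cross` and then divided by 2.
      2e : ∀ A → cross A A ≡ + 2 * e A
      2e A = trans (∑-cong A λ u _ → trans (∑-cong A λ v _ → sp (does (v Fin.<? u)) (a G u v)) (∑-+ A (lo u) (hi u)))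
          (trans (∑-+ A (λ u → ∑ A (lo u)) (λ u → ∑ A (hi u)))
          (trans (cong (λ z → e A + z) (trans (∑-swap A A hi) (∑-cong A λ v _ → ∑-cong A λ u _ → flip v u))) (2e-arith (e A))))
        where
        lo hi : Fin N → Fin N → ℤ
        lo u v = gate (does (v Fin.<? u)) (a G u v)
        hi u v = gate (not (does (v Fin.<? u))) (a G u v)
        sp : ∀ b x → x ≡ gate b x + gate (not b) x
        sp true x = sym (ℤP.+-identityʳ x)
        sp false x = sym (ℤP.+-identityˡ x)
        flip : ∀ v u → hi u v ≡ lo v u
        flip v u = go (v Fin.<? u) (u Fin.<? v)
          where
          go : (p : Dec (v Fin.< u)) (q : Dec (u Fin.< v)) → gate (not (does p)) (a G u v) ≡ gate (does q) (a G v u)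
          go (yes p) (yes q) = ⊥-elim (FinP.<-asym p q)
          go (yes p) (no q) = refl
          go (no p) (yes q) = a-sym G u v
          go (no p) (no q) with FinP.<-cmp u v
          ... | tri< x _ _ = ⊥-elim (q x)
          ... | tri> _ _ x = ⊥-elim (p x)
          ... | tri≈ _ refl _ = a-irr G u

    cr-nn : ∀ u B → 0ℤ ≤ cr u B
    cr-nn u B = ∑-nn B λ v _ → a-nn G u v

    cr-⊆ : ∀ u {A B} → A ⊆ B → cr u A ≤ cr u B
    cr-⊆ u h = ∑-⊆ h λ v _ → a-nn G u v

    cr-∅ : ∀ u {A} → (∀ v → A v ≡ false) → cr u A ≡ 0ℤ
    cr-∅ u h = ∑-∅ h

    cr-self : ∀ u A → cr u (A -′ u) ≡ cr u A
    cr-self u A with A u in p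
    ... | true = sym (trans (∑-pt (a G u) p) (trans (cong (_+ cr u (A -′ u)) (a-irr G u)) (ℤP.+-identityˡ _)))
    ... | false = ∑-set λ v → go v (A v) refl
      where
      go : ∀ v b → A v ≡ b → b ∧ not (v == u) ≡ b
      go v false _ = refl
      go v true q = not-intro (≢⇒== λ { refl → true≢false q p })

    cross-nn : ∀ A B → 0ℤ ≤ cross A B
    cross-nn A B = ∑-nn A λ u _ → cr-nn u B

    cross-⊆ : ∀ {A A′ B B′} → A ⊆ A′ → B ⊆ B′ → cross A B ≤ cross A′ B′
    cross-⊆ {A} {A′} {B} {B′} h k = ℤP.≤-trans (∑-mono A λ u _ → cr-⊆ u k) (∑-⊆ h λ u _ → cr-nn u B′)

    cross-comm : ∀ A B → cross A B ≡ cross B A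
    cross-comm A B = trans (∑-swap A B (a G)) (∑-cong B λ v _ → ∑-cong A λ u _ → a-sym G u v)

    cross-splitˡ : ∀ A C B → cross A B ≡ cross (A ∩ C) B + cross (A ∖ C) B
    cross-splitˡ A C B = ∑-split A C (λ u → cr u B)

    cross-splitʳ : ∀ A B C → cross A B ≡ cross A (B ∩ C) + cross A (B ∖ C)
    cross-splitʳ A B C = trans (∑-cong A λ u _ → ∑-split B C (a G u)) (∑-+ A (λ u → cr u (B ∩ C)) (λ u → cr u (B ∖ C)))

    e-split : ∀ A C → e A ≡ e (A ∩ C) + e (A ∖ C) + cross (A ∩ C) (A ∖ C)
    e-split A C = ℤP.*-cancelˡ-≡ (+ 2) _ _ (trans (sym (2e A)) (trans (cross-splitˡ A C A)
        (trans (cong₂ _+_ (cross-splitʳ (A ∩ C) A C) (cross-splitʳ (A ∖ C) A C))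
        (e-split-eq (2e (A ∩ C)) (2e (A ∖ C)) (cross-comm (A ∖ C) (A ∩ C))))))

    cross-setˡ : ∀ {A A′ B} → (∀ v → A v ≡ A′ v) → cross A B ≡ cross A′ B
    cross-setˡ h = ∑-set h

    cross-setʳ : ∀ A {B B′} → (∀ v → B v ≡ B′ v) → cross A B ≡ cross A B′
    cross-setʳ A h = ∑-cong A λ u _ → ∑-set h

    e-∪ : ∀ A B → (∀ v → v ∈ A → B v ≡ false) → e (A ∪ B) ≡ e A + e B + cross A B
    e-∪ A B d = trans (e-split (A ∪ B) A) (cong₂ _+_ (cong₂ _+_ (e-cong (∪∩ A B)) (e-cong (∪∖ A B d)))
      (trans (cross-setˡ (∪∩ A B)) (cross-setʳ A (∪∖ A B d))))

    e-∅ : ∀ {A} → (∀ v → A v ≡ false) → e A ≡ 0ℤ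
    e-∅ {A} h = ℤP.*-cancelˡ-≡ (+ 2) _ _ (trans (sym (2e A)) (∑-∅ h))

    e-⁅⁆ : ∀ u → e ⁅ u ⁆ ≡ 0ℤ
    e-⁅⁆ u = ℤP.*-cancelˡ-≡ (+ 2) _ _ (trans (sym (2e ⁅ u ⁆)) (trans (∑-⁅⁆ u _) (trans (∑-⁅⁆ u _) (a-irr G u))))

    e-pt : ∀ {A u} → u ∈ A → e A ≡ e (A -′ u) + cr u (A -′ u)
    e-pt {A} {u} p = trans (e-split A ⁅ u ⁆) (cong₂ _+_
        (trans (cong (_+ e (A -′ u)) (trans (e-cong (∩⁅⁆ {A = A} p)) (e-⁅⁆ u))) (ℤP.+-identityˡ (e (A -′ u))))
        (trans (∑-set (∩⁅⁆ {A = A} p)) (∑-⁅⁆ u _)))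

    cross-pos : ∀ {A B} → 1ℤ ≤ cross A B → ∃ λ u → ∃ λ v → u ∈ A × v ∈ B × 1ℤ ≤ a G u v
    cross-pos {A} {B} h with ∑-pos A h
    ... | u , p , k with ∑-pos B k
    ...   | v , q , l = u , v , p , q , l

  e-agree : ∀ {N} (G H : Graph N) A → (∀ u v → u ∈ A → v ∈ A → a G u v ≡ a H u v) → e G A ≡ e H A
  e-agree G H A h = ℤP.*-cancelˡ-≡ (+ 2) _ _ (trans (sym (2e G A)) (trans (∑-cong A λ u p → ∑-cong A λ v q → h u v p q) (2e H A)))

  addEdge : ∀ {N} (G : Graph N) (x y : Fin N) → x ≢ y → Graph N
  addEdge G x y x≢y = record
    { a = λ u v → a G u v + (⟦ (u == x) ∧ (v == y) ⟧ + ⟦ (u == y) ∧ (v == x) ⟧)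
    ; a-sym = λ u v → cong₂ _+_ (a-sym G u v) (trans (ℤP.+-comm ⟦ (u == x) ∧ (v == y) ⟧ _) (cong₂ _+_ (cong ⟦_⟧ (∧-comm (u == y) (v == x))) (cong ⟦_⟧ (∧-comm (u == x) (v == y)))))
    ; a-irr = λ v → cong₂ _+_ (a-irr G v) (cong₂ _+_ (cong ⟦_⟧ (diag x y x≢y v)) (cong ⟦_⟧ (diag y x (x≢y ∘ sym) v)))
    ; a-nn = λ u v → a-nn G u v ⊞ (⟦⟧-nn ((u == x) ∧ (v == y)) ⊞ ⟦⟧-nn ((u == y) ∧ (v == x)))
    }
    where
    diag : ∀ x y → x ≢ y → ∀ v → (v == x) ∧ (v == y) ≡ false
    diag x y n v with v == x in p
    ... | false = refl
    ... | true rewrite ==⇒≡ {u = v} p = ≢⇒== n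

  cr-addEdge : ∀ {N} (G : Graph N) x y n u B → cr (addEdge G x y n) u B ≡ cr G u B + (gate (u == x) ⟦ B y ⟧ + gate (u == y) ⟦ B x ⟧)
  cr-addEdge G x y n u B = trans (∑-+ B (a G u) _) (cong (λ z → cr G u B + z) (trans (∑-+ B (λ v → ⟦ (u == x) ∧ (v == y) ⟧) _) (cong₂ _+_ (part x y) (part y x))))
    where
    part : ∀ x y → ∑ B (λ v → ⟦ (u == x) ∧ (v == y) ⟧) ≡ gate (u == x) ⟦ B y ⟧
    part x y with u == x
    ... | true = ∑-δ B y 1ℤ
    ... | false = ∑-0 B

  e-addEdge : ∀ {N} (G : Graph N) x y n A → e (addEdge G x y n) A ≡ e G A + ⟦ A x ∧ A y ⟧
  e-addEdge G x y n A = ℤP.*-cancelˡ-≡ (+ 2) _ _ (trans (sym (2e (addEdge G x y n) A)) (trans (∑-cong A λ u _ → cr-addEdge G x y n u A)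
      (trans (∑-+ A (λ u → cr G u A) _) (trans (cong₂ _+_ (2e G A) (trans (∑-+ A (λ u → gate (u == x) ⟦ A y ⟧) _) (cong₂ _+_ (∑-δ A x ⟦ A y ⟧) (∑-δ A y ⟦ A x ⟧)))) (lem (A x) (A y) (e G A))))))
    where
    lem : ∀ b c k → + 2 * k + (gate b ⟦ c ⟧ + gate c ⟦ b ⟧) ≡ + 2 * (k + ⟦ b ∧ c ⟧)
    lem true true k = solve (k ∷ [])
    lem true false k = solve (k ∷ [])
    lem false true k = solve (k ∷ [])
    lem false false k = solve (k ∷ [])

  -- Only the row and column of `f` change. The other vertices of `S` stay in the matrix and are
  -- dropped by restricting the vertex set of the instance.
  contract : ∀ {N} (G : Graph N) (S : Sub N) (f : Fin N) → Graph N
  contract G S f = record { a = b ; a-sym = bs ; a-irr = bi ; a-nn = bn }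
    where
    b : _ → _ → ℤ
    b u v = if u == f then (if v == f then 0ℤ else cr G v S) else (if v == f then cr G u S else a G u v)
    bs : ∀ u v → b u v ≡ b v u
    bs u v with u == f | v == f
    ... | true | true = refl
    ... | true | false = refl
    ... | false | true = refl
    ... | false | false = a-sym G u v
    bi : ∀ v → b v v ≡ 0ℤ
    bi v with v == f
    ... | true = refl
    ... | false = a-irr G v
    bn : ∀ u v → 0ℤ ≤ b u v
    bn u v with u == f | v == f
    ... | true | true = 0≤ 0
    ... | true | false = cr-nn G v S
    ... | false | true = cr-nn G u S
    ... | false | false = a-nn G u v

  cr-contract : ∀ {N} (G : Graph N) S f B → B f ≡ false → cr (contract G S f) f B ≡ cross G B S
  cr-contract G S f B h = ∑-cong B go
    where
    go : ∀ v → v ∈ B → a (contract G S f) f v ≡ cr G v S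
    go v p rewrite ==-refl f | ≢⇒== {u = v} {f} (λ { refl → true≢false p h }) = refl

  e-contract : ∀ {N} (G : Graph N) S f B → B f ≡ false → e (contract G S f) B ≡ e G B
  e-contract G S f B h = e-agree (contract G S f) G B go
    where
    go : ∀ u v → u ∈ B → v ∈ B → a (contract G S f) u v ≡ a G u v
    go u v p q rewrite ≢⇒== {u = u} {f} (λ { refl → true≢false p h }) | ≢⇒== {u = v} {f} (λ { refl → true≢false q h }) = refl

  -- Forests and light sets by edge counting

  wt : ∀ {N} → (Fin N → ℕ) → Sub N → ℤ
  wt ω A = ∑ A (λ v → + ω v)

  Nonempty : ∀ {N} → Sub N → Set
  Nonempty A = ∃ λ v → v ∈ A

  ⊆-dec : ∀ {N} (A B : Sub N) → Dec (A ⊆ B)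
  ⊆-dec A B = FinP.all? λ v → (A v Data.Bool.≟ true) →-dec (B v Data.Bool.≟ true)

  anySub? : ∀ {N} {P : Sub N → Set} → (∀ A → Dec (P A)) → (∀ {A B} → (∀ v → A v ≡ B v) → P A → P B) → Dec (∃ P)
  anySub? {P = P} P? resp = Dec.map′
    (λ (xs , p) → lookup xs , p)
    (λ (A , p) → tabulate A , resp (λ v → sym (lookup∘tabulate A v)) p)
    (anySubset? (λ xs → P? (lookup xs)))

  ⊆-resp : ∀ {N} {A B V : Sub N} → (∀ v → A v ≡ B v) → A ⊆ V → B ⊆ V
  ⊆-resp h p v q = p v (trans (h v) q)

  private
    aux-arith-2 : ∀ (x y c d z w ee cc : ℤ) → ee ≡ x + y + z → cc ≡ c + d → x + 1ℤ ≤ c → y + w ≤ d → z ≤ w → ee + 1ℤ ≤ cc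
    aux-arith-2 x y c d z w _ _ refl refl h h′ h″ = by (h ⊞ h′ ⊞ h″) (solve (x ∷ y ∷ c ∷ d ∷ z ∷ w ∷ []))

    aux-arith-3 : ∀ (x y c d z ee cc : ℤ) → ee ≡ x + y + z → cc ≡ c + d → x + 1ℤ ≤ c → y + 1ℤ ≤ d → z ≤ 1ℤ → ee + 1ℤ ≤ cc
    aux-arith-3 x y c d z _ _ refl refl h h′ h″ = by (h ⊞ h′ ⊞ h″) (solve (x ∷ y ∷ c ∷ d ∷ z ∷ []))

    aux-arith-4 : ∀ (x y c d z ee cc : ℤ) → ee ≡ x + y + z → cc ≡ c + d → x + 1ℤ ≤ c → z ≤ 1ℤ → cc ≤ ee + 1ℤ → d ≤ y + 1ℤ
    aux-arith-4 x y c d z _ _ refl refl h h′ h″ = by (h ⊞ h′ ⊞ h″) (solve (x ∷ y ∷ c ∷ d ∷ z ∷ []))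

    aux-arith-5 : ∀ (x y c d z ee cc : ℤ) → ee ≡ x + y + z → cc ≡ c + d → y + 1ℤ ≤ d → z ≤ 1ℤ → cc ≤ ee + 1ℤ → c ≤ x + 1ℤ
    aux-arith-5 x y c d z _ _ refl refl h h′ h″ = by (h ⊞ h′ ⊞ h″) (solve (x ∷ y ∷ c ∷ d ∷ z ∷ []))

    aux-arith-6 : ∀ (x y c d z ee cc : ℤ) → ee ≡ x + y + z → cc ≡ c + d → x + 1ℤ ≤ c → y + 1ℤ ≤ d → z ≤ 0ℤ → cc ≤ ee + 1ℤ → ⊥
    aux-arith-6 x y c d z _ _ refl refl h h′ h″ t = 1≰0 (ℤP.≤-trans {j = z} (by (h ⊞ h′ ⊞ t) (solve (x ∷ y ∷ c ∷ d ∷ z ∷ []))) h″)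

    aux-arith-7 : ∀ (e₀ c e c₀ k : ℤ) → e ≡ e₀ + k → c ≡ 1ℤ + c₀ → e₀ + k ≤ c₀ → e + 1ℤ ≤ c
    aux-arith-7 e₀ _ _ c₀ k refl refl h = by h (solve (e₀ ∷ c₀ ∷ k ∷ []))

    aux-arith-8 : ∀ (e₀ c₀ k : ℤ) → e₀ + 1ℤ ≤ c₀ → k ≤ 1ℤ → e₀ + k ≤ c₀
    aux-arith-8 e₀ c₀ k h h′ = by (h ⊞ h′) (solve (e₀ ∷ c₀ ∷ k ∷ []))

    aux-arith-9 : ∀ (e₀ c e c₀ k : ℤ) → e ≡ e₀ + k → c ≡ 1ℤ + c₀ → e₀ + 1ℤ ≤ c₀ → c ≤ e + 1ℤ → 1ℤ ≤ k
    aux-arith-9 e₀ _ _ c₀ k refl refl h h′ = by (h ⊞ h′) (solve (e₀ ∷ c₀ ∷ k ∷ []))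

    aux-arith-10 : ∀ (e₀ c e c₀ k : ℤ) → e ≡ e₀ + k → c ≡ 1ℤ + c₀ → k ≤ 1ℤ → c ≤ e + 1ℤ → c₀ ≤ e₀ + 1ℤ
    aux-arith-10 e₀ _ _ c₀ k refl refl h h′ = by (h ⊞ h′) (solve (e₀ ∷ c₀ ∷ k ∷ []))

    extend-arith : ∀ (x y : ℤ) → y + 1ℤ ≤ x + 1ℤ → y ≤ x
    extend-arith x y h = by h (solve (x ∷ y ∷ []))

    extend-arith-2 : ∀ (x y k : ℤ) → y + 1ℤ ≤ x → x + 1ℤ ≤ y + k → + 2 ≤ k
    extend-arith-2 x y k h h′ = by (h ⊞ h′) (solve (x ∷ y ∷ k ∷ []))

  module _ {N : ℕ} (G : Graph N) where

    -- A cycle is a vertex set spanning at least as many edges as it has vertices, and a multigraph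
    -- without cycles has no such set. Parallel edges are excluded by the sets of size two.
    Forest : Sub N → Set
    Forest S = ∀ A → A ⊆ S → Nonempty A → e G A + 1ℤ ≤ card A

    -- A nonempty subset of a forest is a tree exactly when card A ≤ e A + 1.
    Light : ℕ → (Fin N → ℕ) → Sub N → Set
    Light s ω S = ∀ A → A ⊆ S → Nonempty A → e G A + 1ℤ ≤ card A × (card A ≤ e G A + 1ℤ → wt ω A ≤ + s)

    Colorable : ℕ → (Fin N → ℕ) → Sub N → Set
    Colorable s ω V = ∃ λ c → Light s ω (V ∩ c) × Forest (V ∖ c)

    Light-mono : ∀ {s ω ω′ S} → (∀ v → v ∈ S → ω v ℕ.≤ ω′ v) → Light s ω′ S → Light s ω S
    Light-mono h L A A⊆ ne = proj₁ (L A A⊆ ne) , λ t →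
      ℤP.≤-trans (∑-mono A λ v p → +≤+ (h v (A⊆ v p))) (proj₂ (L A A⊆ ne) t)

    Forest-⊆ : ∀ {S S′} → S′ ⊆ S → Forest S → Forest S′
    Forest-⊆ h F A A⊆ = F A (λ v p → h v (A⊆ v p))

    Light-⊆ : ∀ {s ω S S′} → S′ ⊆ S → Light s ω S → Light s ω S′
    Light-⊆ h F A A⊆ = F A (λ v p → h v (A⊆ v p))

    Adds : Sub N → Fin N → Sub N → Set
    Adds S u S′ = ∀ v → v ∈ S′ → v ≢ u → v ∈ S

    module _ {A : Sub N} {u : Fin N} (u∈A : u ∈ A) (none : ∀ v → (A -′ u) v ≡ false) where
      single-e : e G A ≡ 0ℤ
      single-e = trans (e-pt G u∈A) (cong₂ _+_ (e-∅ G none) (cr-∅ G u none))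

      single-card : card A ≡ 1ℤ
      single-card = trans (∑-pt (λ _ → 1ℤ) u∈A) (cong (λ x → 1ℤ + x) (∑-∅ none))

      single-∑ : ∀ f → ∑ A f ≡ f u
      single-∑ f = trans (∑-pt f u∈A) (trans (cong (λ x → f u + x) (∑-∅ none)) (ℤP.+-identityʳ _))

    -- A set through `u` has one vertex and `cr G u A` edges more than its rest `A`, so the strict
    -- bound on it is the non-strict bound asked of `A`.
    insert-forest : ∀ {S S′ u} → Adds S u S′ → Forest S →
      (∀ A → A ⊆ S → Nonempty A → e G A + cr G u A ≤ card A) → Forest S′
    insert-forest {S} {S′} {u} S′⊆ F ok A A⊆ ne with true⊎false (A u)
    ... | inj₂ u∉ = F A (λ v p → S′⊆ v (A⊆ v p) λ { refl → true≢false p u∉ }) ne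
    ... | inj₁ u∈ with find (A -′ u)
    ...   | inj₁ ne′ = aux-arith-7 (e G (A -′ u)) (card A) (e G A) (card (A -′ u)) (cr G u (A -′ u)) (e-pt G u∈) (∑-pt (λ _ → 1ℤ) u∈) (ok (A -′ u) (λ v p → S′⊆ v (A⊆ v (-′-⊆ {A = A} u v p)) (-′-≢ A p)) ne′)
    ...   | inj₂ none = ℤP.≤-trans (eq (cong (_+ 1ℤ) (single-e u∈ none))) (eq′ (single-card u∈ none))

    -- If a set through `u` is a tree then, since `u` has at most one edge to the rest, that edge
    -- exists and the rest is a tree too. The weight of `u` is therefore charged only against trees
    -- that `u` really touches.
    insert-light : ∀ {s ω S S′ u} → Adds S u S′ → Light s ω S → ω u ℕ.≤ s →
      (∀ A → A ⊆ S → Nonempty A → cr G u A ≤ 1ℤ × (1ℤ ≤ cr G u A → card A ≤ e G A + 1ℤ → + ω u + wt ω A ≤ + s)) → Light s ω S′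
    insert-light {s} {ω} {S} {S′} {u} S′⊆ L ωu ok A A⊆ ne with true⊎false (A u)
    ... | inj₂ u∉ = L A (λ v p → S′⊆ v (A⊆ v p) λ { refl → true≢false p u∉ }) ne
    ... | inj₁ u∈ with find (A -′ u)
    ...   | inj₁ ne′ = aux-arith-7 e₀ (card A) (e G A) c₀ k₀ (e-pt G u∈) (∑-pt (λ _ → 1ℤ) u∈) (aux-arith-8 e₀ c₀ k₀ f k) , λ t →
              subst (_≤ + s) (sym (∑-pt _ u∈)) (w (aux-arith-9 e₀ (card A) (e G A) c₀ k₀ (e-pt G u∈) (∑-pt (λ _ → 1ℤ) u∈) f t) (aux-arith-10 e₀ (card A) (e G A) c₀ k₀ (e-pt G u∈) (∑-pt (λ _ → 1ℤ) u∈) k t))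
      where
      e₀ = e G (A -′ u)
      c₀ = card (A -′ u)
      k₀ = cr G u (A -′ u)
      A₀⊆ : A -′ u ⊆ S
      A₀⊆ v p = S′⊆ v (A⊆ v (-′-⊆ {A = A} u v p)) (-′-≢ A p)
      f = proj₁ (L (A -′ u) A₀⊆ ne′)
      k = proj₁ (ok (A -′ u) A₀⊆ ne′)
      w = proj₂ (ok (A -′ u) A₀⊆ ne′)
    ...   | inj₂ none = ℤP.≤-trans (eq (cong (_+ 1ℤ) (single-e u∈ none))) (eq′ (single-card u∈ none)) , λ _ →
              subst (_≤ + s) (sym (single-∑ u∈ none _)) (+≤+ ωu)

    -- If `u` cannot join, some `A` has `|A| + 1 ≤ e(A) + cr u A`; against `e(A) + 1 ≤ |A|` this
    -- leaves two edges from `u` to `A`. All colour extensions rest on this dichotomy: a vertex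
    -- refused by F has spent two edges on F and has few left for M.
    extend : ∀ S u → Forest S → (∀ S′ → Adds S u S′ → Forest S′) ⊎ + 2 ≤ cr G u S
    extend S u F with anySub? {P = λ A → A ⊆ S × card A + 1ℤ ≤ e G A + cr G u A}
        (λ A → ⊆-dec A S ×-dec (card A + 1ℤ ≤? e G A + cr G u A))
        (λ h (p , q) → ⊆-resp h p , subst₂ _≤_ (cong (_+ 1ℤ) (∑-set h)) (cong₂ _+_ (e-cong G h) (∑-set h)) q)
    ... | no none = inj₁ λ S′ S′⊆ → insert-forest S′⊆ F λ A A⊆ _ → small A A⊆
      where
      small : ∀ A → A ⊆ S → e G A + cr G u A ≤ card A
      small A A⊆ = extend-arith (card A) (e G A + cr G u A) (≰⇒+1≤ λ q → none (A , A⊆ , q))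
    ... | yes (A , A⊆ , q) with find A
    ...   | inj₁ ne = inj₂ (ℤP.≤-trans (extend-arith-2 (card A) (e G A) (cr G u A) (F A A⊆ ne) q) (cr-⊆ G u A⊆))
    ...   | inj₂ none = ⊥-elim (1≰0 (subst₂ _≤_ (cong (_+ 1ℤ) (∑-∅ {f = λ _ → 1ℤ} none)) (cong₂ _+_ (e-∅ G none) (cr-∅ G u none)) q))

    Light-≤ : ∀ {s ω S v} → Light s ω S → v ∈ S → ω v ℕ.≤ s
    Light-≤ {s} {ω} {S} {v} L v∈ = ℤP.drop‿+≤+ (subst (_≤ + s) (∑-⁅⁆ v _) (proj₂ (L ⁅ v ⁆ sub (v , ==-refl v)) (eq (trans (∑-⁅⁆ v _) (sym (cong (_+ 1ℤ) (e-⁅⁆ G v)))))))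
      where
      sub : ⁅ v ⁆ ⊆ S
      sub w p = subst (_∈ S) (sym (==⇒≡ p)) v∈

    module _ {A₀ : Sub N} where

      ∖-empty : ∀ {A} → (∀ v → (A ∖ A₀) v ≡ false) → ∀ v → (A ∩ A₀) v ≡ A v
      ∖-empty {A} h v with A v | A₀ v | h v
      ... | true | true | _ = refl
      ... | false | _ | _ = refl

      -- The condition on `B` says that `S₂` remains a forest when all of `S₁` is shrunk to one
      -- additional vertex.
      glue-forest : ∀ {S₁ S₂ S} → (∀ v → v ∈ S → v ∈ A₀ → v ∈ S₁) → (∀ v → v ∈ S → A₀ v ≡ false → v ∈ S₂) →
        Forest S₁ → Forest S₂ → (∀ B → B ⊆ S₂ → e G B + cross G B S₁ ≤ card B) → Forest S
      glue-forest {S₁} {S₂} {S} l r F₁ F₂ ok A A⊆ (v , v∈) with find (A ∩ A₀)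
      ... | inj₁ ne = aux-arith-2 (e G (A ∩ A₀)) (e G (A ∖ A₀)) (card (A ∩ A₀)) (card (A ∖ A₀)) (cross G (A ∩ A₀) (A ∖ A₀)) (cross G (A ∖ A₀) S₁) (e G A) (card A) (e-split G A A₀) (∑-split A A₀ _) (F₁ (A ∩ A₀) l′ ne) (ok (A ∖ A₀) r′)
              (subst (_≤ cross G (A ∖ A₀) S₁) (cross-comm G (A ∖ A₀) (A ∩ A₀)) (cross-⊆ G (λ _ p → p) l′))
        where
        l′ : A ∩ A₀ ⊆ S₁
        l′ w p = l w (A⊆ w (proj₁ (∧-true p))) (proj₂ (∧-true p))
        r′ : A ∖ A₀ ⊆ S₂
        r′ w p = r w (A⊆ w (proj₁ (∧-true p))) (not-true (proj₂ (∧-true p)))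
      ... | inj₂ none = F₂ A (λ w p → r w (A⊆ w p) (≢true λ q → true≢false (∧-intro p q) (none w))) (v , v∈)

      -- Two nonempty pieces without an edge between them never form a tree, so no weight has to be
      -- bounded. Joined by a single edge, they form a tree only if both are trees, and then their
      -- weights add up.
      glue-light : ∀ {s ω S₁ S₂ S} → (∀ v → v ∈ S → v ∈ A₀ → v ∈ S₁) → (∀ v → v ∈ S → A₀ v ≡ false → v ∈ S₂) →
        Light s ω S₁ → Light s ω S₂ →
        (∀ A B → A ⊆ S₁ → B ⊆ S₂ → cross G A B ≤ 0ℤ ⊎ (cross G A B ≤ 1ℤ × (Nonempty A → Nonempty B → card A ≤ e G A + 1ℤ → card B ≤ e G B + 1ℤ → wt ω A + wt ω B ≤ + s))) →
        Light s ω S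
      glue-light {s} {ω} {S₁} {S₂} {S} l r L₁ L₂ ok A A⊆ (v , v∈) with find (A ∩ A₀) | find (A ∖ A₀)
      ... | inj₂ none | _ = L₂ A (λ w p → r w (A⊆ w p) (≢true λ q → true≢false (∧-intro p q) (none w))) (v , v∈)
      ... | inj₁ _ | inj₂ none = L₁ A (λ w p → l w (A⊆ w p) (in-A₀ w p)) (v , v∈)
        where
        in-A₀ : ∀ w → w ∈ A → w ∈ A₀
        in-A₀ w p = proj₂ (∧-true (trans (∖-empty {A} none w) p))
      ... | inj₁ ne | inj₁ ne′ = go (ok (A ∩ A₀) (A ∖ A₀) l′ r′)
        where
        l′ : A ∩ A₀ ⊆ S₁
        l′ w p = l w (A⊆ w (proj₁ (∧-true p))) (proj₂ (∧-true p))
        r′ : A ∖ A₀ ⊆ S₂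
        r′ w p = r w (A⊆ w (proj₁ (∧-true p))) (not-true (proj₂ (∧-true p)))
        x₀ = e G (A ∩ A₀)
        y₀ = e G (A ∖ A₀)
        c₀ = card (A ∩ A₀)
        d₀ = card (A ∖ A₀)
        z₀ = cross G (A ∩ A₀) (A ∖ A₀)
        f₁ = proj₁ (L₁ (A ∩ A₀) l′ ne)
        f₂ = proj₁ (L₂ (A ∖ A₀) r′ ne′)
        es = e-split G A A₀
        cs = ∑-split A A₀ (λ _ → 1ℤ)
        go : z₀ ≤ 0ℤ ⊎ (z₀ ≤ 1ℤ × (Nonempty (A ∩ A₀) → Nonempty (A ∖ A₀) → c₀ ≤ x₀ + 1ℤ → d₀ ≤ y₀ + 1ℤ → wt ω (A ∩ A₀) + wt ω (A ∖ A₀) ≤ + s)) →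
          e G A + 1ℤ ≤ card A × (card A ≤ e G A + 1ℤ → wt ω A ≤ + s)
        go (inj₁ z) = aux-arith-3 x₀ y₀ c₀ d₀ z₀ (e G A) (card A) es cs f₁ f₂ (ℤP.≤-trans z (0≤ 1)) , λ t → ⊥-elim (aux-arith-6 x₀ y₀ c₀ d₀ z₀ (e G A) (card A) es cs f₁ f₂ z t)
        go (inj₂ (z , w)) = aux-arith-3 x₀ y₀ c₀ d₀ z₀ (e G A) (card A) es cs f₁ f₂ z , λ t →
          subst (_≤ + s) (sym (∑-split A A₀ _)) (w ne ne′ (aux-arith-5 x₀ y₀ c₀ d₀ z₀ (e G A) (card A) es cs f₂ z t) (aux-arith-4 x₀ y₀ c₀ d₀ z₀ (e G A) (card A) es cs f₁ z t))

  -- Potentials and sets of small potential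

  -- pot h is the potential of a vertex of weight h; weights above s force a vertex into F. The field raise splits the budget s between
  -- the two ends of an edge leaving a set of potential p: its inner end gains weight i, its outer end s - i.
  record Params : Set where
    field
      s : ℕ
      K : ℤ
      pot : ℕ → ℤ
      s≤K : + s ≤ K
      1≤s : 1 ℕ.≤ s
      pot-lo : ∀ h → K - 1ℤ ≤ pot h
      pot-hi : ∀ h → 1 ℕ.≤ h → pot h ≤ K + K - 1ℤ
      pot-step : ∀ h j → pot h ≤ pot (h ℕ.+ j) + + 2 * + j
      pot-small : ∀ h → 1 ℕ.≤ h → + 2 * + h ≤ + s → pot h ≡ K + K + 1ℤ - + 2 * + h
      pot-top : ∀ h → s ℕ.< h → pot h ≡ K - 1ℤ
      raise : ∀ p → ℤ.-1ℤ ≤ p → p ≤ K - 1ℤ → ∃ λ i → i ℕ.≤ s ×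
        (∀ h → 1 ℕ.≤ h → pot h ≤ pot (h ℕ.+ i) + (p + 1ℤ)) ×
        (∀ h → 1 ℕ.≤ h → pot h ≤ pot (h ℕ.+ (s ℕ.∸ i)) + (K - p))

  private
    bound-arith : ∀ x y z → x ≡ y + z → z ≤ 0ℤ → x ≤ y
    bound-arith x y z refl h = by h (solve (y ∷ z ∷ []))

    go-arith : ∀ x y s w h z y′ → w + x ≤ h → y ≡ w + z → y′ ≡ h + z → y′ ≤ s → x + y ≤ s
    go-arith x y s w h z y′ h₁ refl refl h₂ = by (h₁ ⊞ h₂) (solve (x ∷ s ∷ w ∷ h ∷ z ∷ []))

    noF-eq : ∀ x → x + 1ℤ ≤ 1ℤ → x ≤ 0ℤ
    noF-eq x h = by h (solve (x ∷ []))

    wbound-arith : ∀ c y z w → c ≡ y + w → c ≤ 1ℤ → 1ℤ ≤ y → 1ℤ ≤ z → z ≤ w → 1ℤ ≤ 0ℤ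
    wbound-arith c y z w refl h₁ h₂ h₃ h₄ = ℤP.≤-trans {j = z} h₃ (by (h₁ ⊞ h₂ ⊞ h₄) (solve (y ∷ z ∷ w ∷ [])))

    wbound-arith-2 : ∀ w t d i s t′ r x x′ → d + i ≡ s → t ≡ x + r → t′ ≡ x′ + r → x′ ≡ x + i → t′ ≤ s → w + t ≤ w + d
    wbound-arith-2 w t d i s t′ r x x′ refl refl refl refl h = by h (solve (w ∷ d ∷ i ∷ r ∷ x ∷ []))

    attach-arith : ∀ x y b z d → x ≡ b + z → y ≡ d + 1ℤ → x + 1ℤ ≤ y → b + z ≤ d
    attach-arith x y b z d refl refl h = by h (solve (b ∷ z ∷ d ∷ []))

    attach-arith-2 : ∀ x y z → y ≡ 0ℤ → x + 1ℤ ≤ z → x + y ≤ z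
    attach-arith-2 x y z refl h = by (h ⊞ 0≤ 1) (solve (x ∷ z ∷ []))

    1≤cr-arith : ∀ c a b → c ≡ a + b → 1ℤ ≤ a → 0ℤ ≤ b → 1ℤ ≤ c
    1≤cr-arith c a b refl h h′ = by (h ⊞ h′) (solve (a ∷ b ∷ []))

    go-arith-2 : ∀ k p x y z → x ≤ k + k - 1ℤ → k - 1ℤ ≤ y → p ≤ k - 1ℤ → k * + 2 ≤ z → x ≤ y + (z - p)
    go-arith-2 k p x y z h₁ h₂ h₃ h₄ = by (h₁ ⊞ h₂ ⊞ h₃ ⊞ h₄ ⊞ 0≤ 1) (solve (k ∷ p ∷ x ∷ y ∷ z ∷ []))

    go-arith-3 : ∀ k p x y z → x ≤ y + (k - p) → k ≤ z → x ≤ y + (z - p)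
    go-arith-3 k p x y z h₁ h₂ = by (h₁ ⊞ h₂) (solve (k ∷ p ∷ x ∷ y ∷ z ∷ []))

    smaller-arith : ∀ c v a b → v ≡ a + b → c ≡ b + 1ℤ → + 2 ≤ a → c + 1ℤ ≤ v
    smaller-arith c v a b refl refl h = by h (solve (a ∷ b ∷ []))

    valid-off-arith : ∀ k r p z → ℤ.-1ℤ ≤ r → p ≤ k - 1ℤ → k ≤ z → ℤ.-1ℤ ≤ r - p + z
    valid-off-arith k r p z h h′ h″ = by (h ⊞ h′ ⊞ h″ ⊞ 0≤ 1) (solve (k ∷ r ∷ p ∷ z ∷ []))

    valid-off-arith-2 : ∀ r p z → p ≤ r → 0ℤ ≤ z → ℤ.-1ℤ ≤ r - p + z
    valid-off-arith-2 r p z h h′ = by (h ⊞ h′ ⊞ 0≤ 1) (solve (r ∷ p ∷ z ∷ []))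

    valid-on-arith : ∀ k r p z y b q s t → ℤ.-1ℤ ≤ r → p ≤ k - 1ℤ → r - p + k * z ≤ y - k * b → s ≡ q + y → t ≡ b + z → k - 1ℤ ≤ q → ℤ.-1ℤ ≤ s - k * t
    valid-on-arith k r p z y b q s t h h′ h″ refl refl l = by (h ⊞ h′ ⊞ h″ ⊞ l) (solve (k ∷ r ∷ p ∷ z ∷ y ∷ b ∷ q ∷ []))

    smaller-arith-2 : ∀ v a b → v ≡ a + b → + 2 ≤ a → b + 1ℤ ≤ v
    smaller-arith-2 v a b refl h = by (h ⊞ 0≤ 1) (solve (a ∷ b ∷ []))

    valid′-arith : ∀ k r p x h c y y₁ m₀ m f cm cf s s′ b → ℤ.-1ℤ ≤ r → x ≤ h + (k * c - p) → r ≡ p + (s - k * b) - k * (m + f) → y ≤ y₁ + k * m₀ →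
      s ≡ x + y → s′ ≡ h + y₁ → m ≡ cm + m₀ → f ≡ 0ℤ → c ≡ cm + cf → cf ≡ 0ℤ → ℤ.-1ℤ ≤ s′ - k * b
    valid′-arith k r p x h c y y₁ m₀ m f cm cf s s′ b h₁ h₂ refl h₃ refl refl refl refl refl refl =
      by (h₁ ⊞ h₂ ⊞ h₃) (solve (k ∷ p ∷ x ∷ h ∷ y ∷ y₁ ∷ m₀ ∷ cm ∷ b ∷ []))

    validA-arith : ∀ k p r x x′ y b s s′ → p ≤ r → x ≤ x′ + (p + 1ℤ) → r ≡ s - k * b → s ≡ x + y → s′ ≡ x′ + y → ℤ.-1ℤ ≤ s′ - k * b
    validA-arith k p r x x′ y b s s′ h h′ refl refl refl = by (h ⊞ h′) (solve (k ∷ p ∷ x ∷ x′ ∷ y ∷ b ∷ []))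

    attach-arith-3 : ∀ x y z → y ≤ 0ℤ → x + 1ℤ ≤ z → x + y ≤ z
    attach-arith-3 x y z h′ h = by (h ⊞ h′ ⊞ 0≤ 1) (solve (x ∷ y ∷ z ∷ []))

    pot-conv-arith : ∀ x y → 0ℤ ≤ y → x ≤ x + y
    pot-conv-arith x y h = by h (solve (x ∷ y ∷ []))

    pot-conv-arith-2 : ∀ k x y z → x ≤ k + k - 1ℤ → k - 1ℤ ≤ y → k ≤ z → x ≤ y + z
    pot-conv-arith-2 k x y z h h′ h″ = by (h ⊞ h′ ⊞ h″) (solve (k ∷ x ∷ y ∷ z ∷ []))

    ρ-∪-eq : ∀ x y k a b c → (x + y) - k * (a + b + c) ≡ (x - k * a) + (y - k * b) - k * c
    ρ-∪-eq = solve-∀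

    outer-arith : ∀ r p k x y b m f → r ≡ p + (x - k * b) - k * (m + f) → x ≤ y + k * m → r - p + k * f ≤ y - k * b
    outer-arith r p k x y b m f refl h = by h (solve (p ∷ k ∷ x ∷ y ∷ b ∷ m ∷ f ∷ []))

    A-smaller-arith : ∀ v a b → v ≡ a + b → 1ℤ ≤ b → a + 1ℤ ≤ v
    A-smaller-arith v a b refl h = by h (solve (a ∷ b ∷ []))

    single-ρ-eq : ∀ x k → x - k * 0ℤ ≡ x
    single-ρ-eq = solve-∀

    single-valid-arith : ∀ k → 1ℤ ≤ k → ℤ.-1ℤ ≤ k - 1ℤ
    single-valid-arith k h = by (h ⊞ 0≤ 1) (solve (k ∷ []))

  module Reduction (P : Params) {N : ℕ} where
    open Params P public

    K≥1 : 1ℤ ≤ K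
    K≥1 = ℤP.≤-trans (+≤+ 1≤s) s≤K

    Pos : (Fin N → ℕ) → Set
    Pos ω = ∀ v → 1 ℕ.≤ ω v

    ρ : Graph N → (Fin N → ℕ) → Sub N → ℤ
    ρ G ω A = ∑ A (λ v → pot (ω v)) - K * e G A

    Valid : Graph N → (Fin N → ℕ) → Sub N → Set
    Valid G ω V = ∀ A → A ⊆ V → ℤ.-1ℤ ≤ ρ G ω A

    IH : Sub N → Set
    IH V = ∀ V′ G ω → card V′ + 1ℤ ≤ card V → Pos ω → Valid G ω V′ → Colorable G s ω V′

    K*-mono : ∀ {x y} → x ≤ y → K * x ≤ K * y
    K*-mono = *-monoˡ (ℤP.≤-trans (0≤ 1) K≥1)

    K≤K* : ∀ {x} → 1ℤ ≤ x → K ≤ K * x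
    K≤K* {x} h = subst (_≤ K * x) (ℤP.*-identityʳ K) (K*-mono h)

    single-ρ : ∀ G {ω A u} → u ∈ A → (∀ v → (A -′ u) v ≡ false) → ρ G ω A ≡ pot (ω u)
    single-ρ G {ω} {A} {u} p none = trans (cong₂ (λ x y → x - K * y) (single-∑ G p none _) (single-e G p none)) (single-ρ-eq (pot (ω u)) K)

    single-valid : ∀ G {ω A u} → u ∈ A → (∀ v → (A -′ u) v ≡ false) → ℤ.-1ℤ ≤ ρ G ω A
    single-valid G {ω} {A} {u} p none = subst (ℤ.-1ℤ ≤_) (sym (single-ρ G p none)) (ℤP.≤-trans (single-valid-arith K K≥1) (pot-lo (ω u)))

    -- `min` compares `A` only with sets that miss a vertex of `V`; the potential of `V` itself may
    -- be smaller. Every use below must therefore exhibit a missed vertex.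
    module Dense (G : Graph N) (ω : Fin N → ℕ) (V : Sub N) (pos : Pos ω) (valid : Valid G ω V) (ih : IH V)
      (A : Sub N) (A⊆V : A ⊆ V) (2≤A : + 2 ≤ card A) (ρA≤ : ρ G ω A ≤ K - 1ℤ)
      (min : ∀ B → B ⊆ V → + 2 ≤ card B → ∀ w → w ∈ V → B w ≡ false → ρ G ω A ≤ ρ G ω B) where

      p : ℤ
      p = ρ G ω A

      disj : ∀ {B} → B ⊆ V ∖ A → ∀ v → v ∈ A → B v ≡ false
      disj B⊆ v v∈A = ≢true λ q → true≢false v∈A (not-true (proj₂ (∧-true (B⊆ v q))))

      ∪⊆V : ∀ {B} → B ⊆ V ∖ A → A ∪ B ⊆ V
      ∪⊆V B⊆ v q with ∨-true q
      ... | inj₁ x = A⊆V v x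
      ... | inj₂ x = proj₁ (∧-true (B⊆ v x))

      2≤∪ : ∀ {B} → + 2 ≤ card (A ∪ B)
      2≤∪ {B} = ℤP.≤-trans 2≤A (∑-⊆ (λ v q → cong (_∨ B v) q) λ _ _ → 0≤ 1)

      proper : ∀ {B} → B ⊆ V ∖ A → ∀ {w} → w ∈ V ∖ A → B w ≡ false → p ≤ ρ G ω (A ∪ B)
      proper {B} B⊆ {w} w∈ w∉ = min (A ∪ B) (∪⊆V B⊆) 2≤∪ w (proj₁ (∧-true w∈)) (cong₂ _∨_ (not-true (proj₂ (∧-true w∈))) w∉)

      card-V : card V ≡ card A + card (V ∖ A)
      card-V = ∑-sub _ A⊆V

      module Coloured (cA : Sub N) (LA : Light G s ω (A ∩ cA)) (FA : Forest G (A ∖ cA)) where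

        M F : Sub N
        M = A ∩ cA
        F = A ∖ cA

        -- The outer vertices with a neighbour in M. Giving them weight `s + 1` forces them into F,
        -- so that no tree of M leaves `A` through them.
        conv : Sub N
        conv v = does (1ℤ ≤? cr G v M)

        conv-false : ∀ {v} → conv v ≡ false → cr G v M ≤ 0ℤ
        conv-false {v} h with 1ℤ ≤? cr G v M
        ... | no k = noF-eq (cr G v M) (≰⇒+1≤ k)

        conv-true : ∀ {v} → conv v ≡ true → 1ℤ ≤ cr G v M
        conv-true {v} h with 1ℤ ≤? cr G v M
        ... | yes k = k

        ω₁ : Fin N → ℕ
        ω₁ v = if conv v then suc s else ω v

        ω₁-pos : Pos ω₁
        ω₁-pos v with conv v
        ... | true = s≤s z≤n
        ... | false = pos v

        -- All values of `pot` at positive weights lie between `K - 1` and `2K - 1`, so forcing a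
        -- vertex costs at most `K`, which one edge to M repays.
        pot-conv : ∀ v → pot (ω v) ≤ pot (ω₁ v) + K * cr G v M
        pot-conv v with conv v in q
        ... | false = pot-conv-arith (pot (ω v)) (K * cr G v M) (*-nn (ℤP.≤-trans (0≤ 1) K≥1) (cr-nn G v M))
        ... | true = pot-conv-arith-2 K (pot (ω v)) (pot (suc s)) (K * cr G v M) (pot-hi (ω v) (pos v)) (pot-lo (suc s)) (K≤K* (conv-true q))

        cr-MF : ∀ v → cr G v A ≡ cr G v M + cr G v F
        cr-MF v = ∑-split A cA _

        cross-MF : ∀ B → cross G B A ≡ cross G B M + cross G B F
        cross-MF B = cross-splitʳ G B A cA

        conv-bound : ∀ B → ∑ B (λ v → pot (ω v)) ≤ ∑ B (λ v → pot (ω₁ v)) + K * cross G B M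
        conv-bound B = ℤP.≤-trans (∑-mono B λ v _ → pot-conv v) (eq (trans (∑-+ B _ _) (cong (λ x → ∑ B (λ v → pot (ω₁ v)) + x) (∑-* B K _))))

        ρ-∪ : ∀ {B} → B ⊆ V ∖ A → ρ G ω (A ∪ B) ≡ p + (∑ B (λ v → pot (ω v)) - K * e G B) - K * (cross G B M + cross G B F)
        ρ-∪ {B} B⊆ = trans (cong₂ (λ x y → x - K * y) (∑-∪ A B _ (disj B⊆)) (trans (e-∪ G A B (disj B⊆)) (cong (λ x → e G A + e G B + x) (trans (cross-comm G A B) (cross-MF B)))))
            (ρ-∪-eq (∑ A _) (∑ B _) K (e G A) (e G B) (cross G B M + cross G B F))

        -- In `ρ(A ∪ B)` the edges from `B` to M have already been subtracted, and they pay for the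
        -- forcing. The edges to F are kept on the left as credit.
        outer : ∀ {B} → B ⊆ V ∖ A → ρ G ω (A ∪ B) - p + K * cross G B F ≤ ρ G ω₁ B
        outer {B} B⊆ = outer-arith (ρ G ω (A ∪ B)) p K (∑ B (λ v → pot (ω v))) (∑ B (λ v → pot (ω₁ v))) (e G B) (cross G B M) (cross G B F) (ρ-∪ B⊆) (conv-bound B)

        colouring : Sub N → Sub N
        colouring c v = if A v then cA v else c v

        colouring-M : ∀ {c v} → v ∈ V ∩ colouring c → v ∈ A → v ∈ M
        colouring-M {c} {v} h q with A v
        colouring-M {c} {v} h refl | true = proj₂ (∧-true h)

        colouring-M′ : ∀ {c v} → v ∈ V ∩ colouring c → A v ≡ false → v ∈ (V ∖ A) ∩ c
        colouring-M′ {c} {v} h q with A v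
        colouring-M′ {c} {v} h refl | false with V v
        colouring-M′ {c} {v} h refl | false | true = h

        colouring-F : ∀ {c v} → v ∈ V ∖ colouring c → v ∈ A → v ∈ F
        colouring-F {c} {v} h q with A v
        colouring-F {c} {v} h refl | true = proj₂ (∧-true h)

        colouring-F′ : ∀ {c v} → v ∈ V ∖ colouring c → A v ≡ false → v ∈ (V ∖ A) ∖ c
        colouring-F′ {c} {v} h q with A v
        colouring-F′ {c} {v} h refl | false with V v
        colouring-F′ {c} {v} h refl | false | true = h

        -- Case in which an outer vertex `v₁` touches F. All of F is shrunk to `f`, whose weight
        -- `s + 1` puts it into F again, so cycles running through `A` are seen in the quotient.
        module ToF (f : Fin N) (f∈F : f ∈ F) (v₁ : Fin N) (v₁∈ : v₁ ∈ V ∖ A) (touch : 1ℤ ≤ cr G v₁ F) where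

          f∈A : f ∈ A
          f∈A = proj₁ (∧-true f∈F)

          G′ : Graph N
          G′ = contract G F f

          ω′ : Fin N → ℕ
          ω′ v = if v == f then suc s else ω₁ v

          ω′-f : ω′ f ≡ suc s
          ω′-f rewrite ==-refl f = refl

          ω′-≢ : ∀ {v} → v ≢ f → ω′ v ≡ ω₁ v
          ω′-≢ n rewrite ≢⇒== n = refl

          ω′-pos : Pos ω′
          ω′-pos v with v == f
          ... | true = s≤s z≤n
          ... | false = ω₁-pos v

          V′ : Sub N
          V′ = (V ∖ A) ∪ ⁅ f ⁆

          f∉B : ∀ {B} → B ⊆ V ∖ A → B f ≡ false
          f∉B B⊆ = disj B⊆ f f∈A

          ≢f : ∀ {B v} → B ⊆ V ∖ A → v ∈ B → v ≢ f
          ≢f B⊆ q refl = true≢false q (f∉B B⊆)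

          smaller : card V′ + 1ℤ ≤ card V
          smaller = smaller-arith (card V′) (card V) (card A) (card (V ∖ A)) card-V
              (trans (∑-∪ (V ∖ A) ⁅ f ⁆ _ λ v q → ≢⇒== (≢f (λ _ x → x) q)) (cong (λ x → card (V ∖ A) + x) (∑-⁅⁆ f _))) 2≤A

          ρ-off : ∀ {B} → B ⊆ V ∖ A → ρ G′ ω′ B ≡ ρ G ω₁ B
          ρ-off {B} B⊆ = cong₂ (λ x y → x - K * y) (∑-cong B λ v q → cong pot (ω′-≢ (≢f B⊆ q))) (e-contract G F f B (f∉B B⊆))

          valid-off : ∀ {B} → B ⊆ V ∖ A → ℤ.-1ℤ ≤ ρ G ω₁ B
          valid-off {B} B⊆ with ≤⊎+1≤ (cross G B F) 0ℤ
          -- One edge from `B` to F is credit `K`, more than the `p ≤ K - 1` lost with `A`.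
          ... | inj₂ h = ℤP.≤-trans (valid-off-arith K (ρ G ω (A ∪ B)) p (K * cross G B F) (valid _ (∪⊆V B⊆)) ρA≤ (K≤K* h)) (outer B⊆)
          -- Without such an edge `B` misses `v₁`, so `A ∪ B` is proper and minimality gives
          -- `p ≤ ρ(A ∪ B)`.
          ... | inj₁ h = ℤP.≤-trans (valid-off-arith-2 (ρ G ω (A ∪ B)) p (K * cross G B F) (proper B⊆ v₁∈ v₁∉) (*-nn (ℤP.≤-trans (0≤ 1) K≥1) (cross-nn G B F))) (outer B⊆)
            where
            v₁∉ : B v₁ ≡ false
            v₁∉ = ≢true λ q → 1≰0 (ℤP.≤-trans touch (ℤP.≤-trans (subst (_≤ cross G B F) (∑-⁅⁆ v₁ _) (∑-⊆ (λ w r → subst (_∈ B) (sym (==⇒≡ r)) q) λ w _ → cr-nn G w F)) h))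

          valid-on : ∀ {B} → B ⊆ V′ → f ∈ B → ℤ.-1ℤ ≤ ρ G′ ω′ B
          -- The vertex `f` stands in for `A`: its potential is at least `K - 1`, hence at least
          -- `p`, and it keeps all the edges to F.
          valid-on {B} B⊆ f∈B = valid-on-arith K (ρ G ω (A ∪ B₀)) p (cross G B₀ F) (∑ B₀ (λ v → pot (ω₁ v))) (e G B₀) (pot (ω′ f)) (∑ B _) (e G′ B)
              (valid _ (∪⊆V B₀⊆)) ρA≤ (outer B₀⊆)
              (trans (∑-pt _ f∈B) (cong (λ x → pot (ω′ f) + x) (∑-cong B₀ λ v q → cong pot (ω′-≢ (≢f B₀⊆ q)))))
              (trans (e-pt G′ f∈B) (cong₂ _+_ (e-contract G F f B₀ (f∉B B₀⊆)) (cr-contract G F f B₀ (f∉B B₀⊆)))) (pot-lo (ω′ f))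
            where
            B₀ = B -′ f
            B₀⊆ : B₀ ⊆ V ∖ A
            B₀⊆ v q with ∨-true (B⊆ v (-′-⊆ {A = B} f v q))
            ... | inj₁ x = x
            ... | inj₂ x = ⊥-elim (-′-≢ B q (==⇒≡ x))

          valid′ : Valid G′ ω′ V′
          valid′ B B⊆ with true⊎false (B f)
          ... | inj₁ q = valid-on B⊆ q
          ... | inj₂ q = subst (ℤ.-1ℤ ≤_) (sym (ρ-off B⊆′)) (valid-off B⊆′)
            where
            B⊆′ : B ⊆ V ∖ A
            B⊆′ v r with ∨-true (B⊆ v r)
            ... | inj₁ x = x
            ... | inj₂ x = ⊥-elim (true≢false (subst (_∈ B) (==⇒≡ x) r) q)

          result : Colorable G s ω V
          result with ih V′ G′ ω′ smaller ω′-pos valid′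
          ... | c , L , Fo = colouring c , light , forest
            where
            MB⊆ : (V ∖ A) ∩ c ⊆ V′ ∩ c
            MB⊆ v q = ∩⁺ V′ c (∪ˡ (V ∖ A) ⁅ f ⁆ (proj₁ (∩⁻ (V ∖ A) c q))) (proj₂ (∩⁻ (V ∖ A) c q))
            MB-V : (V ∖ A) ∩ c ⊆ V ∖ A
            MB-V v q = proj₁ (∧-true q)
            FB⊆ : (V ∖ A) ∖ c ⊆ V′ ∖ c
            FB⊆ v q = ∖⁺ V′ c (∪ˡ (V ∖ A) ⁅ f ⁆ (proj₁ (∖⁻ (V ∖ A) c q))) (proj₂ (∖⁻ (V ∖ A) c q))
            ω-M : ∀ v → v ∈ (V ∖ A) ∩ c → conv v ≡ false
            ω-M v q = ≢true λ x → ℕP.1+n≰n (subst (ℕ._≤ s) (trans (ω′-≢ (≢f MB-V q)) (cong (λ b → if b then suc s else ω v) x)) (Light-≤ G′ L (MB⊆ v q)))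
              where import Data.Nat.Properties as ℕP
            L₂ : Light G s ω ((V ∖ A) ∩ c)
            L₂ B B⊆ ne = subst (λ x → x + 1ℤ ≤ card B × (card B ≤ x + 1ℤ → wt ω B ≤ + s)) (e-contract G F f B (f∉B (λ v q → MB-V v (B⊆ v q))))
              (proj₁ l , λ t → ℤP.≤-trans (eq (∑-cong B λ v q → cong +_ (sym (trans (ω′-≢ (≢f MB-V (B⊆ v q))) (cong (λ b → if b then suc s else ω v) (ω-M v (B⊆ v q))))))) (proj₂ l t))
              where l = L B (λ v q → MB⊆ v (B⊆ v q)) ne
            light : Light G s ω (V ∩ colouring c)
            light = glue-light G {A₀ = A} (λ v → colouring-M {c}) (λ v → colouring-M′ {c}) LA L₂ λ A₁ B₁ A₁⊆ B₁⊆ → inj₁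
              (subst (_≤ 0ℤ) (cross-comm G B₁ A₁) (ℤP.≤-trans (cross-⊆ G (λ _ q → q) A₁⊆) (subst (cross G B₁ M ≤_) (∑-0 B₁) (∑-mono B₁ λ v q → conv-false (ω-M v (B₁⊆ v q))))))
            f∉c : c f ≡ false
            f∉c = ≢true λ x → ℕP.1+n≰n (subst (ℕ._≤ s) ω′-f (Light-≤ G′ L (∩⁺ V′ c (∪ʳ (V ∖ A) ⁅ f ⁆ (==-refl f)) x)))
              where import Data.Nat.Properties as ℕP
            F₂ : Forest G ((V ∖ A) ∖ c)
            F₂ B B⊆ ne = subst (λ x → x + 1ℤ ≤ card B) (e-contract G F f B (f∉B (λ v q → proj₁ (∧-true (B⊆ v q))))) (Fo B (λ v q → FB⊆ v (B⊆ v q)) ne)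
            attach : ∀ B → B ⊆ (V ∖ A) ∖ c → e G B + cross G B F ≤ card B
            -- The forest condition of the quotient for `B` together with `f` is precisely the
            -- gluing condition.
            attach B B⊆ = attach-arith (e G′ (B ∪ ⁅ f ⁆)) (card (B ∪ ⁅ f ⁆)) (e G B) (cross G B F) (card B)
                (trans (e-∪ G′ B ⁅ f ⁆ λ v q → ≢⇒== (≢f B⊆′ q)) (trans (cong₂ _+_ (cong₂ _+_ (e-contract G F f B (f∉B B⊆′)) (e-⁅⁆ G′ f))
                  (trans (cross-comm G′ B ⁅ f ⁆) (trans (∑-⁅⁆ f _) (cr-contract G F f B (f∉B B⊆′))))) (cong (_+ cross G B F) (ℤP.+-identityʳ (e G B)))))
                (trans (∑-∪ B ⁅ f ⁆ _ λ v q → ≢⇒== (≢f B⊆′ q)) (cong (λ x → card B + x) (∑-⁅⁆ f _)))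
                (Fo (B ∪ ⁅ f ⁆) sub (f , ∪ʳ B ⁅ f ⁆ (==-refl f)))
              where
              B⊆′ : B ⊆ V ∖ A
              B⊆′ v q = proj₁ (∧-true (B⊆ v q))
              sub : B ∪ ⁅ f ⁆ ⊆ V′ ∖ c
              sub v q with ∨-true q
              ... | inj₁ x = FB⊆ v (B⊆ v x)
              ... | inj₂ x rewrite ==⇒≡ {u = v} x = ∖⁺ V′ c (∪ʳ (V ∖ A) ⁅ f ⁆ (==-refl f)) f∉c
            forest : Forest G (V ∖ colouring c)
            forest = glue-forest G {A₀ = A} (λ v → colouring-F {c}) (λ v → colouring-F′ {c}) FA F₂ attach

        -- Case in which no edge leaves F. Among the outer vertices touching M, only `v₀` may be
        -- spared the forcing: it gets weight `h₀`. By `drop` its edges into `A` pay for this even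
        -- after `p` is deducted, and by `room` a weight `h₀ ≤ s` covers `v₀` together with any tree
        -- of `A` that it touches.
        module ToM (noF : ∀ v → v ∈ V ∖ A → cr G v F ≤ 0ℤ) (v₀ : Fin N) (v₀∈ : v₀ ∈ V ∖ A) (h₀ : ℕ) (1≤h₀ : 1 ℕ.≤ h₀)
          (drop : pot (ω v₀) ≤ pot h₀ + (K * cr G v₀ A - p))
          (room : h₀ ℕ.≤ s → ω v₀ ℕ.≤ h₀ × (∀ A₁ → A₁ ⊆ M → cr G v₀ A₁ ≤ 1ℤ ×
            (1ℤ ≤ cr G v₀ A₁ → Nonempty A₁ → card A₁ ≤ e G A₁ + 1ℤ → + ω v₀ + wt ω A₁ ≤ + h₀))) where

          ω′ : Fin N → ℕ
          ω′ v = if v == v₀ then h₀ else ω₁ v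

          ω′-v₀ : ω′ v₀ ≡ h₀
          ω′-v₀ rewrite ==-refl v₀ = refl

          ω′-≢ : ∀ {v} → v ≢ v₀ → ω′ v ≡ ω₁ v
          ω′-≢ n rewrite ≢⇒== n = refl

          ω′-pos : Pos ω′
          ω′-pos v with v == v₀
          ... | true = 1≤h₀
          ... | false = ω₁-pos v

          smaller : card (V ∖ A) + 1ℤ ≤ card V
          smaller = smaller-arith-2 (card V) (card A) (card (V ∖ A)) card-V 2≤A

          cross-F : ∀ {B} → B ⊆ V ∖ A → cross G B F ≡ 0ℤ
          cross-F {B} B⊆ = ∑-zero B λ v q → ℤP.≤-antisym (noF v (B⊆ v q)) (cr-nn G v F)

          valid′ : Valid G ω′ (V ∖ A)
          valid′ B B⊆ with true⊎false (B v₀)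
          -- `A ∪ B` misses `v₀`, hence is proper, and minimality of `A` applies.
          ... | inj₂ q = ℤP.≤-trans (valid-off-arith-2 (ρ G ω (A ∪ B)) p (K * cross G B F) (proper B⊆ v₀∈ q) (*-nn (ℤP.≤-trans (0≤ 1) K≥1) (cross-nn G B F)))
                (ℤP.≤-trans (outer B⊆) (eq (cong (_- K * e G B) (∑-cong B λ v r → cong pot (sym (ω′-≢ λ { refl → true≢false r q }))))))
          -- Here `A ∪ B` may be all of `V`, where only `ρ ≥ -1` is known; this is why `drop` has to
          -- pay back the whole of `p`.
          ... | inj₁ q = valid′-arith K (ρ G ω (A ∪ B)) p (pot (ω v₀)) (pot h₀) (cr G v₀ A) (∑ B₀ (λ v → pot (ω v))) (∑ B₀ (λ v → pot (ω₁ v)))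
                (cross G B₀ M) (cross G B M) (cross G B F) (cr G v₀ M) (cr G v₀ F) (∑ B (λ v → pot (ω v))) (∑ B (λ v → pot (ω′ v))) (e G B)
                (valid _ (∪⊆V B⊆)) drop (ρ-∪ B⊆) (conv-bound B₀) (∑-pt _ q)
                (trans (∑-pt _ q) (cong₂ _+_ (cong pot ω′-v₀) (∑-cong B₀ λ v r → cong pot (ω′-≢ (-′-≢ B r)))))
                (∑-pt _ q) (cross-F B⊆) (cr-MF v₀) (ℤP.≤-antisym (noF v₀ v₀∈) (cr-nn G v₀ F))
            where
            B₀ = B -′ v₀

          result : Colorable G s ω V
          result with ih (V ∖ A) G ω′ smaller ω′-pos valid′
          ... | c , L , Fo = colouring c , light , forest
            where
            MB-V : (V ∖ A) ∩ c ⊆ V ∖ A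
            MB-V v q = proj₁ (∩⁻ (V ∖ A) c q)
            ω-M : ∀ v → v ∈ (V ∖ A) ∩ c → v ≢ v₀ → conv v ≡ false
            ω-M v q n = ≢true λ x → ℕP.1+n≰n (subst (ℕ._≤ s) (trans (ω′-≢ n) (cong (λ b → if b then suc s else ω v) x)) (Light-≤ G L q))
            ω-eq : ∀ v → v ∈ (V ∖ A) ∩ c → v ≢ v₀ → ω v ≡ ω′ v
            ω-eq v q n = sym (trans (ω′-≢ n) (cong (λ b → if b then suc s else ω v) (ω-M v q n)))
            room′ : v₀ ∈ (V ∖ A) ∩ c → ω v₀ ℕ.≤ h₀ × (∀ A₁ → A₁ ⊆ M → cr G v₀ A₁ ≤ 1ℤ ×
              (1ℤ ≤ cr G v₀ A₁ → Nonempty A₁ → card A₁ ≤ e G A₁ + 1ℤ → + ω v₀ + wt ω A₁ ≤ + h₀))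
            room′ q = room (subst (ℕ._≤ s) ω′-v₀ (Light-≤ G L q))
            ω≤ω′ : ∀ v → v ∈ (V ∖ A) ∩ c → ω v ℕ.≤ ω′ v
            ω≤ω′ v q with true⊎false (v == v₀)
            ... | inj₂ n = ℕP.≤-reflexive (ω-eq v q (==-false n))
            ... | inj₁ y with ==⇒≡ {u = v} y
            ...   | refl = subst (ω v₀ ℕ.≤_) (sym ω′-v₀) (proj₁ (room′ q))
            L₂ : Light G s ω ((V ∖ A) ∩ c)
            L₂ = Light-mono G ω≤ω′ L
            off : ∀ {A₁ B} → A₁ ⊆ M → B ⊆ (V ∖ A) ∩ c → B v₀ ≡ false → cross G B A₁ ≤ 0ℤ
            off {A₁} {B} A₁⊆ B⊆ n = ℤP.≤-trans (cross-⊆ G (λ _ q → q) A₁⊆) (subst (cross G B M ≤_) (∑-0 B)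
              (∑-mono B λ v q → conv-false (ω-M v (B⊆ v q) λ { refl → true≢false q n })))
            light : Light G s ω (V ∩ colouring c)
            light = glue-light G {A₀ = A} (λ v → colouring-M {c}) (λ v → colouring-M′ {c}) LA L₂ ok
              where
              ok : ∀ A₁ B → A₁ ⊆ M → B ⊆ (V ∖ A) ∩ c → cross G A₁ B ≤ 0ℤ ⊎ (cross G A₁ B ≤ 1ℤ ×
                (Nonempty A₁ → Nonempty B → card A₁ ≤ e G A₁ + 1ℤ → card B ≤ e G B + 1ℤ → wt ω A₁ + wt ω B ≤ + s))
              ok A₁ B A₁⊆ B⊆ with true⊎false (B v₀)
              ... | inj₂ n = inj₁ (subst (_≤ 0ℤ) (cross-comm G B A₁) (off A₁⊆ B⊆ n))
              ... | inj₁ y = go (≤⊎+1≤ (cr G v₀ A₁) 0ℤ)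
                where
                B₀ = B -′ v₀
                B₀⊆ : B₀ ⊆ (V ∖ A) ∩ c
                B₀⊆ v q = B⊆ v (-′-⊆ {A = B} v₀ v q)
                bound : cross G A₁ B ≤ cr G v₀ A₁
                bound = bound-arith (cross G A₁ B) (cr G v₀ A₁) (cross G B₀ A₁) (trans (cross-comm G A₁ B) (∑-pt _ y)) (off A₁⊆ B₀⊆ (-′-∉ B v₀))
                r = proj₂ (room′ (B⊆ v₀ y)) A₁ A₁⊆
                go : cr G v₀ A₁ ≤ 0ℤ ⊎ 0ℤ + 1ℤ ≤ cr G v₀ A₁ → cross G A₁ B ≤ 0ℤ ⊎ (cross G A₁ B ≤ 1ℤ ×
                  (Nonempty A₁ → Nonempty B → card A₁ ≤ e G A₁ + 1ℤ → card B ≤ e G B + 1ℤ → wt ω A₁ + wt ω B ≤ + s))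
                go (inj₁ h) = inj₁ (ℤP.≤-trans bound h)
                go (inj₂ h) = inj₂ (ℤP.≤-trans bound (proj₁ r) , λ ne ne′ t t′ →
                    go-arith (wt ω A₁) (wt ω B) (+ s) (+ ω v₀) (+ h₀) (wt ω B₀) (wt ω′ B) (proj₂ r h ne t) (∑-pt _ y)
                      (trans (∑-pt _ y) (cong₂ _+_ (cong +_ ω′-v₀) (∑-cong B₀ λ v q → cong +_ (sym (ω-eq v (B₀⊆ v q) (-′-≢ B q))))))
                      (proj₂ (L B B⊆ ne′) t′))
            attach : ∀ B → B ⊆ (V ∖ A) ∖ c → e G B + cross G B F ≤ card B
            attach B B⊆ with find B
            ... | inj₁ ne = attach-arith-2 (e G B) (cross G B F) (card B) (cross-F (λ v q → proj₁ (∖⁻ (V ∖ A) c (B⊆ v q)))) (Fo B B⊆ ne)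
            ... | inj₂ none = eq (trans (cong₂ _+_ (e-∅ G none) (∑-∅ none)) (sym (∑-∅ none)))
            forest : Forest G (V ∖ colouring c)
            forest = glue-forest G {A₀ = A} (λ v → colouring-F {c}) (λ v → colouring-F′ {c}) FA Fo attach

      module _ (w₀ : Fin N) (w₀∈ : w₀ ∈ V ∖ A) where

        A-smaller : card A + 1ℤ ≤ card V
        A-smaller = A-smaller-arith (card V) (card A) (card (V ∖ A)) card-V (card-pos w₀∈)

        -- A tree of M might use the edge from `x` to `v₀`. While `A` is coloured, `i` units are
        -- reserved at `x`; if `x` ends in M, its tree then weighs at most `s - i`, which is what
        -- `v₀` is charged afterwards.
        module Edge (x v₀ : Fin N) (x∈A : x ∈ A) (v₀∈ : v₀ ∈ V ∖ A) (1≤xv : 1ℤ ≤ a G x v₀) where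

          private
            rs = raise p (valid A A⊆V) ρA≤

          i : ℕ
          i = proj₁ rs

          ωA : Fin N → ℕ
          ωA v = if v == x then ω x ℕ.+ i else ω v

          ωA-x : ωA x ≡ ω x ℕ.+ i
          ωA-x rewrite ==-refl x = refl

          ωA-≢ : ∀ {v} → v ≢ x → ωA v ≡ ω v
          ωA-≢ n rewrite ≢⇒== n = refl

          ω≤ωA : ∀ v → ω v ℕ.≤ ωA v
          ω≤ωA v with v == x in q
          ... | true rewrite ==⇒≡ {u = v} q = ℕP.m≤m+n (ω x) i
          ... | false = ℕP.≤-refl

          ωA-pos : Pos ωA
          ωA-pos v = ℕP.≤-trans (pos v) (ω≤ωA v)

          validA : Valid G ωA A
          validA B B⊆ with true⊎false (B x)
          ... | inj₂ n = subst (ℤ.-1ℤ ≤_) (cong (_- K * e G B) (∑-cong B λ v q → cong pot (sym (ωA-≢ λ { refl → true≢false q n })))) (valid B λ v q → A⊆V v (B⊆ v q))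
          ... | inj₁ y with find (B -′ x)
          ...   | inj₂ none = single-valid G y none
          -- `B` misses `w₀`, so `ρ(B) ≥ p` by minimality, and raising `x` costs at most `p + 1`.
          ...   | inj₁ (u , u∈) = validA-arith K p (ρ G ω B) (pot (ω x)) (pot (ω x ℕ.+ i)) (∑ B₀ (λ v → pot (ω v))) (e G B) (∑ B (λ v → pot (ω v))) (∑ B (λ v → pot (ωA v)))
                  (min B (λ v q → A⊆V v (B⊆ v q)) 2≤B w₀ (proj₁ (∖⁻ V A w₀∈)) (≢true λ q → true≢false (B⊆ w₀ q) (proj₂ (∖⁻ V A w₀∈))))
                  (proj₁ (proj₂ (proj₂ rs)) (ω x) (pos x)) refl (∑-pt _ y)
                  (trans (∑-pt _ y) (cong₂ _+_ (cong pot ωA-x) (∑-cong B₀ λ v q → cong pot (ωA-≢ (-′-≢ B q)))))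
            where
            B₀ = B -′ x
            2≤B : + 2 ≤ card B
            2≤B = subst (+ 2 ≤_) (sym (∑-pt (λ _ → 1ℤ) y)) (ℤP.≤-refl {1ℤ} ⊞ card-pos u∈)

          result : Colorable G s ω V
          result with ih A G ωA A-smaller ωA-pos validA
          ... | cA , L , Fo = go (FinP.any? λ v → ((V ∖ A) v Data.Bool.≟ true) ×-dec (1ℤ ≤? cr G v (A ∖ cA)))
            where
            open Coloured cA (Light-mono G (λ v _ → ω≤ωA v) L) Fo
            1≤vx : 1ℤ ≤ a G v₀ x
            1≤vx = subst (1ℤ ≤_) (a-sym G x v₀) 1≤xv
            1≤cr : 1ℤ ≤ cr G v₀ A
            1≤cr = 1≤cr-arith (cr G v₀ A) (a G v₀ x) (cr G v₀ (A -′ x)) (∑-pt _ x∈A) 1≤vx (cr-nn G v₀ (A -′ x))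
            go : Dec (∃ λ v → v ∈ V ∖ A × 1ℤ ≤ cr G v (A ∖ cA)) → Colorable G s ω V
            go (yes (v₁ , v₁∈ , t)) with ∑-pos F t
            ... | f , f∈ , _ = ToF.result f f∈ v₁ v₁∈ t
            go (no none) with ≤⊎+1≤ (cr G v₀ A) 1ℤ
            -- Two edges into `A` leave `2K - p ≥ K + 1`, enough to force `v₀` into F outright.
            ... | inj₂ big = ToM.result noF v₀ v₀∈ (suc s) (s≤s z≤n)
                    (go-arith-2 K p (pot (ω v₀)) (pot (suc s)) (K * cr G v₀ A) (pot-hi _ (pos v₀)) (pot-lo (suc s)) ρA≤ (K*-mono big)) (λ h → ⊥-elim (ℕP.1+n≰n h))
              where
              noF : ∀ v → v ∈ V ∖ A → cr G v F ≤ 0ℤ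
              noF v q = noF-eq (cr G v F) (≰⇒+1≤ λ h → none (v , q , h))
            ... | inj₁ one = ToM.result noF v₀ v₀∈ (ω v₀ ℕ.+ (s ℕ.∸ i)) (ℕP.≤-trans (pos v₀) (ℕP.m≤m+n (ω v₀) _))
                    (go-arith-3 K p (pot (ω v₀)) (pot (ω v₀ ℕ.+ (s ℕ.∸ i))) (K * cr G v₀ A) (proj₂ (proj₂ (proj₂ rs)) (ω v₀) (pos v₀)) (K≤K* 1≤cr))
                    λ _ → ℕP.m≤m+n (ω v₀) _ , λ A₁ A₁⊆ → ℤP.≤-trans (cr-⊆ G v₀ λ v q → proj₁ (∩⁻ A cA (A₁⊆ v q))) one , wbound A₁ A₁⊆
              where
              noF : ∀ v → v ∈ V ∖ A → cr G v F ≤ 0ℤ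
              noF v q = noF-eq (cr G v F) (≰⇒+1≤ λ h → none (v , q , h))
              wbound : ∀ A₁ → A₁ ⊆ M → 1ℤ ≤ cr G v₀ A₁ → Nonempty A₁ → card A₁ ≤ e G A₁ + 1ℤ → + ω v₀ + wt ω A₁ ≤ + (ω v₀ ℕ.+ (s ℕ.∸ i))
              wbound A₁ A₁⊆ t ne tr with true⊎false (A₁ x)
              -- The only edge from `v₀` into `A` ends at `x`, so a tree touched by `v₀` contains
              -- `x` and has felt the reservation.
              ... | inj₂ n = ⊥-elim (1≰0 (wbound-arith (cr G v₀ A) (a G v₀ x) (cr G v₀ A₁) (cr G v₀ (A -′ x)) (∑-pt _ x∈A) one 1≤vx t
                      (cr-⊆ G v₀ λ v q → -′-intro {A = A} (proj₁ (∩⁻ A cA (A₁⊆ v q))) λ { refl → true≢false q n })))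
              ... | inj₁ y = subst (+ ω v₀ + wt ω A₁ ≤_) (sym (ℤP.pos-+ (ω v₀) (s ℕ.∸ i)))
                      (wbound-arith-2 (+ ω v₀) (wt ω A₁) (+ (s ℕ.∸ i)) (+ i) (+ s) (wt ωA A₁) (wt ω (A₁ -′ x)) (+ ω x) (+ ωA x)
                        (trans (sym (ℤP.pos-+ (s ℕ.∸ i) i)) (cong +_ (ℕP.m∸n+n≡m (proj₁ (proj₂ rs)))))
                        (∑-pt _ y) (trans (∑-pt _ y) (cong (λ z → + ωA x + z) (∑-cong (A₁ -′ x) λ v q → cong +_ (ωA-≢ (-′-≢ A₁ q)))))
                        (trans (cong +_ ωA-x) (ℤP.pos-+ (ω x) i)) (proj₂ (L A₁ A₁⊆ ne) tr))

        dense : Colorable G s ω V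
        dense with ≤⊎+1≤ (cross G A (V ∖ A)) 0ℤ
        ... | inj₂ h with cross-pos G h
        ...   | x , v₀ , x∈ , v₀∈ , t = Edge.result x v₀ x∈ v₀∈ t
        dense | inj₁ h with ih A G ω A-smaller pos (λ B B⊆ → valid B λ v q → A⊆V v (B⊆ v q))
                          | ih (V ∖ A) G ω (smaller-arith-2 (card V) (card A) (card (V ∖ A)) card-V 2≤A) pos (λ B B⊆ → valid B λ v q → proj₁ (∖⁻ V A (B⊆ v q)))
        ... | cA , LA , FA | c , LB , FB = colouring c ,
              glue-light G {A₀ = A} (λ v → colouring-M {c}) (λ v → colouring-M′ {c}) LA LB (λ A₁ B A₁⊆ B⊆ → inj₁ (ℤP.≤-trans
                (cross-⊆ G (λ v q → proj₁ (∩⁻ A cA (A₁⊆ v q))) (λ v q → proj₁ (∩⁻ (V ∖ A) c (B⊆ v q)))) h)) ,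
              glue-forest G {A₀ = A} (λ v → colouring-F {c}) (λ v → colouring-F′ {c}) FA FB attach
          where
          open Coloured cA LA FA
          attach : ∀ B → B ⊆ (V ∖ A) ∖ c → e G B + cross G B F ≤ card B
          attach B B⊆ with find B
          ... | inj₁ ne = attach-arith-3 (e G B) (cross G B F) (card B) (ℤP.≤-trans (subst (_≤ cross G A (V ∖ A)) (cross-comm G F B)
                  (cross-⊆ G (λ v q → proj₁ (∖⁻ A cA q)) (λ v q → proj₁ (∖⁻ (V ∖ A) c (B⊆ v q))))) h) (FB B B⊆ ne)
          ... | inj₂ none = eq (trans (cong₂ _+_ (e-∅ G none) (∑-∅ none)) (sym (∑-∅ none)))

  -- Reducible vertices

  private
    more-arith : ∀ d x y → d ≡ x + y → + 3 ≤ d → x ≤ + 2 → 1ℤ ≤ y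
    more-arith d x y refl l l′ = by (l ⊞ l′) (solve (x ∷ y ∷ []))

    big-arith : ∀ k r h → k ≤ r → h ≤ k → ℤ.-1ℤ ≤ r - h * 1ℤ
    big-arith k r h l l′ = by (l ⊞ l′ ⊞ 0≤ 1) (solve (k ∷ r ∷ h ∷ []))

    big-arith-2 : ∀ k r h p z → k ≤ r + p - z → p ≡ k + k + 1ℤ - h → k * + 2 ≤ z → h ≤ k → ℤ.-1ℤ ≤ r - h * + 2
    big-arith-2 k r h p z l₁ refl l₂ l₃ = by (l₁ ⊞ l₂ ⊞ l₃) (solve (k ∷ r ∷ h ∷ z ∷ []))

    big-arith-3 : ∀ k r h p z → k ≤ r + p - z → p ≡ k + k + 1ℤ - h → k * + 3 ≤ z → h ≤ k → ℤ.-1ℤ ≤ r - h * + 3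
    big-arith-3 k r h p z l₁ refl l₂ l₃ = by (l₁ ⊞ l₂ ⊞ l₃ ⊞ l₃) (solve (k ∷ r ∷ h ∷ z ∷ []))

    big-arith-4 : ∀ k r h p z t c → t ≡ r + p - z → p ≡ k + k + 1ℤ - h → k * + 3 ≤ z → c ≤ t + k + h → ℤ.-1ℤ ≤ r - c
    big-arith-4 k r h p z t c refl refl l₂ l₃ = by (l₂ ⊞ l₃) (solve (k ∷ r ∷ h ∷ z ∷ c ∷ []))

    ωu≤s-arith : ∀ h s → + 2 * h ≤ s → 0ℤ ≤ h → h ≤ s
    ωu≤s-arith h s l l′ = by (l ⊞ l′) (solve (h ∷ s ∷ []))

    valid⁺-arith : ∀ r h → ℤ.-1ℤ ≤ r → ℤ.-1ℤ ≤ r - h * 0ℤ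
    valid⁺-arith r h l = by l (solve (r ∷ h ∷ []))

    dense-or-gap-arith : ∀ k r → k - 1ℤ + 1ℤ ≤ r → k ≤ r
    dense-or-gap-arith k r h = by h (solve (k ∷ r ∷ []))

    place-arith : ∀ d x y z → d ≡ x + y → d ≤ + 3 → + 2 ≤ y → z ≤ x → z ≤ 1ℤ
    place-arith d x y z refl h h′ h″ = by (h ⊞ h′ ⊞ h″) (solve (x ∷ y ∷ z ∷ []))

    place-arith-2 : ∀ d x y z → d ≡ x + y → + 2 ≤ y → z ≤ x → 1ℤ ≤ z → + 3 ≤ d
    place-arith-2 d x y z refl h h′ h″ = by (h ⊞ h′ ⊞ h″) (solve (x ∷ y ∷ z ∷ []))

    room-arith : ∀ h w w′ x x′ t t′ → t ≡ w + x → t′ ≡ w′ + x′ → w′ ≡ w + h → x ≤ x′ → h + t ≤ t′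
    room-arith h w w′ x x′ t t′ refl refl refl l = by l (solve (h ∷ w ∷ x ∷ x′ ∷ []))

    pot-bound-arith : ∀ x a b y c h n → x ≡ a + b → y ≡ c + b → a ≤ c + h * n → x ≤ y + h * n
    pot-bound-arith x a b y c h n refl refl l = by l (solve (a ∷ b ∷ c ∷ h ∷ n ∷ []))

    lower-arith : ∀ x y h m n k → x ≤ y + h * m → h * m ≤ h * n → x - k - h * n ≤ y - k
    lower-arith x y h m n k l₁ l₂ = by (l₁ ⊞ l₂) (solve (x ∷ y ∷ h ∷ m ∷ n ∷ k ∷ []))

    ρ-ins-eq : ∀ x y k e c → (x + y) - k * (e + 0ℤ + c) ≡ (x - k * e) + y - k * c
    ρ-ins-eq = solve-∀

  module Main (P : Params) {N : ℕ} where
    open Reduction P {N} public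

    -- The negation of having a set to absorb: `K - 1` is the largest potential that the single edge
    -- in `Dense` can make up for.
    Gap : Graph N → (Fin N → ℕ) → Sub N → Set
    Gap G ω V = ∀ A → A ⊆ V → + 2 ≤ card A → ∀ w → w ∈ V → A w ≡ false → K ≤ ρ G ω A

    ρ-cong : ∀ {G ω A B} → (∀ v → A v ≡ B v) → ρ G ω A ≡ ρ G ω B
    ρ-cong {G} h = cong₂ (λ x y → x - K * y) (∑-set h) (e-cong G h)

    0≤K : 0ℤ ≤ K
    0≤K = ℤP.≤-trans (0≤ 1) K≥1

    module Choice (G : Graph N) (ω : Fin N → ℕ) (V : Sub N) (pos : Pos ω) (valid : Valid G ω V) (ih : IH V) where

      Q : Sub N → Set
      Q A = A ⊆ V × + 2 ≤ card A × ∃ λ w → w ∈ V × A w ≡ false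

      Q? : ∀ A → Dec (Q A)
      Q? A = ⊆-dec A V ×-dec ((+ 2 ≤? card A) ×-dec FinP.any? λ w → (V w Data.Bool.≟ true) ×-dec (A w Data.Bool.≟ false))

      Q-resp : ∀ {A B} → (∀ v → A v ≡ B v) → Q A → Q B
      Q-resp h (p , q , w , r , t) = ⊆-resp h p , subst (+ 2 ≤_) (∑-set h) q , w , r , trans (sym (h w)) t

      low? : ∀ t → Dec (∃ λ A → Q A × ρ G ω A ≤ t)
      low? t = anySub? (λ A → Q? A ×-dec (ρ G ω A ≤? t)) λ h (q , r) → Q-resp h q , subst (_≤ t) (ρ-cong h) r

      -- Descent on the potential; it stops because `ρ ≥ -1` on every candidate, and `k` bounds the
      -- number of steps left.
      least : ∀ k A → Q A → ρ G ω A ≤ ℤ.-1ℤ + + k → ∃ λ A → Q A × ρ G ω A ≤ ℤ.-1ℤ + + k × (∀ B → Q B → ρ G ω A ≤ ρ G ω B)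
      least zero A q r = A , q , r , λ B q′ → ℤP.≤-trans r (valid B (proj₁ q′))
      least (suc k) A q r with low? (ℤ.-1ℤ + + k)
      ... | yes (A′ , q′ , r′) with least k A′ q′ r′
      ...   | A″ , q″ , r″ , m = A″ , q″ , ℤP.≤-trans r″ (ℤP.+-monoʳ-≤ ℤ.-1ℤ (+≤+ (ℕP.n≤1+n k))) , m
      least (suc k) A q r | no none = A , q , r , λ B q′ → ℤP.≤-trans r (ℤP.≤-trans (eq (lem k)) (≰⇒+1≤ λ h → none (B , q′ , h)))
        where
        lem : ∀ k → ℤ.-1ℤ + + suc k ≡ ℤ.-1ℤ + + k + 1ℤ
        lem k = trans (cong (λ x → ℤ.-1ℤ + x) (trans (cong +_ (ℕP.+-comm 1 k)) (ℤP.pos-+ k 1))) (sym (ℤP.+-assoc ℤ.-1ℤ (+ k) 1ℤ))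

      dense-or-gap : Colorable G s ω V ⊎ Gap G ω V
      dense-or-gap with low? (K - 1ℤ)
      ... | no none = inj₂ λ A A⊆ 2≤ w w∈ w∉ → dense-or-gap-arith K (ρ G ω A) (≰⇒+1≤ λ h → none (A , (A⊆ , 2≤ , w , w∈ , w∉) , h))
      ... | yes (A , q , r) with least ℤ.∣ K ∣ A q (subst (ρ G ω A ≤_) (sym K-1) r)
        where
        K-1 : ℤ.-1ℤ + + ℤ.∣ K ∣ ≡ K - 1ℤ
        K-1 = trans (cong (λ x → ℤ.-1ℤ + x) (ℤP.0≤i⇒+∣i∣≡i 0≤K)) (ℤP.+-comm ℤ.-1ℤ K)
      ...   | A , (A⊆ , 2≤ , w , w∈ , w∉) , r′ , m = inj₁ (Dense.dense G ω V pos valid ih A A⊆ 2≤ (subst (ρ G ω A ≤_) K-1 r′)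
                (λ B B⊆ 2≤B w′ w′∈ w′∉ → m B (B⊆ , 2≤B , w′ , w′∈ , w′∉)) w (∖⁺ V A w∈ w∉))
        where
        K-1 : ℤ.-1ℤ + + ℤ.∣ K ∣ ≡ K - 1ℤ
        K-1 = trans (cong (λ x → ℤ.-1ℤ + x) (ℤP.0≤i⇒+∣i∣≡i 0≤K)) (ℤP.+-comm ℤ.-1ℤ K)

    _∪ᶜ_ : Sub N → Fin N → Sub N
    c ∪ᶜ u = c ∪ ⁅ u ⁆

    module Place (G : Graph N) (V : Sub N) (u : Fin N) (c : Sub N) where

      U : Sub N
      U = V -′ u

      toF-M : V ∩ (c -′ u) ⊆ U ∩ c
      toF-M v q with ∩⁻ V (c -′ u) q
      ... | v∈ , c∈ = ∩⁺ U c (-′-intro {A = V} v∈ (-′-≢ c c∈)) (-′-⊆ {A = c} u v c∈)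

      toF-F : Adds G (U ∖ c) u (V ∖ (c -′ u))
      toF-F v q n with ∖⁻ V (c -′ u) q
      ... | v∈ , c∉ = ∖⁺ U c (-′-intro {A = V} v∈ n) (≢true λ h → true≢false (-′-intro {A = c} h n) c∉)

      toM-F : V ∖ (c ∪ᶜ u) ⊆ U ∖ c
      toM-F v q with ∖⁻ V (c ∪ᶜ u) q
      ... | v∈ , c∉ = ∖⁺ U c (-′-intro {A = V} v∈ λ { refl → true≢false (∪ʳ c ⁅ v ⁆ (==-refl v)) c∉ }) (≢true λ h → true≢false (∪ˡ c ⁅ u ⁆ h) c∉)

      toM-M : Adds G (U ∩ c) u (V ∩ (c ∪ᶜ u))
      toM-M v q n with ∩⁻ V (c ∪ᶜ u) q
      ... | v∈ , c∈ with ∪⁻ c ⁅ u ⁆ c∈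
      ...   | inj₁ h = ∩⁺ U c (-′-intro {A = V} v∈ n) h
      ...   | inj₂ h = ⊥-elim (n (==⇒≡ h))

      cr-parts : cr G u V ≡ cr G u (U ∩ c) + cr G u (U ∖ c)
      cr-parts = trans (sym (cr-self G u V)) (∑-split U c _)

      -- If F refuses `u`, two of its at most three edges go to F and at most one goes to M. Such an
      -- edge exists only if the degree is exactly 3, and then the weights `ω′` used so far have
      -- kept room for `u`.
      place : ∀ {ω ω′} → ω u ℕ.≤ s → (∀ v → ω v ℕ.≤ ω′ v) → cr G u V ≤ + 3 →
        (∀ A → A ⊆ U → 1ℤ ≤ cr G u A → + 3 ≤ cr G u V → + ω u + wt ω A ≤ wt ω′ A) →
        Light G s ω′ (U ∩ c) → Forest G (U ∖ c) → Colorable G s ω V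
      place {ω} {ω′} ωu ω≤ d≤3 room L F with extend G (U ∖ c) u F
      ... | inj₁ ok = c -′ u , Light-⊆ G toF-M (Light-mono G (λ v _ → ω≤ v) L) , ok _ toF-F
      ... | inj₂ two = c ∪ᶜ u , insert-light G toM-M (Light-mono G (λ v _ → ω≤ v) L) ωu add , Forest-⊆ G toM-F F
        where
        add : ∀ A → A ⊆ U ∩ c → Nonempty A → cr G u A ≤ 1ℤ × (1ℤ ≤ cr G u A → card A ≤ e G A + 1ℤ → + ω u + wt ω A ≤ + s)
        add A A⊆ ne = place-arith (cr G u V) (cr G u (U ∩ c)) (cr G u (U ∖ c)) (cr G u A) cr-parts d≤3 two (cr-⊆ G u A⊆) , λ one t →
          ℤP.≤-trans (room A (λ v q → proj₁ (∩⁻ U c (A⊆ v q))) one (place-arith-2 (cr G u V) (cr G u (U ∩ c)) (cr G u (U ∖ c)) (cr G u A) cr-parts two (cr-⊆ G u A⊆) one))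
            (proj₂ (L A A⊆ ne) t)

    -- It is not known in advance which neighbour will lie in the tree that `u` joins, so `h` is
    -- reserved at all of them, at a price of at most `2h` each. One raised neighbour in a tree
    -- already makes room for `u`.
    module Raise (G : Graph N) (ω : Fin N → ℕ) (u : Fin N) (h : ℕ) where

      Nb : Sub N
      Nb v = does (1ℤ ≤? a G u v)

      Nb-true : ∀ {v} → v ∈ Nb → 1ℤ ≤ a G u v
      Nb-true {v} q with 1ℤ ≤? a G u v
      ... | yes r = r

      Nb-intro : ∀ {v} → 1ℤ ≤ a G u v → v ∈ Nb
      Nb-intro {v} q with 1ℤ ≤? a G u v
      ... | yes r = refl
      ... | no r = ⊥-elim (r q)

      ω⁺ : Fin N → ℕ
      ω⁺ v = if Nb v then ω v ℕ.+ h else ω v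

      ω≤ω⁺ : ∀ v → ω v ℕ.≤ ω⁺ v
      ω≤ω⁺ v with Nb v
      ... | true = ℕP.m≤m+n (ω v) h
      ... | false = ℕP.≤-refl

      card-Nb : ∀ A → card (A ∩ Nb) ≤ cr G u A
      card-Nb A = ℤP.≤-trans (∑-mono (A ∩ Nb) λ v q → Nb-true (proj₂ (∩⁻ A Nb q))) (cr-⊆ G u λ v q → proj₁ (∩⁻ A Nb q))

      room : ∀ {A v} → v ∈ A → 1ℤ ≤ a G u v → + h + wt ω A ≤ wt ω⁺ A
      room {A} {v} v∈ q = room-arith (+ h) (+ ω v) (+ ω⁺ v) (wt ω (A -′ v)) (wt ω⁺ (A -′ v)) (wt ω A) (wt ω⁺ A) (∑-pt _ v∈) (∑-pt _ v∈)
          (trans (cong +_ (cong (λ b → if b then ω v ℕ.+ h else ω v) (Nb-intro q))) (ℤP.pos-+ (ω v) h)) (∑-mono (A -′ v) λ w _ → +≤+ (ω≤ω⁺ w))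

      pot-bound : ∀ A → ∑ A (λ v → pot (ω v)) ≤ ∑ A (λ v → pot (ω⁺ v)) + + 2 * + h * card (A ∩ Nb)
      pot-bound A = pot-bound-arith (∑ A (λ v → pot (ω v))) (∑ (A ∩ Nb) (λ v → pot (ω v))) (∑ (A ∖ Nb) (λ v → pot (ω v)))
          (∑ A (λ v → pot (ω⁺ v))) (∑ (A ∩ Nb) (λ v → pot (ω⁺ v))) (+ 2 * + h) (card (A ∩ Nb))
          (∑-split A Nb _) (trans (∑-split A Nb _) (cong (λ x → ∑ (A ∩ Nb) (λ v → pot (ω⁺ v)) + x) (∑-cong (A ∖ Nb) λ v q → cong (λ b → pot (if b then ω v ℕ.+ h else ω v)) (proj₂ (∖⁻ A Nb q)))))
          (ℤP.≤-trans (∑-mono (A ∩ Nb) λ v q → subst (λ b → pot (ω v) ≤ pot (if b then ω v ℕ.+ h else ω v) + (+ 2 * + h) * 1ℤ) (sym (proj₂ (∩⁻ A Nb q)))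
              (subst (λ x → pot (ω v) ≤ pot (ω v ℕ.+ h) + x) (sym (ℤP.*-identityʳ (+ 2 * + h))) (pot-step (ω v) h)))
            (eq (trans (∑-+ (A ∩ Nb) _ _) (cong (λ x → ∑ (A ∩ Nb) (λ v → pot (ω⁺ v)) + x) (∑-* (A ∩ Nb) (+ 2 * + h) _)))))

      lower : ∀ A n → card (A ∩ Nb) ≤ n → ρ G ω A - + 2 * + h * n ≤ ρ G ω⁺ A
      lower A n l = lower-arith (∑ A (λ v → pot (ω v))) (∑ A (λ v → pot (ω⁺ v))) (+ 2 * + h) (card (A ∩ Nb)) n (K * e G A) (pot-bound A) (*-monoˡ (*-nn (0≤ 2) (0≤ h)) l)

    module Sparse (G : Graph N) (ω : Fin N → ℕ) (V : Sub N) (pos : Pos ω) (valid : Valid G ω V) (ih : IH V) (gap : Gap G ω V) where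

      del-smaller : ∀ {u} → u ∈ V → card (V -′ u) + 1ℤ ≤ card V
      del-smaller {u} u∈ = eq (trans (ℤP.+-comm (card (V -′ u)) 1ℤ) (sym (∑-pt _ u∈)))

      del-valid : ∀ u → Valid G ω (V -′ u)
      del-valid u A A⊆ = valid A λ v q → -′-⊆ {A = V} u v (A⊆ v q)

      ρ-ins : ∀ {A u} → A u ≡ false → ρ G ω (A ∪ ⁅ u ⁆) ≡ ρ G ω A + pot (ω u) - K * cr G u A
      ρ-ins {A} {u} u∉ = trans (cong₂ (λ x y → x - K * y) (trans (∑-∪ A ⁅ u ⁆ _ dj) (cong (λ x → ∑ A _ + x) (∑-⁅⁆ u _)))
          (trans (e-∪ G A ⁅ u ⁆ dj) (cong₂ _+_ (cong (λ x → e G A + x) (e-⁅⁆ G u)) (trans (cross-comm G A ⁅ u ⁆) (∑-⁅⁆ u _)))))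
          (ρ-ins-eq (∑ A _) (pot (ω u)) K (e G A) (cr G u A))
        where
        dj : ∀ v → v ∈ A → ⁅ u ⁆ v ≡ false
        dj v q = ≢⇒== λ { refl → true≢false q u∉ }

      low-degree : ∀ {u} → u ∈ V → ω u ℕ.≤ s → cr G u V ≤ + 2 → Colorable G s ω V
      low-degree {u} u∈ ωu d≤2 with ih (V -′ u) G ω (del-smaller u∈) pos (del-valid u)
      ... | c , L , F = Place.place G V u c {ω} {ω} ωu (λ _ → ℕP.≤-refl) (ℤP.≤-trans d≤2 (+≤+ (s≤s (s≤s z≤n)))) (λ A A⊆ o t → ⊥-elim (contra (ℤP.≤-trans t d≤2))) L F
        where
        contra : ¬ (+ 3 ≤ + 2)
        contra (+≤+ (s≤s (s≤s ())))

      -- A single edge closes no cycle in F, so this also removes vertices whose weight forces them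
      -- into F.
      pendant : ∀ {u} → u ∈ V → cr G u V ≤ 1ℤ → Colorable G s ω V
      pendant {u} u∈ d≤1 with ih (V -′ u) G ω (del-smaller u∈) pos (del-valid u)
      ... | c , L , F with extend G ((V -′ u) ∖ c) u F
      ...   | inj₁ ok = c -′ u , Light-⊆ G (Place.toF-M G V u c) L , ok _ (Place.toF-F G V u c)
      ...   | inj₂ two = ⊥-elim (contra (ℤP.≤-trans two (ℤP.≤-trans (cr-⊆ G u λ v q → -′-⊆ {A = V} u v (proj₁ (∖⁻ (V -′ u) c q))) d≤1)))
        where
        contra : ¬ (+ 2 ≤ + 1)
        contra (+≤+ (s≤s ()))

      -- The condition `whole` is validity of the raised weights on `V` minus `u`. It has to be
      -- assumed because the gap is silent about `V` itself; for the other sets the gap suffices.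
      module Cubic {u : Fin N} (u∈ : u ∈ V) (2h≤s : + 2 * + ω u ≤ + s) (d≡3 : cr G u V ≡ + 3)
        (whole : + 2 * + ω u * card (V ∩ Raise.Nb G ω u (ω u)) ≤ ρ G ω V + K + + 2 * + ω u) where

        open Raise G ω u (ω u)

        private
          h = + ω u
          hh = + 2 * + ω u
          pot-u : pot (ω u) ≡ K + K + 1ℤ - hh
          pot-u = pot-small (ω u) (pos u) 2h≤s

        ω⁺-pos : Pos ω⁺
        ω⁺-pos v = ℕP.≤-trans (pos v) (ω≤ω⁺ v)

        valid⁺ : Valid G ω⁺ (V -′ u)
        valid⁺ A A⊆ with ≤⊎+1≤ (card (A ∩ Nb)) 0ℤ
        ... | inj₁ l = ℤP.≤-trans (valid⁺-arith (ρ G ω A) hh (valid A A⊆V)) (lower A 0ℤ l)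
          where
          A⊆V : A ⊆ V
          A⊆V v q = -′-⊆ {A = V} u v (A⊆ v q)
        ... | inj₂ l₁ with card-pos⁻¹ (ℤP.≤-trans l₁ (∑-⊆ (λ v q → proj₁ (∩⁻ A Nb q)) λ _ _ → 0≤ 1))
        ...   | u₁ , u₁∈ with find (A -′ u₁)
        ...     | inj₂ none = single-valid G u₁∈ none
        ...     | inj₁ (u₂ , u₂∈) = big
          where
          A⊆V : A ⊆ V
          A⊆V v q = -′-⊆ {A = V} u v (A⊆ v q)
          u∉A : A u ≡ false
          u∉A = ≢true λ q → true≢false (A⊆ u q) (-′-∉ V u)
          2≤A : + 2 ≤ card A
          2≤A = subst (+ 2 ≤_) (sym (∑-pt (λ _ → 1ℤ) u₁∈)) (ℤP.≤-refl {1ℤ} ⊞ card-pos u₂∈)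
          K≤ρ : K ≤ ρ G ω A
          K≤ρ = gap A A⊆V 2≤A u u∈ u∉A
          A⁺ = A ∪ ⁅ u ⁆
          A⁺⊆V : A⁺ ⊆ V
          A⁺⊆V v q with ∪⁻ A ⁅ u ⁆ q
          ... | inj₁ x = A⊆V v x
          ... | inj₂ x rewrite ==⇒≡ {u = v} x = u∈
          2≤A⁺ : + 2 ≤ card A⁺
          2≤A⁺ = ℤP.≤-trans 2≤A (∑-⊆ (λ v → ∪ˡ A ⁅ u ⁆) λ _ _ → 0≤ 1)
          gap⁺ : ∀ {w} → w ∈ V → A⁺ w ≡ false → K ≤ ρ G ω A + pot (ω u) - K * cr G u A
          gap⁺ {w} p q = subst (K ≤_) (ρ-ins u∉A) (gap A⁺ A⁺⊆V 2≤A⁺ w p q)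
          j≤3 : cr G u A ≤ + 3
          j≤3 = subst (cr G u A ≤_) d≡3 (cr-⊆ G u A⊆V)
          s≤K′ : hh ≤ K
          s≤K′ = ℤP.≤-trans 2h≤s s≤K
          big : ℤ.-1ℤ ≤ ρ G ω⁺ A
          big with ≤⊎+1≤ (card (A ∩ Nb)) 1ℤ
          -- One raised vertex costs `2h ≤ s ≤ K`, covered by the gap at `A`.
          ... | inj₁ l = ℤP.≤-trans (big-arith K (ρ G ω A) hh K≤ρ s≤K′) (lower A 1ℤ l)
          ... | inj₂ l with ≤⊎+1≤ (cr G u A) (+ 2)
          -- An edge of `u` leaves `A`, so `A` with `u` is still proper. The gap there gives
          -- `ρ(A) ≥ K - 1 + 2h`, against a cost of at most `4h`.
          ...   | inj₁ j≤2 = ℤP.≤-trans (big-arith-2 K (ρ G ω A) hh (pot (ω u)) (K * cr G u A) (gap⁺ w∈ w∉) pot-u (K*-mono (ℤP.≤-trans l (card-Nb A))) s≤K′) (lower A (+ 2) (ℤP.≤-trans (card-Nb A) j≤2))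
            where
            more : 1ℤ ≤ cr G u (V ∖ A)
            more = more-arith (cr G u V) (cr G u A) (cr G u (V ∖ A)) (∑-sub _ A⊆V) (eq′ d≡3) j≤2
            wit = ∑-pos (V ∖ A) more
            w = proj₁ wit
            w∈ : w ∈ V
            w∈ = proj₁ (∖⁻ V A (proj₁ (proj₂ wit)))
            w∉ : A⁺ w ≡ false
            w∉ = cong₂ Data.Bool._∨_ (proj₂ (∖⁻ V A (proj₁ (proj₂ wit)))) (≢⇒== λ q → 1≰0 (subst (1ℤ ≤_) (trans (cong (a G u) q) (a-irr G u)) (proj₂ (proj₂ wit))))
          ...   | inj₂ 3≤j with find (V ∖ A⁺)
          -- With all three edges inside, the gap at the proper set `A⁺` gives `ρ(A) ≥ 2K - 1 + 2h`,
          -- against at most `6h`.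
          ...     | inj₁ (w , q) = ℤP.≤-trans (big-arith-3 K (ρ G ω A) hh (pot (ω u)) (K * cr G u A) (gap⁺ (proj₁ (∖⁻ V A⁺ q)) (proj₂ (∖⁻ V A⁺ q))) pot-u (K*-mono 3≤j) s≤K′) (lower A (+ 3) (ℤP.≤-trans (card-Nb A) j≤3))
          ...     | inj₂ none = ℤP.≤-trans (big-arith-4 K (ρ G ω A) hh (pot (ω u)) (K * cr G u A) (ρ G ω V) (hh * card (V ∩ Nb)) (trans (ρ-cong V≗) (ρ-ins u∉A)) pot-u (K*-mono 3≤j) whole)
                    (lower A (card (V ∩ Nb)) (∑-⊆ (λ v q → ∩⁺ V Nb (A⊆V v (proj₁ (∩⁻ A Nb q))) (proj₂ (∩⁻ A Nb q))) λ _ _ → 0≤ 1))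
            where
            V≗ : ∀ v → V v ≡ A⁺ v
            V≗ v with V v in p | A⁺ v in q
            ... | true | true = refl
            ... | false | false = refl
            ... | true | false = ⊥-elim (true≢false (∖⁺ V A⁺ p q) (none v))
            ... | false | true = ⊥-elim (true≢false (A⁺⊆V v q) p)

        cubic : Colorable G s ω V
        cubic with ih (V -′ u) G ω⁺ (del-smaller u∈) ω⁺-pos valid⁺
        ... | c , L , F = Place.place G V u c {ω} {ω⁺} ωu≤s ω≤ω⁺ (eq d≡3) (λ A A⊆ o _ → uncurry-room A (∑-pos A o)) L F
          where
          ωu≤s : ω u ℕ.≤ s
          ωu≤s = ℤP.drop‿+≤+ (ωu≤s-arith h (+ s) 2h≤s (0≤ (ω u)))
          uncurry-room : ∀ A → (∃ λ v → v ∈ A × 1ℤ ≤ a G u v) → h + wt ω A ≤ wt ω⁺ A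
          uncurry-room A (v , v∈ , q) = room v∈ q

  -- Strong induction, tiny instances and the discharging inequality.

  private
    induct-arith : ∀ x y → x + 1ℤ ≤ y → y ≤ 0ℤ → 0ℤ ≤ x → 1ℤ ≤ 0ℤ
    induct-arith x y h h′ h″ = ℤP.≤-trans {j = y} (by (h ⊞ h″) (solve (x ∷ y ∷ []))) h′

    induct-arith-2 : ∀ x y k → x + 1ℤ ≤ y → y ≤ 1ℤ + k → x ≤ k
    induct-arith-2 x y k h h′ = by (h ⊞ h′) (solve (x ∷ y ∷ k ∷ []))

    small-arith : ∀ x y z → y ≡ 1ℤ + z → + 2 ≤ x → x ≤ z → y ≤ + 2 → 1ℤ ≤ 0ℤ
    small-arith x y z refl h h′ h″ = ℤP.≤-trans {j = x - 1ℤ} (by h (solve (x ∷ []))) (by (h′ ⊞ h″) (solve (x ∷ z ∷ [])))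

    small-arith-2 : ∀ k c e x → + 2 ≤ c → k * c ≤ k * e → x ≡ (k - 1ℤ) * c - k * e → ℤ.-1ℤ ≤ x → 1ℤ ≤ 0ℤ
    small-arith-2 k c e x h h′ refl h″ = ℤP.≤-trans {j = c - 1ℤ} (by h (solve (c ∷ []))) (by (h′ ⊞ h″) (solve (k ∷ c ∷ e ∷ [])))

    discharge-arith : ∀ x f k e c → c ≡ + 2 * e → + 2 * x + f ≤ k * c → + 2 * (x - k * e) + f ≤ 0ℤ
    discharge-arith x f k e c refl h = by h (solve (x ∷ f ∷ k ∷ e ∷ []))

  module Step (P : Params) {N : ℕ} where
    open Main P {N} public

    Claim : Graph N → (Fin N → ℕ) → Sub N → Set
    Claim G ω V = Pos ω → Valid G ω V → IH V → Colorable G s ω V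

    induct : (∀ G ω V → Claim G ω V) → ∀ k G ω V → card V ≤ + k → Pos ω → Valid G ω V → Colorable G s ω V
    induct claim zero G ω V le pos valid = claim G ω V pos valid λ V′ _ _ lt _ _ → ⊥-elim (1≰0 (induct-arith (card V′) (card V) lt le (card-nn V′)))
    induct claim (suc k) G ω V le pos valid = claim G ω V pos valid λ V′ G′ ω′ lt → induct claim k G′ ω′ V′ (induct-arith-2 (card V′) (card V) (+ k) lt (ℤP.≤-trans le (eq (ℤP.pos-+ 1 k))))

    two-of : ∀ {A : Sub N} {v w} → v ∈ A → w ∈ (A -′ v) → + 2 ≤ card A
    two-of p q = subst (+ 2 ≤_) (sym (∑-pt (λ _ → 1ℤ) p)) (ℤP.≤-refl {1ℤ} ⊞ card-pos q)

    -- If some vertex fits into M, it goes there alone and at most one vertex is left for F.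
    -- Otherwise every vertex has potential `K - 1`, and `e(A) ≥ |A| ≥ 2` would make `ρ(A)` at most
    -- -2.
    small : ∀ G ω V → Valid G ω V → card V ≤ + 2 → Colorable G s ω V
    small G ω V valid le with FinP.any? (λ u → (V u Data.Bool.≟ true) ×-dec (ω u ℕ.≤? s))
    ... | yes (u , u∈ , ωu) = ⁅ u ⁆ , insert-light G {S = ∅} only (λ A A⊆ (v , q) → ⊥-elim (false≢true (A⊆ v q))) ωu (λ A A⊆ (v , q) → ⊥-elim (false≢true (A⊆ v q))) , forest
      where
      only : Adds G ∅ u (V ∩ ⁅ u ⁆)
      only v q n = ⊥-elim (n (==⇒≡ (proj₂ (∩⁻ V ⁅ u ⁆ q))))
      forest : Forest G (V ∖ ⁅ u ⁆)
      forest A A⊆ (v , q) with find (A -′ v)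
      ... | inj₂ none = ℤP.≤-trans (eq (cong (_+ 1ℤ) (single-e G q none))) (eq′ (single-card G q none))
      ... | inj₁ (w , r) = ⊥-elim (1≰0 (small-arith (card A) (card V) (card (V -′ u)) (∑-pt _ u∈) (two-of q r) (∑-⊆ A⊆ λ _ _ → 0≤ 1) le))
    ... | no none = ∅ , (λ A A⊆ (v , q) → ⊥-elim (false≢true (proj₂ (∩⁻ V ∅ (A⊆ v q))))) , forest
      where
      top : ∀ v → v ∈ V → pot (ω v) ≡ (K - 1ℤ) * 1ℤ
      top v q = trans (pot-top (ω v) (ℕP.≰⇒> λ h → none (v , q , h))) (sym (ℤP.*-identityʳ (K - 1ℤ)))
      forest : Forest G (V ∖ ∅)
      forest A A⊆ (v , q) with find (A -′ v)
      ... | inj₂ none = ℤP.≤-trans (eq (cong (_+ 1ℤ) (single-e G q none))) (eq′ (single-card G q none))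
      ... | inj₁ (w , r) with ≤⊎+1≤ (card A) (e G A)
      ...   | inj₂ h = h
      ...   | inj₁ h = ⊥-elim (1≰0 (small-arith-2 K (card A) (e G A) (ρ G ω A) (two-of q r) (K*-mono h)
                (cong (_- K * e G A) (trans (∑-cong A λ v q → top v (A⊆V v q)) (∑-* A (K - 1ℤ) _))) (valid A A⊆V)))
        where
        A⊆V : A ⊆ V
        A⊆V v q = proj₁ (∖⁻ V ∅ (A⊆ v q))

    -- 2 pot(ω v) - K d(v) summed over V is 2 ρ(V).
    discharge : ∀ G ω V (f : Fin N → ℤ) → (∀ v → v ∈ V → + 2 * pot (ω v) + f v ≤ K * cr G v V) → + 2 * ρ G ω V + ∑ V f ≤ 0ℤ
    discharge G ω V f h = discharge-arith (∑ V (λ v → pot (ω v))) (∑ V f) K (e G V) (cross G V V) (2e G V)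
        (ℤP.≤-trans (eq (sym (trans (∑-+ V _ f) (cong (_+ ∑ V f) (∑-* V (+ 2) _))))) (ℤP.≤-trans (∑-mono V h) (eq (∑-* V K _))))

  -- Odd `s`.

  private
    charge-arith : ∀ k p z → p ≡ k - 1ℤ → k * + 2 ≤ z → + 2 * p + 1ℤ ≤ z
    charge-arith k p z refl l = by (l ⊞ 0≤ 1) (solve (k ∷ z ∷ []))

    charge-arith-2 : ∀ k p z → p ≤ k + k - 1ℤ → k * + 4 ≤ z → + 2 * p + 1ℤ ≤ z
    charge-arith-2 k p z l₁ l = by (l₁ ⊞ l₁ ⊞ l ⊞ 0≤ 1) (solve (k ∷ p ∷ z ∷ []))

    color-arith : ∀ h k r c → c ≤ + 2 * h * + 3 → + 4 * h + 1ℤ ≤ k → ℤ.-1ℤ ≤ r → c ≤ r + k + + 2 * h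
    color-arith h k r c l₁ l₂ l₃ = by (l₁ ⊞ l₂ ⊞ l₃) (solve (h ∷ k ∷ r ∷ c ∷ []))

    color-arith-2 : ∀ r c → + 2 * r + c ≤ 0ℤ → ℤ.-1ℤ ≤ r → + 2 + 1ℤ ≤ c → 1ℤ ≤ 0ℤ
    color-arith-2 r c h₁ h₂ h₃ = ℤP.≤-trans {j = c - + 2} (by h₃ (solve (c ∷ []))) (by (h₁ ⊞ h₂ ⊞ h₂) (solve (r ∷ c ∷ [])))

  -- `heavy` gives a cubic vertex of weight above `s/2` a positive charge. `light` makes lighter
  -- cubic vertices reducible, since `6h ≤ -1 + K + 2h` yields the condition on the whole of `V`.
  module OddCase (P : Params)
    (heavy : ∀ h → 1 ℕ.≤ h → h ℕ.≤ Params.s P → + Params.s P + 1ℤ ≤ + 2 * + h → + 2 * Params.pot P h + 1ℤ ≤ Params.K P * + 3)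
    (light : ∀ h → + 2 * + h ≤ + Params.s P → + 4 * + h + 1ℤ ≤ Params.K P) {N : ℕ} where
    open Step P {N}

    color : ∀ G ω V → Claim G ω V
    color G ω V pos valid ih with ≤⊎+1≤ (card V) (+ 2)
    ... | inj₁ le = small G ω V valid le
    ... | inj₂ 3≤V with Choice.dense-or-gap G ω V pos valid ih
    ...   | inj₁ c = c
    ...   | inj₂ gap with FinP.any? (λ u → (V u Data.Bool.≟ true) ×-dec (((ω u ℕ.≤? s) ×-dec (cr G u V ≤? + 2)) ⊎-dec ((cr G u V ≤? 1ℤ) ⊎-dec ((+ 2 * + ω u ≤? + s) ×-dec (cr G u V ≤? + 3)))))
    ...     | yes (u , u∈ , inj₁ (ωu , d)) = Sparse.low-degree G ω V pos valid ih gap u∈ ωu d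
    ...     | yes (u , u∈ , inj₂ (inj₁ d)) = Sparse.pendant G ω V pos valid ih gap u∈ d
    ...     | yes (u , u∈ , inj₂ (inj₂ (2h , d))) with ≤⊎+1≤ (cr G u V) (+ 2)
    ...       | inj₁ d′ = Sparse.low-degree G ω V pos valid ih gap u∈ (ℤP.drop‿+≤+ (ωu≤s-arith (+ ω u) (+ s) 2h (0≤ (ω u)))) d′
    ...       | inj₂ d′ = Sparse.Cubic.cubic G ω V pos valid ih gap u∈ 2h (ℤP.≤-antisym d d′)
                  (color-arith (+ ω u) K (ρ G ω V) _ (*-monoˡ (*-nn (0≤ 2) (0≤ (ω u))) (ℤP.≤-trans (Raise.card-Nb G ω u (ω u) V) d)) (light (ω u) 2h) (valid V λ _ q → q))
    -- Every charge is at least 1, so `2ρ(V) + |V| ≤ 0`, contrary to `ρ(V) ≥ -1` and `|V| ≥ 3`.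
    color G ω V pos valid ih | inj₂ 3≤V | inj₂ gap | no none = ⊥-elim (1≰0 (color-arith-2 (ρ G ω V) (card V) (discharge G ω V (λ _ → 1ℤ) charge) (valid V λ _ q → q) 3≤V))
      where
      charge : ∀ v → v ∈ V → + 2 * pot (ω v) + 1ℤ ≤ K * cr G v V
      charge v v∈ with ω v ℕ.≤? s
      ... | no h = charge-arith K (pot (ω v)) (K * cr G v V) (pot-top (ω v) (ℕP.≰⇒> h)) (K*-mono (≰⇒+1≤ λ d → none (v , v∈ , inj₂ (inj₁ d))))
      ... | yes h with ≤⊎+1≤ (cr G v V) (+ 3)
      ...   | inj₂ d = charge-arith-2 K (pot (ω v)) (K * cr G v V) (pot-hi (ω v) (pos v)) (K*-mono d)
      ...   | inj₁ d = ℤP.≤-trans (heavy (ω v) (pos v) h (≰⇒+1≤ λ l → none (v , v∈ , inj₂ (inj₂ (l , d))))) (K*-mono (≰⇒+1≤ λ l → none (v , v∈ , inj₁ (h , l))))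

    coloring : ∀ k G ω V → card V ≤ + k → Pos ω → Valid G ω V → Colorable G s ω V
    coloring = induct color

  -- The potential functions

  private
    half-eq : ∀ j → 1ℤ + (+ 2 * j + 1ℤ) ≡ + 2 * (1ℤ + j)
    half-eq = solve-∀

  half : ∀ q → ∃ λ j → + q ≡ + 2 * + j ⊎ + q ≡ + 2 * + j + 1ℤ
  half zero = 0 , inj₁ refl
  half (suc q) with half q
  ... | j , inj₁ h = j , inj₂ (trans (ℤP.pos-+ 1 q) (trans (ℤP.+-comm 1ℤ (+ q)) (cong (_+ 1ℤ) h)))
  ... | j , inj₂ h = suc j , inj₁ (trans (ℤP.pos-+ 1 q) (trans (cong (λ x → 1ℤ + x) h) (trans (half-eq (+ j)) (cong (+ 2 *_) (sym (ℤP.pos-+ 1 j))))))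

  private
    halve-≤-arith : ∀ x y → + 2 * x ≤ + 2 * y + 1ℤ → y + 1ℤ ≤ x → 1ℤ ≤ 0ℤ
    halve-≤-arith x y h l = ℤP.≤-trans {j = + 2 * x - + 2 * y - 1ℤ} (by (l ⊞ l) (solve (x ∷ y ∷ []))) (by h (solve (x ∷ y ∷ [])))

  halve-≤ : ∀ {x y} → + 2 * x ≤ + 2 * y + 1ℤ → x ≤ y
  halve-≤ {x} {y} h with ≤⊎+1≤ x y
  ... | inj₁ l = l
  ... | inj₂ l = ⊥-elim (1≰0 (halve-≤-arith x y h l))

  private
    pos-∸-eq : ∀ d i s → d + i ≡ s → d ≡ s - i
    pos-∸-eq d i s refl = solve (d ∷ i ∷ [])

  pos-∸ : ∀ {i s} → i ℕ.≤ s → + (s ℕ.∸ i) ≡ + s - + i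
  pos-∸ {i} {s} h = pos-∸-eq (+ (s ℕ.∸ i)) (+ i) (+ s) (trans (sym (ℤP.pos-+ (s ℕ.∸ i) i)) (cong +_ (ℕP.m∸n+n≡m h)))

  private
    +1-cancel-eq : ∀ x → x ≡ x + 1ℤ - 1ℤ
    +1-cancel-eq = solve-∀

  +1-cancel : ∀ p x → x + 1ℤ ≡ p + 1ℤ → p ≡ x
  +1-cancel p x h = trans (+1-cancel-eq p) (trans (cong (_- 1ℤ) (sym h)) (sym (+1-cancel-eq x)))

  private
    go-eq : ∀ x → (x + 1ℤ) - x ≡ 1ℤ - 0ℤ
    go-eq = solve-∀

    q≡-eq : ∀ p → (p + 1ℤ) - 0ℤ ≡ p - ℤ.-1ℤ
    q≡-eq = solve-∀

    j≤s-arith-2 : ∀ j p m s → s ≡ + 2 * m → + 2 * j ≤ p + 1ℤ → p ≤ + 4 * m - 1ℤ → + 2 * j ≤ + 2 * s + 1ℤ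
    j≤s-arith-2 j p m s refl l l′ = by (l ⊞ l′ ⊞ 0≤ 1) (solve (j ∷ p ∷ m ∷ []))

    up-arith-3 : ∀ d s j m p → d ≡ s - j → s ≡ + 2 * m → p + 1ℤ ≤ + 2 * j + 1ℤ → + 2 * d ≤ + 4 * m - p
    up-arith-3 d s j m p refl refl l = by l (solve (j ∷ m ∷ p ∷ []))

    pot-lo-arith : ∀ m h p → h ≤ + 2 * m + 1ℤ → p ≡ + 8 * m + 1ℤ - + 2 * h → + 4 * m - 1ℤ ≤ p
    pot-lo-arith m h p l refl = by (l ⊞ l) (solve (m ∷ h ∷ []))

    pot-hi-arith : ∀ m h p → 1ℤ ≤ h → p ≡ + 8 * m + 1ℤ - + 2 * h → p ≤ + 4 * m + + 4 * m - 1ℤ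
    pot-hi-arith m h p l refl = by (l ⊞ l) (solve (m ∷ h ∷ []))

    pot-hi-arith-2 : ∀ m p → 0ℤ ≤ m → p ≡ + 4 * m - 1ℤ → p ≤ + 4 * m + + 4 * m - 1ℤ
    pot-hi-arith-2 m p l refl = by (l ⊞ l ⊞ l ⊞ l) (solve (m ∷ []))

    pot-step-arith : ∀ m h j t p q → t ≡ h + j → p ≡ + 8 * m + 1ℤ - + 2 * h → q ≡ + 8 * m + 1ℤ - + 2 * t → p ≤ q + + 2 * j
    pot-step-arith m h j _ _ _ refl refl refl = by (ℤP.≤-refl {0ℤ}) (solve (m ∷ h ∷ j ∷ []))

    pot-step-arith-2 : ∀ m h j t p q → t ≡ h + j → + 2 * m + 1ℤ + 1ℤ ≤ t → p ≡ + 8 * m + 1ℤ - + 2 * h → q ≡ + 4 * m - 1ℤ → p ≤ q + + 2 * j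
    pot-step-arith-2 m h j _ _ _ refl l refl refl = by (l ⊞ l ⊞ 0≤ 2) (solve (m ∷ h ∷ j ∷ []))

    pot-step-arith-3 : ∀ m h j t p q → t ≡ h + j → t ≤ + 2 * m + 1ℤ → 0ℤ ≤ j → p ≡ + 4 * m - 1ℤ → q ≡ + 8 * m + 1ℤ - + 2 * t → p ≤ q + + 2 * j
    pot-step-arith-3 m h j _ _ _ refl l l′ refl refl = by (l ⊞ l ⊞ l′ ⊞ l′) (solve (m ∷ h ∷ j ∷ []))

    pot-step-arith-4 : ∀ m j p q → 0ℤ ≤ j → p ≡ + 4 * m - 1ℤ → q ≡ + 4 * m - 1ℤ → p ≤ q + + 2 * j
    pot-step-arith-4 m j _ _ l refl refl = by (l ⊞ l) (solve (m ∷ j ∷ []))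

    pot-val-arith : ∀ m h → h ≤ + 2 * m + 1ℤ → + 2 * m + 1ℤ + 1ℤ ≤ h → 1ℤ ≤ 0ℤ
    pot-val-arith m h l l′ = ℤP.≤-trans {j = h - + 2 * m - 1ℤ} (by l′ (solve (m ∷ h ∷ []))) (by l (solve (m ∷ h ∷ [])))

    pot-top-arith : ∀ m h s p → s ≡ + 2 * m → h ≤ + 2 * m + 1ℤ → 1ℤ + s ≤ h → p ≡ + 8 * m + 1ℤ - + 2 * h → p ≡ + 4 * m - 1ℤ
    pot-top-arith m h _ _ refl l l′ refl = trans (cong (λ x → + 8 * m + 1ℤ - + 2 * x) (ℤP.≤-antisym l (ℤP.≤-trans (eq (ℤP.+-comm (+ 2 * m) 1ℤ)) l′))) (solve (m ∷ []))

    pot-small-arith : ∀ m h → + 8 * m + 1ℤ - + 2 * h ≡ + 4 * m + + 4 * m + 1ℤ - + 2 * h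
    pot-small-arith = solve-∀

    pot-small-arith-2 : ∀ m h s → s ≡ + 2 * m → + 2 * h ≤ s → 0ℤ ≤ h → h ≤ + 2 * m + 1ℤ
    pot-small-arith-2 m h s refl l l″ = by (l ⊞ l″ ⊞ 0≤ 1) (solve (m ∷ h ∷ []))

    params-arith : ∀ s m → s ≡ + 2 * m → 0ℤ ≤ m → s ≤ + 4 * m
    params-arith s m refl l = by (l ⊞ l) (solve (m ∷ []))

  -- With s = D + 1 = 2m, sparsity reads K e(A) ≤ pot(1) |A| + 1.
  module EvenParams (m : ℕ) (1≤m : 1 ℕ.≤ m) where

    μ = + m
    s = 2 ℕ.* m
    σ : + s ≡ + 2 * μ
    σ = ℤP.pos-* 2 m

    K = + 4 * μ

    Spec : ℕ → ℤ → Set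
    Spec h p = (+ h ≤ + 2 * μ + 1ℤ × p ≡ + 8 * μ + 1ℤ - + 2 * + h) ⊎ (+ 2 * μ + 1ℤ + 1ℤ ≤ + h × p ≡ + 4 * μ - 1ℤ)

    opaque
      pot : ℕ → ℤ
      pot h = if does (+ h ≤? + 2 * μ + 1ℤ) then + 8 * μ + 1ℤ - + 2 * + h else + 4 * μ - 1ℤ

      spec : ∀ h → Spec h (pot h)
      spec h with + h ≤? + 2 * μ + 1ℤ
      ... | yes l = inj₁ (l , refl)
      ... | no l = inj₂ (≰⇒+1≤ l , refl)

    0≤μ : 0ℤ ≤ μ
    0≤μ = 0≤ m

    pot-lo : ∀ h → K - 1ℤ ≤ pot h
    pot-lo h = go (spec h)
      where
      go : Spec h (pot h) → K - 1ℤ ≤ pot h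
      go (inj₁ (l , q)) = pot-lo-arith μ (+ h) (pot h) l q
      go (inj₂ (l , q)) = eq′ q

    pot-hi : ∀ h → 1 ℕ.≤ h → pot h ≤ K + K - 1ℤ
    pot-hi h 1≤h = go (spec h)
      where
      go : Spec h (pot h) → pot h ≤ K + K - 1ℤ
      go (inj₁ (l , q)) = pot-hi-arith μ (+ h) (pot h) (+≤+ 1≤h) q
      go (inj₂ (l , q)) = pot-hi-arith-2 μ (pot h) 0≤μ q

    pot-step : ∀ h j → pot h ≤ pot (h ℕ.+ j) + + 2 * + j
    pot-step h j = go (spec h) (spec (h ℕ.+ j))
      where
      H = ℤP.pos-+ h j
      go : Spec h (pot h) → Spec (h ℕ.+ j) (pot (h ℕ.+ j)) → pot h ≤ pot (h ℕ.+ j) + + 2 * + j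
      go (inj₁ (l , q)) (inj₁ (l′ , q′)) = pot-step-arith μ (+ h) (+ j) _ _ _ H q q′
      go (inj₁ (l , q)) (inj₂ (l′ , q′)) = pot-step-arith-2 μ (+ h) (+ j) _ _ _ H l′ q q′
      go (inj₂ (l , q)) (inj₁ (l′ , q′)) = pot-step-arith-3 μ (+ h) (+ j) _ _ _ H l′ (0≤ j) q q′
      go (inj₂ (l , q)) (inj₂ (l′ , q′)) = pot-step-arith-4 μ (+ j) _ _ (0≤ j) q q′

    pot-val : ∀ h → + h ≤ + 2 * μ + 1ℤ → pot h ≡ + 8 * μ + 1ℤ - + 2 * + h
    pot-val h l = go (spec h)
      where
      go : Spec h (pot h) → pot h ≡ + 8 * μ + 1ℤ - + 2 * + h
      go (inj₁ (_ , q)) = q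
      go (inj₂ (l′ , _)) = ⊥-elim (1≰0 (pot-val-arith μ (+ h) l l′))

    pot-top : ∀ h → s ℕ.< h → pot h ≡ K - 1ℤ
    pot-top h l = go (spec h)
      where
      go : Spec h (pot h) → pot h ≡ K - 1ℤ
      go (inj₂ (_ , q)) = q
      go (inj₁ (l′ , q)) = pot-top-arith μ (+ h) (+ s) (pot h) σ l′ (subst (_≤ + h) (ℤP.pos-+ 1 s) (+≤+ l)) q

    pot-small : ∀ h → 1 ℕ.≤ h → + 2 * + h ≤ + s → pot h ≡ K + K + 1ℤ - + 2 * + h
    pot-small h _ l = trans (pot-val h (pot-small-arith-2 μ (+ h) (+ s) σ l (0≤ h))) (pot-small-arith μ (+ h))

    -- A unit of weight costs at most 2 and `K = 2s`. Taking `i` as half of `p + 1`, rounded down,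
    -- gives both `2i ≤ p + 1` and `2(s - i) ≤ K - p`.
    raise : ∀ p → ℤ.-1ℤ ≤ p → p ≤ K - 1ℤ → ∃ λ i → i ℕ.≤ s ×
        (∀ h → 1 ℕ.≤ h → pot h ≤ pot (h ℕ.+ i) + (p + 1ℤ)) ×
        (∀ h → 1 ℕ.≤ h → pot h ≤ pot (h ℕ.+ (s ℕ.∸ i)) + (K - p))
    raise p lo hi with half ℤ.∣ p + 1ℤ ∣
    ... | j , h = j , j≤s , (λ h _ → ℤP.≤-trans (pot-step h j) (ℤP.+-monoʳ-≤ (pot (h ℕ.+ j)) low)) ,
          λ h _ → ℤP.≤-trans (pot-step h (s ℕ.∸ j)) (ℤP.+-monoʳ-≤ (pot (h ℕ.+ (s ℕ.∸ j))) up)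
      where
      q≡ : + ℤ.∣ p + 1ℤ ∣ ≡ p + 1ℤ
      q≡ = ℤP.0≤i⇒+∣i∣≡i (by lo (q≡-eq p))
      low : + 2 * + j ≤ p + 1ℤ
      low = go h
        where
        go : _ ⊎ _ → + 2 * + j ≤ p + 1ℤ
        go (inj₁ x) = eq (trans (sym x) q≡)
        go (inj₂ x) = ℤP.≤-trans (by (0≤ 1) (go-eq (+ 2 * + j))) (eq (trans (sym x) q≡))
      high : p + 1ℤ ≤ + 2 * + j + 1ℤ
      high = go h
        where
        go : _ ⊎ _ → p + 1ℤ ≤ + 2 * + j + 1ℤ
        go (inj₂ x) = eq (trans (sym q≡) x)
        go (inj₁ x) = ℤP.≤-trans (eq (trans (sym q≡) x)) (by (0≤ 1) (go-eq (+ 2 * + j)))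
      j≤s : j ℕ.≤ s
      j≤s = ℤP.drop‿+≤+ (halve-≤ (j≤s-arith-2 (+ j) p μ (+ s) σ low hi))
      up : + 2 * + (s ℕ.∸ j) ≤ K - p
      up = up-arith-3 (+ (s ℕ.∸ j)) (+ s) (+ j) μ p (pos-∸ j≤s) σ high

    params : Params
    params = record
      { s = s ; K = K ; pot = pot
      ; s≤K = params-arith (+ s) μ σ 0≤μ
      ; 1≤s = ℕP.≤-trans 1≤m (ℕP.m≤m+n m (1 ℕ.* m))
      ; pot-lo = pot-lo ; pot-hi = pot-hi ; pot-step = pot-step ; pot-small = pot-small ; pot-top = pot-top ; raise = raise }

  private
    up-eq : ∀ p x → x ≡ p + 1ℤ → p ≡ x - 1ℤ
    up-eq p _ refl = solve (p ∷ [])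

    up-arith : ∀ d s j n p → d ≡ s - j → s ≡ + 2 * n + 1ℤ → p ≡ + 2 * j - 1ℤ → + 2 * d ≡ + 4 * n + 1ℤ - p
    up-arith _ _ j n _ refl refl refl = solve (j ∷ n ∷ [])

    long-arith : ∀ d s j n → d ≡ s - j → s ≡ + 2 * n + 1ℤ → j + 1ℤ ≤ n → n + 1ℤ ≤ d
    long-arith _ _ j n refl refl l = by (l ⊞ 0≤ 1) (solve (j ∷ n ∷ []))

    j≤s-arith : ∀ i j p n s → i ≡ 1ℤ + j → s ≡ + 2 * n + 1ℤ → p ≡ + 2 * j → p ≤ + 4 * n + 1ℤ - 1ℤ → + 2 * i ≤ + 2 * s + 1ℤ
    j≤s-arith _ j _ n _ refl refl refl l = by (l ⊞ 0≤ 1) (solve (j ∷ n ∷ []))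

    up-arith-2 : ∀ d s i j n p → d ≡ s - i → s ≡ + 2 * n + 1ℤ → i ≡ 1ℤ + j → p ≡ + 2 * j → + 2 * d ≤ + 4 * n + 1ℤ - p
    up-arith-2 _ _ _ j n _ refl refl refl refl = by (0≤ 1) (solve (j ∷ n ∷ []))

    num₂-eq-2 : ∀ n → + 2 * n + + 2 ≡ 1ℤ + (+ 2 * n + 1ℤ)
    num₂-eq-2 = solve-∀

    lt-arith : ∀ j p n s → s ≡ + 2 * n + 1ℤ → + 2 * j ≤ p + 1ℤ → p ≤ + 4 * n + 1ℤ - 1ℤ → + 2 * j ≤ + 2 * s + 1ℤ
    lt-arith j p n _ refl l l′ = by (l ⊞ l′ ⊞ 0≤ 2) (solve (j ∷ p ∷ n ∷ []))

    go-arith-4 : ∀ a b d s j n p → d ≡ s - j → s ≡ + 2 * n + 1ℤ → p ≡ + 2 * j → a + 1ℤ ≤ b + + 2 * d → a ≤ b + (+ 4 * n + 1ℤ - p)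
    go-arith-4 a b _ _ j n _ refl refl refl l = by l (solve (a ∷ b ∷ j ∷ n ∷ []))

    go-arith-5 : ∀ a b i j p → i ≡ 1ℤ + j → p ≡ + 2 * j → a + 1ℤ ≤ b + + 2 * i → a ≤ b + (p + 1ℤ)
    go-arith-5 a b _ j _ refl refl l = by l (solve (a ∷ b ∷ j ∷ []))

    pot-lo-arith-2 : ∀ n h p → 0ℤ ≤ n → h ≤ n + 1ℤ → p ≡ + 8 * n + + 3 - + 2 * h → + 4 * n + 1ℤ - 1ℤ ≤ p
    pot-lo-arith-2 n h _ l l′ refl = by (l ⊞ l ⊞ l′ ⊞ l′ ⊞ 0≤ 1) (solve (n ∷ h ∷ []))

    pot-lo-arith-3 : ∀ n h p → h ≤ + 2 * n + + 2 → p ≡ + 8 * n + + 4 - + 2 * h → + 4 * n + 1ℤ - 1ℤ ≤ p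
    pot-lo-arith-3 n h _ l′ refl = by (l′ ⊞ l′) (solve (n ∷ h ∷ []))

    pot-lo-arith-4 : ∀ n p → p ≡ + 4 * n → + 4 * n + 1ℤ - 1ℤ ≤ p
    pot-lo-arith-4 n _ refl = by (ℤP.≤-refl {0ℤ}) (solve (n ∷ []))

    pot-hi-arith-3 : ∀ n h p → 1ℤ ≤ h → p ≡ + 8 * n + + 3 - + 2 * h → p ≤ + 4 * n + 1ℤ + (+ 4 * n + 1ℤ) - 1ℤ
    pot-hi-arith-3 n h _ l refl = by (l ⊞ l) (solve (n ∷ h ∷ []))

    pot-hi-arith-4 : ∀ n h p → 0ℤ ≤ n → n + 1ℤ + 1ℤ ≤ h → p ≡ + 8 * n + + 4 - + 2 * h → p ≤ + 4 * n + 1ℤ + (+ 4 * n + 1ℤ) - 1ℤ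
    pot-hi-arith-4 n h _ l l′ refl = by (l ⊞ l ⊞ l′ ⊞ l′ ⊞ 0≤ 1) (solve (n ∷ h ∷ []))

    pot-hi-arith-5 : ∀ n p → 0ℤ ≤ n → p ≡ + 4 * n → p ≤ + 4 * n + 1ℤ + (+ 4 * n + 1ℤ) - 1ℤ
    pot-hi-arith-5 n _ l refl = by (l ⊞ l ⊞ l ⊞ l ⊞ 0≤ 1) (solve (n ∷ []))

    pot-step-arith-5 : ∀ n h j t p q → t ≡ h + j → p ≡ + 8 * n + + 3 - + 2 * h → q ≡ + 8 * n + + 3 - + 2 * t → p ≤ q + + 2 * j
    pot-step-arith-5 n h j _ _ _ refl refl refl = by (ℤP.≤-refl {0ℤ}) (solve (n ∷ h ∷ j ∷ []))

    pot-step-arith-6 : ∀ n h j t p q → t ≡ h + j → p ≡ + 8 * n + + 3 - + 2 * h → q ≡ + 8 * n + + 4 - + 2 * t → p ≤ q + + 2 * j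
    pot-step-arith-6 n h j _ _ _ refl refl refl = by (0≤ 1) (solve (n ∷ h ∷ j ∷ []))

    pot-step-arith-7 : ∀ n h j t p q → t ≡ h + j → + 2 * n + + 2 + 1ℤ ≤ t → p ≡ + 8 * n + + 3 - + 2 * h → q ≡ + 4 * n → p ≤ q + + 2 * j
    pot-step-arith-7 n h j _ _ _ refl l refl refl = by (l ⊞ l ⊞ 0≤ 3) (solve (n ∷ h ∷ j ∷ []))

    pot-step-arith-8 : ∀ n h j t p q → t ≡ h + j → n + 1ℤ + 1ℤ ≤ h → t ≤ n + 1ℤ → 0ℤ ≤ j → p ≡ + 8 * n + + 4 - + 2 * h → q ≡ + 8 * n + + 3 - + 2 * t → p ≤ q + + 2 * j
    pot-step-arith-8 n h j _ _ _ refl l l′ l″ refl refl = by (l ⊞ l′ ⊞ l″) (solve (n ∷ h ∷ j ∷ []))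

    pot-step-arith-9 : ∀ n h j t p q → t ≡ h + j → p ≡ + 8 * n + + 4 - + 2 * h → q ≡ + 8 * n + + 4 - + 2 * t → p ≤ q + + 2 * j
    pot-step-arith-9 n h j _ _ _ refl refl refl = by (ℤP.≤-refl {0ℤ}) (solve (n ∷ h ∷ j ∷ []))

    pot-step-arith-10 : ∀ n h j t p q → t ≡ h + j → + 2 * n + + 2 + 1ℤ ≤ t → p ≡ + 8 * n + + 4 - + 2 * h → q ≡ + 4 * n → p ≤ q + + 2 * j
    pot-step-arith-10 n h j _ _ _ refl l refl refl = by (l ⊞ l ⊞ 0≤ 2) (solve (n ∷ h ∷ j ∷ []))

    pot-step-arith-11 : ∀ n h j t p q → t ≡ h + j → t ≤ n + 1ℤ → 0ℤ ≤ j → 0ℤ ≤ n → p ≡ + 4 * n → q ≡ + 8 * n + + 3 - + 2 * t → p ≤ q + + 2 * j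
    pot-step-arith-11 n h j _ _ _ refl l l′ l″ refl refl = by (l ⊞ l ⊞ l′ ⊞ l′ ⊞ l″ ⊞ l″ ⊞ 0≤ 1) (solve (n ∷ h ∷ j ∷ []))

    pot-step-arith-12 : ∀ n h j t p q → t ≡ h + j → t ≤ + 2 * n + + 2 → 0ℤ ≤ j → p ≡ + 4 * n → q ≡ + 8 * n + + 4 - + 2 * t → p ≤ q + + 2 * j
    pot-step-arith-12 n h j _ _ _ refl l l′ refl refl = by (l ⊞ l ⊞ l′ ⊞ l′) (solve (n ∷ h ∷ j ∷ []))

    pot-step-arith-13 : ∀ n j p q → 0ℤ ≤ j → p ≡ + 4 * n → q ≡ + 4 * n → p ≤ q + + 2 * j
    pot-step-arith-13 n j _ _ l refl refl = by (l ⊞ l) (solve (n ∷ j ∷ []))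

    jump-arith : ∀ n h j t p q → t ≡ h + j → t ≤ n + 1ℤ → 1ℤ ≤ h → n + 1ℤ ≤ j → p ≡ + 8 * n + + 3 - + 2 * h → q ≡ + 8 * n + + 3 - + 2 * t → p + 1ℤ ≤ q + + 2 * j
    jump-arith n h j _ _ _ refl l l′ l″ refl refl = by (l ⊞ l′ ⊞ l″) (solve (n ∷ h ∷ j ∷ []))

    jump-arith-2 : ∀ n h j t p q → t ≡ h + j → p ≡ + 8 * n + + 3 - + 2 * h → q ≡ + 8 * n + + 4 - + 2 * t → p + 1ℤ ≤ q + + 2 * j
    jump-arith-2 n h j _ _ _ refl refl refl = by (ℤP.≤-refl {0ℤ}) (solve (n ∷ h ∷ j ∷ []))

    jump-arith-3 : ∀ n h j t p q → t ≡ h + j → + 2 * n + + 2 + 1ℤ ≤ t → p ≡ + 8 * n + + 3 - + 2 * h → q ≡ + 4 * n → p + 1ℤ ≤ q + + 2 * j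
    jump-arith-3 n h j _ _ _ refl l refl refl = by (l ⊞ l ⊞ 0≤ 2) (solve (n ∷ h ∷ j ∷ []))

    jump-arith-4 : ∀ n h j t p q → t ≡ h + j → n + 1ℤ + 1ℤ ≤ h → t ≤ n + 1ℤ → n + 1ℤ ≤ j → 0ℤ ≤ n → p ≡ + 8 * n + + 4 - + 2 * h → q ≡ + 8 * n + + 3 - + 2 * t → p + 1ℤ ≤ q + + 2 * j
    jump-arith-4 n h j _ _ _ refl l l′ l″ l‴ refl refl = by (l ⊞ l′ ⊞ l″ ⊞ l‴) (solve (n ∷ h ∷ j ∷ []))

    jump-arith-5 : ∀ n h j t p q → t ≡ h + j → n + 1ℤ + 1ℤ ≤ h → t ≤ + 2 * n + + 2 → n + 1ℤ ≤ j → p ≡ + 8 * n + + 4 - + 2 * h → q ≡ + 8 * n + + 4 - + 2 * t → p + 1ℤ ≤ q + + 2 * j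
    jump-arith-5 n h j _ _ _ refl l l′ l″ refl refl = by (l ⊞ l′ ⊞ l″) (solve (n ∷ h ∷ j ∷ []))

    jump-arith-6 : ∀ n h j t p q → t ≡ h + j → + 2 * n + + 2 + 1ℤ ≤ t → p ≡ + 8 * n + + 4 - + 2 * h → q ≡ + 4 * n → p + 1ℤ ≤ q + + 2 * j
    jump-arith-6 n h j _ _ _ refl l refl refl = by (l ⊞ l ⊞ 0≤ 1) (solve (n ∷ h ∷ j ∷ []))

    jump-arith-7 : ∀ n h j t p q → t ≡ h + j → t ≤ n + 1ℤ → n + 1ℤ ≤ j → 0ℤ ≤ n → p ≡ + 4 * n → q ≡ + 8 * n + + 3 - + 2 * t → p + 1ℤ ≤ q + + 2 * j
    jump-arith-7 n h j _ _ _ refl l l′ l″ refl refl = by (l ⊞ l ⊞ l′ ⊞ l′ ⊞ l″ ⊞ l″ ⊞ l″ ⊞ l″ ⊞ 0≤ 2) (solve (n ∷ h ∷ j ∷ []))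

    jump-arith-8 : ∀ n h j t p q → t ≡ h + j → t ≤ + 2 * n + + 2 → n + 1ℤ ≤ j → 0ℤ ≤ n → p ≡ + 4 * n → q ≡ + 8 * n + + 4 - + 2 * t → p + 1ℤ ≤ q + + 2 * j
    jump-arith-8 n h j _ _ _ refl l l′ l″ refl refl = by (l ⊞ l ⊞ l′ ⊞ l′ ⊞ l″ ⊞ l″ ⊞ 0≤ 1) (solve (n ∷ h ∷ j ∷ []))

    jump-arith-9 : ∀ n j p q → n + 1ℤ ≤ j → 0ℤ ≤ n → p ≡ + 4 * n → q ≡ + 4 * n → p + 1ℤ ≤ q + + 2 * j
    jump-arith-9 n j _ _ l l′ refl refl = by (l ⊞ l ⊞ l′ ⊞ l′ ⊞ 0≤ 1) (solve (n ∷ j ∷ []))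

    pot-small-arith-3 : ∀ n h p → p ≡ + 8 * n + + 3 - + 2 * h → p ≡ + 4 * n + 1ℤ + (+ 4 * n + 1ℤ) + 1ℤ - + 2 * h
    pot-small-arith-3 n h _ refl = solve (n ∷ h ∷ [])

    pot-small-arith-4 : ∀ n h → h ≤ n → n + 1ℤ + 1ℤ ≤ h → 1ℤ ≤ 0ℤ
    pot-small-arith-4 n h l l′ = ℤP.≤-trans {j = h - n} (by (l′ ⊞ 0≤ 1) (solve (n ∷ h ∷ []))) (by l (solve (n ∷ h ∷ [])))

    pot-small-arith-5 : ∀ n h → h ≤ n → 0ℤ ≤ n → + 2 * n + + 2 + 1ℤ ≤ h → 1ℤ ≤ 0ℤ
    pot-small-arith-5 n h l l″ l′ = ℤP.≤-trans {j = h - n} (by (l′ ⊞ l″ ⊞ 0≤ 2) (solve (n ∷ h ∷ []))) (by l (solve (n ∷ h ∷ [])))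

    pot-top-arith-2 : ∀ n h s → s ≡ + 2 * n + 1ℤ → 0ℤ ≤ n → h ≤ n + 1ℤ → 1ℤ + s ≤ h → 1ℤ ≤ 0ℤ
    pot-top-arith-2 n h _ refl l l′ l″ = ℤP.≤-trans {j = h - n - 1ℤ} (by (l ⊞ l″) (solve (n ∷ h ∷ []))) (by l′ (solve (n ∷ h ∷ [])))

    pot-top-arith-3 : ∀ n h s p → s ≡ + 2 * n + 1ℤ → h ≤ + 2 * n + + 2 → 1ℤ + s ≤ h → p ≡ + 8 * n + + 4 - + 2 * h → p ≡ + 4 * n + 1ℤ - 1ℤ
    pot-top-arith-3 n h _ _ refl l l′ refl = trans (cong (λ x → + 8 * n + + 4 - + 2 * x) (ℤP.≤-antisym l (ℤP.≤-trans (eq (num₂-eq-2 n)) l′))) (solve (n ∷ []))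

    pot-top-arith-4 : ∀ n p → p ≡ + 4 * n → p ≡ + 4 * n + 1ℤ - 1ℤ
    pot-top-arith-4 n _ refl = solve (n ∷ [])

    params-arith-2 : ∀ s n → s ≡ + 2 * n + 1ℤ → 0ℤ ≤ n → s ≤ + 4 * n + 1ℤ
    params-arith-2 _ n refl l = by (l ⊞ l) (solve (n ∷ []))

    heavy-arith : ∀ n h s p → s ≡ + 2 * n + 1ℤ → s + 1ℤ ≤ + 2 * h → p ≡ + 8 * n + + 3 - + 2 * h → + 2 * p + 1ℤ ≤ (+ 4 * n + 1ℤ) * + 3
    heavy-arith n h _ _ refl l refl = by (l ⊞ l) (solve (n ∷ h ∷ []))

    heavy-arith-2 : ∀ n h p → n + 1ℤ + 1ℤ ≤ h → p ≡ + 8 * n + + 4 - + 2 * h → + 2 * p + 1ℤ ≤ (+ 4 * n + 1ℤ) * + 3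
    heavy-arith-2 n h _ l refl = by (l ⊞ l ⊞ l ⊞ l ⊞ 0≤ 2) (solve (n ∷ h ∷ []))

    heavy-arith-3 : ∀ n p → 0ℤ ≤ n → p ≡ + 4 * n → + 2 * p + 1ℤ ≤ (+ 4 * n + 1ℤ) * + 3
    heavy-arith-3 n _ l refl = by (l ⊞ l ⊞ l ⊞ l ⊞ 0≤ 2) (solve (n ∷ []))

    light-arith-3 : ∀ n h → h ≤ n → + 4 * h + 1ℤ ≤ + 4 * n + 1ℤ
    light-arith-3 n h l = by (l ⊞ l ⊞ l ⊞ l) (solve (n ∷ h ∷ []))

  -- With s = D + 1 = 2n + 1, sparsity again reads K e(A) ≤ pot(1) |A| + 1. Up to weight s + 1, each unit of weight costs 2,
  -- except that the step from n + 1 to n + 2 costs only 1.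
  module OddParams (n : ℕ) where

    ν = + n
    s = 2 ℕ.* n ℕ.+ 1
    σ : + s ≡ + 2 * ν + 1ℤ
    σ = trans (ℤP.pos-+ (2 ℕ.* n) 1) (cong (_+ 1ℤ) (ℤP.pos-* 2 n))

    K = + 4 * ν + 1ℤ

    0≤ν : 0ℤ ≤ ν
    0≤ν = 0≤ n

    Spec : ℕ → ℤ → Set
    Spec h p = (+ h ≤ ν + 1ℤ × p ≡ + 8 * ν + + 3 - + 2 * + h)
      ⊎ (ν + 1ℤ + 1ℤ ≤ + h × + h ≤ + 2 * ν + + 2 × p ≡ + 8 * ν + + 4 - + 2 * + h)
      ⊎ (+ 2 * ν + + 2 + 1ℤ ≤ + h × p ≡ + 4 * ν)

    opaque
      pot : ℕ → ℤ
      pot h = if does (+ h ≤? ν + 1ℤ) then + 8 * ν + + 3 - + 2 * + h else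
        (if does (+ h ≤? + 2 * ν + + 2) then + 8 * ν + + 4 - + 2 * + h else + 4 * ν)

      spec : ∀ h → Spec h (pot h)
      spec h = go (+ h ≤? ν + 1ℤ) (+ h ≤? + 2 * ν + + 2)
        where
        go : (d : Dec (+ h ≤ ν + 1ℤ)) (d′ : Dec (+ h ≤ + 2 * ν + + 2)) → Spec h (if does d then + 8 * ν + + 3 - + 2 * + h else
          (if does d′ then + 8 * ν + + 4 - + 2 * + h else + 4 * ν))
        go (yes l) _ = inj₁ (l , refl)
        go (no l) (yes l′) = inj₂ (inj₁ (≰⇒+1≤ l , l′ , refl))
        go (no l) (no l′) = inj₂ (inj₂ (≰⇒+1≤ l′ , refl))

    pot-lo : ∀ h → K - 1ℤ ≤ pot h
    pot-lo h = go (spec h)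
      where
      go : Spec h (pot h) → K - 1ℤ ≤ pot h
      go (inj₁ (l , q)) = pot-lo-arith-2 ν (+ h) _ 0≤ν l q
      go (inj₂ (inj₁ (_ , l , q))) = pot-lo-arith-3 ν (+ h) _ l q
      go (inj₂ (inj₂ (_ , q))) = pot-lo-arith-4 ν _ q

    pot-hi : ∀ h → 1 ℕ.≤ h → pot h ≤ K + K - 1ℤ
    pot-hi h 1≤h = go (spec h)
      where
      go : Spec h (pot h) → pot h ≤ K + K - 1ℤ
      go (inj₁ (l , q)) = pot-hi-arith-3 ν (+ h) _ (+≤+ 1≤h) q
      go (inj₂ (inj₁ (l , _ , q))) = pot-hi-arith-4 ν (+ h) _ 0≤ν l q
      go (inj₂ (inj₂ (_ , q))) = pot-hi-arith-5 ν _ 0≤ν q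

    pot-step : ∀ h j → pot h ≤ pot (h ℕ.+ j) + + 2 * + j
    pot-step h j = go (spec h) (spec (h ℕ.+ j))
      where
      H = ℤP.pos-+ h j
      go : Spec h (pot h) → Spec (h ℕ.+ j) (pot (h ℕ.+ j)) → pot h ≤ pot (h ℕ.+ j) + + 2 * + j
      go (inj₁ (_ , q)) (inj₁ (_ , q′)) = pot-step-arith-5 ν (+ h) (+ j) _ _ _ H q q′
      go (inj₁ (_ , q)) (inj₂ (inj₁ (_ , _ , q′))) = pot-step-arith-6 ν (+ h) (+ j) _ _ _ H q q′
      go (inj₁ (_ , q)) (inj₂ (inj₂ (l , q′))) = pot-step-arith-7 ν (+ h) (+ j) _ _ _ H l q q′
      go (inj₂ (inj₁ (l , _ , q))) (inj₁ (l′ , q′)) = pot-step-arith-8 ν (+ h) (+ j) _ _ _ H l l′ (0≤ j) q q′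
      go (inj₂ (inj₁ (_ , _ , q))) (inj₂ (inj₁ (_ , _ , q′))) = pot-step-arith-9 ν (+ h) (+ j) _ _ _ H q q′
      go (inj₂ (inj₁ (_ , _ , q))) (inj₂ (inj₂ (l , q′))) = pot-step-arith-10 ν (+ h) (+ j) _ _ _ H l q q′
      go (inj₂ (inj₂ (_ , q))) (inj₁ (l , q′)) = pot-step-arith-11 ν (+ h) (+ j) _ _ _ H l (0≤ j) 0≤ν q q′
      go (inj₂ (inj₂ (_ , q))) (inj₂ (inj₁ (_ , l , q′))) = pot-step-arith-12 ν (+ h) (+ j) _ _ _ H l (0≤ j) q q′
      go (inj₂ (inj₂ (_ , q))) (inj₂ (inj₂ (_ , q′))) = pot-step-arith-13 ν (+ j) _ _ (0≤ j) q q′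

    -- An increment of at least n + 1 crosses the jump of pot or runs into the plateau.
    jump : ∀ h j → 1 ℕ.≤ h → ν + 1ℤ ≤ + j → pot h + 1ℤ ≤ pot (h ℕ.+ j) + + 2 * + j
    jump h j 1≤h L = go (spec h) (spec (h ℕ.+ j))
      where
      H = ℤP.pos-+ h j
      go : Spec h (pot h) → Spec (h ℕ.+ j) (pot (h ℕ.+ j)) → pot h + 1ℤ ≤ pot (h ℕ.+ j) + + 2 * + j
      go (inj₁ (_ , q)) (inj₁ (l , q′)) = jump-arith ν (+ h) (+ j) _ _ _ H l (+≤+ 1≤h) L q q′
      go (inj₁ (_ , q)) (inj₂ (inj₁ (_ , _ , q′))) = jump-arith-2 ν (+ h) (+ j) _ _ _ H q q′
      go (inj₁ (_ , q)) (inj₂ (inj₂ (l , q′))) = jump-arith-3 ν (+ h) (+ j) _ _ _ H l q q′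
      go (inj₂ (inj₁ (l , _ , q))) (inj₁ (l′ , q′)) = jump-arith-4 ν (+ h) (+ j) _ _ _ H l l′ L 0≤ν q q′
      go (inj₂ (inj₁ (l , _ , q))) (inj₂ (inj₁ (_ , l′ , q′))) = jump-arith-5 ν (+ h) (+ j) _ _ _ H l l′ L q q′
      go (inj₂ (inj₁ (_ , _ , q))) (inj₂ (inj₂ (l , q′))) = jump-arith-6 ν (+ h) (+ j) _ _ _ H l q q′
      go (inj₂ (inj₂ (_ , q))) (inj₁ (l , q′)) = jump-arith-7 ν (+ h) (+ j) _ _ _ H l L 0≤ν q q′
      go (inj₂ (inj₂ (_ , q))) (inj₂ (inj₁ (_ , l , q′))) = jump-arith-8 ν (+ h) (+ j) _ _ _ H l L 0≤ν q q′
      go (inj₂ (inj₂ (_ , q))) (inj₂ (inj₂ (_ , q′))) = jump-arith-9 ν (+ j) _ _ L 0≤ν q q′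

    2h≤s⇒h≤n : ∀ h → + 2 * + h ≤ + s → + h ≤ ν
    2h≤s⇒h≤n h l = halve-≤ (subst (+ 2 * + h ≤_) σ l)

    pot-small : ∀ h → 1 ℕ.≤ h → + 2 * + h ≤ + s → pot h ≡ K + K + 1ℤ - + 2 * + h
    pot-small h _ l = go (spec h)
      where
      h≤n = 2h≤s⇒h≤n h l
      go : Spec h (pot h) → pot h ≡ K + K + 1ℤ - + 2 * + h
      go (inj₁ (_ , q)) = pot-small-arith-3 ν (+ h) _ q
      go (inj₂ (inj₁ (l , _ , _))) = ⊥-elim (1≰0 (pot-small-arith-4 ν (+ h) h≤n l))
      go (inj₂ (inj₂ (l , _))) = ⊥-elim (1≰0 (pot-small-arith-5 ν (+ h) h≤n 0≤ν l))

    pot-top : ∀ h → s ℕ.< h → pot h ≡ K - 1ℤ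
    pot-top h l = go (spec h)
      where
      s<h : 1ℤ + + s ≤ + h
      s<h = subst (_≤ + h) (ℤP.pos-+ 1 s) (+≤+ l)
      go : Spec h (pot h) → pot h ≡ K - 1ℤ
      go (inj₁ (l′ , q)) = ⊥-elim (1≰0 (pot-top-arith-2 ν (+ h) (+ s) σ 0≤ν l′ s<h))
      go (inj₂ (inj₁ (_ , l′ , q))) = pot-top-arith-3 ν (+ h) (+ s) _ σ l′ s<h q
      go (inj₂ (inj₂ (_ , q))) = pot-top-arith-4 ν _ q

    -- At 2 per unit the whole of `s` costs `2s = K + 1`, which is what the two ends may spend
    -- together. For even `p + 1` the split is exact. For odd `p + 1` one end is short by one; the
    -- rounding is chosen so that this end receives at least `n + 1` units, and `jump` supplies the
    -- missing unit.
    raise : ∀ p → ℤ.-1ℤ ≤ p → p ≤ K - 1ℤ → ∃ λ i → i ℕ.≤ s ×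
        (∀ h → 1 ℕ.≤ h → pot h ≤ pot (h ℕ.+ i) + (p + 1ℤ)) ×
        (∀ h → 1 ℕ.≤ h → pot h ≤ pot (h ℕ.+ (s ℕ.∸ i)) + (K - p))
    raise p lo hi = go (half ℤ.∣ p + 1ℤ ∣)
      where
      q≡ : + ℤ.∣ p + 1ℤ ∣ ≡ p + 1ℤ
      q≡ = ℤP.0≤i⇒+∣i∣≡i (by lo (q≡-eq p))
      lt : ∀ j → + 2 * + j ≤ p + 1ℤ → j ℕ.≤ s
      lt j low = ℤP.drop‿+≤+ (halve-≤ (lt-arith (+ j) p ν (+ s) σ low hi))
      go : (∃ λ j → + ℤ.∣ p + 1ℤ ∣ ≡ + 2 * + j ⊎ + ℤ.∣ p + 1ℤ ∣ ≡ + 2 * + j + 1ℤ) → _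
      go (j , inj₁ x) = j , j≤s , (λ h _ → ℤP.≤-trans (pot-step h j) (eq (cong (λ z → pot (h ℕ.+ j) + z) 2j))) ,
          λ h _ → ℤP.≤-trans (pot-step h (s ℕ.∸ j)) (eq (cong (λ z → pot (h ℕ.+ (s ℕ.∸ j)) + z) up))
        where
        2j : + 2 * + j ≡ p + 1ℤ
        2j = trans (sym x) q≡
        j≤s = lt j (eq 2j)
        up : + 2 * + (s ℕ.∸ j) ≡ K - p
        up = up-arith (+ (s ℕ.∸ j)) (+ s) (+ j) ν p (pos-∸ j≤s) σ (up-eq p (+ 2 * + j) 2j)
      go (j , inj₂ x) with ≤⊎+1≤ ν (+ j)
      ... | inj₂ j<n = j , j≤s , (λ h _ → ℤP.≤-trans (pot-step h j) (ℤP.+-monoʳ-≤ (pot (h ℕ.+ j)) low)) ,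
          λ h 1≤h → go-arith-4 (pot h) (pot (h ℕ.+ (s ℕ.∸ j))) (+ (s ℕ.∸ j)) (+ s) (+ j) ν p (pos-∸ j≤s) σ p≡ (jump h (s ℕ.∸ j) 1≤h long)
        where
        p≡ : p ≡ + 2 * + j
        p≡ = +1-cancel p (+ 2 * + j) (trans (sym x) q≡)
        low : + 2 * + j ≤ p + 1ℤ
        low = subst (λ z → + 2 * + j ≤ z + 1ℤ) (sym p≡) (by (0≤ 1) (go-eq (+ 2 * + j)))
        j≤s = lt j low
        long : ν + 1ℤ ≤ + (s ℕ.∸ j)
        long = long-arith (+ (s ℕ.∸ j)) (+ s) (+ j) ν (pos-∸ j≤s) σ j<n
      ... | inj₁ n≤j = suc j , j≤s , (λ h 1≤h → go-arith-5 (pot h) (pot (h ℕ.+ suc j)) (+ suc j) (+ j) p (ℤP.pos-+ 1 j) p≡ (jump h (suc j) 1≤h long)) ,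
          λ h _ → ℤP.≤-trans (pot-step h (s ℕ.∸ suc j)) (ℤP.+-monoʳ-≤ (pot (h ℕ.+ (s ℕ.∸ suc j))) up)
        where
        p≡ : p ≡ + 2 * + j
        p≡ = +1-cancel p (+ 2 * + j) (trans (sym x) q≡)
        j≤s : suc j ℕ.≤ s
        j≤s = ℤP.drop‿+≤+ (halve-≤ (j≤s-arith (+ suc j) (+ j) p ν (+ s) (ℤP.pos-+ 1 j) σ p≡ hi))
        long : ν + 1ℤ ≤ + suc j
        long = ℤP.≤-trans (ℤP.+-monoˡ-≤ 1ℤ n≤j) (eq (trans (ℤP.+-comm (+ j) 1ℤ) (sym (ℤP.pos-+ 1 j))))
        up : + 2 * + (s ℕ.∸ suc j) ≤ K - p
        up = up-arith-2 (+ (s ℕ.∸ suc j)) (+ s) (+ suc j) (+ j) ν p (pos-∸ j≤s) σ (ℤP.pos-+ 1 j) p≡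

    params : Params
    params = record
      { s = s ; K = K ; pot = pot
      ; s≤K = params-arith-2 (+ s) ν σ 0≤ν
      ; 1≤s = ℕP.m≤n+m 1 (2 ℕ.* n)
      ; pot-lo = pot-lo ; pot-hi = pot-hi ; pot-step = pot-step ; pot-small = pot-small ; pot-top = pot-top ; raise = raise }

    -- Equality holds at `h = n + 1`: `2(6n + 1) + 1 = 3(4n + 1)`. Hence the cheap step of `pot`
    -- must not come before weight `n + 1`.
    heavy : ∀ h → 1 ℕ.≤ h → h ℕ.≤ s → + s + 1ℤ ≤ + 2 * + h → + 2 * pot h + 1ℤ ≤ K * + 3
    heavy h _ _ l = go (spec h)
      where
      go : Spec h (pot h) → + 2 * pot h + 1ℤ ≤ K * + 3
      go (inj₁ (_ , q)) = heavy-arith ν (+ h) (+ s) _ σ l q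
      go (inj₂ (inj₁ (l , _ , q))) = heavy-arith-2 ν (+ h) _ l q
      go (inj₂ (inj₂ (_ , q))) = heavy-arith-3 ν _ 0≤ν q

    light : ∀ h → + 2 * + h ≤ + s → + 4 * + h + 1ℤ ≤ K
    light h l = light-arith-3 ν (+ h) (2h≤s⇒h≤n h l)

  -- Reducible configurations for even s

  private
    ok-arith : ∀ c x y → c ≡ x + y → x ≤ 1ℤ → y ≤ 0ℤ → c ≤ 1ℤ
    ok-arith _ x y refl h h′ = by (h ⊞ h′) (solve (x ∷ y ∷ []))

    ok-arith-2 : ∀ c c₀ e e₀ k → c ≡ 1ℤ + c₀ → e ≡ e₀ + k → k ≤ 0ℤ → c ≤ e + 1ℤ → e₀ + 1ℤ ≤ c₀ → 1ℤ ≤ 0ℤ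
    ok-arith-2 _ c₀ _ e₀ k refl refl h h′ h″ = ℤP.≤-trans {j = c₀ - e₀} (by h″ (solve (c₀ ∷ e₀ ∷ []))) (by (h ⊞ h′) (solve (c₀ ∷ e₀ ∷ k ∷ [])))

    subdivide-arith : ∀ e e′ k c a b d → e′ ≡ e + d → k ≤ a + b → a + b ≤ 1ℤ + d → e′ + 1ℤ ≤ c → e + k ≤ c
    subdivide-arith e _ k c a b d refl h₁ h₂ h₃ = by (h₁ ⊞ h₂ ⊞ h₃) (solve (e ∷ k ∷ c ∷ a ∷ b ∷ d ∷ []))

  module _ {N : ℕ} (G : Graph N) where

    cr-none : ∀ {u S A} → A ⊆ S → cr G u S ≤ 0ℤ → cr G u A ≤ 0ℤ
    cr-none {u} A⊆ h = ℤP.≤-trans (cr-⊆ G u A⊆) h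

    insert-isolated : ∀ {s ω S S′ u} → Adds G S u S′ → Light G s ω S → ω u ℕ.≤ s → cr G u S ≤ 0ℤ → Light G s ω S′
    insert-isolated ad L ωu none = insert-light G ad L ωu λ A A⊆ _ → ℤP.≤-trans (cr-none A⊆ none) (0≤ 1) , λ one → ⊥-elim (1≰0 (ℤP.≤-trans one (cr-none A⊆ none)))

    -- Neither vertex sees `S`, so a tree through `u` and `w` is just the pair and weighs
    -- `ω u + ω w`.
    insert-pair : ∀ {s ω S S′ u w} → (∀ v → v ∈ S′ → v ≢ u → v ≢ w → v ∈ S) → Light G s ω S → cr G u S ≤ 0ℤ → cr G w S ≤ 0ℤ → a G u w ≤ 1ℤ →
      ω u ℕ.+ ω w ℕ.≤ s → Light G s ω S′
    insert-pair {s} {ω} {S} {S′} {u} {w} ad L nu nw one le = insert-light G (λ v q n → -′-intro {A = S′} q n) L₁ (ℕP.≤-trans (ℕP.m≤m+n (ω u) (ω w)) le) ok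
      where
      L₁ : Light G s ω (S′ -′ u)
      L₁ = insert-isolated (λ v q n → ad v (-′-⊆ {A = S′} u v q) (-′-≢ S′ q) n) L (ℕP.≤-trans (ℕP.m≤n+m (ω w) (ω u)) le) nw
      ok : ∀ A → A ⊆ S′ -′ u → Nonempty A → cr G u A ≤ 1ℤ × (1ℤ ≤ cr G u A → card A ≤ e G A + 1ℤ → + ω u + wt ω A ≤ + s)
      ok A A⊆ ne with true⊎false (A w)
      ... | inj₂ n = ℤP.≤-trans (cr-none A⊆S nu) (0≤ 1) , λ o → ⊥-elim (1≰0 (ℤP.≤-trans o (cr-none A⊆S nu)))
        where
        A⊆S : A ⊆ S
        A⊆S v q = ad v (-′-⊆ {A = S′} u v (A⊆ v q)) (-′-≢ S′ (A⊆ v q)) λ { refl → true≢false q n }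
      ... | inj₁ y = ok-arith (cr G u A) (a G u w) (cr G u A₀) (∑-pt _ y) one (cr-none A₀⊆ nu) , λ _ t → weight t (find A₀)
        where
        A₀ = A -′ w
        A₀⊆ : A₀ ⊆ S
        A₀⊆ v q = ad v (-′-⊆ {A = S′} u v (A⊆ v q′)) (-′-≢ S′ (A⊆ v q′)) (-′-≢ A q)
          where q′ = -′-⊆ {A = A} w v q
        weight : card A ≤ e G A + 1ℤ → Nonempty A₀ ⊎ (∀ v → A₀ v ≡ false) → + ω u + wt ω A ≤ + s
        weight t (inj₁ ne′) = ⊥-elim (1≰0 (ok-arith-2 (card A) (card A₀) (e G A) (e G A₀) (cr G w A₀) (∑-pt _ y) (e-pt G y) (cr-none A₀⊆ nw) t (proj₁ (L A₀ A₀⊆ ne′))))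
        weight t (inj₂ none) = ℤP.≤-trans (eq (trans (cong (λ x → + ω u + x) (single-∑ G y none _)) (sym (ℤP.pos-+ (ω u) (ω w))))) (+≤+ le)

    module _ {x y : Fin N} (n : x ≢ y) where

      private H = addEdge G x y n

      e≤ : ∀ A → e G A ≤ e H A
      e≤ A = ℤP.≤-trans (pot-conv-arith (e G A) ⟦ A x ∧ A y ⟧ (⟦⟧-nn (A x ∧ A y))) (eq′ (e-addEdge G x y n A))

      Forest-remove : ∀ {S} → Forest H S → Forest G S
      Forest-remove F A A⊆ ne = ℤP.≤-trans (ℤP.+-monoˡ-≤ 1ℤ (e≤ A)) (F A A⊆ ne)

      Light-remove : ∀ {s ω S} → Light H s ω S → Light G s ω S
      Light-remove L A A⊆ ne = ℤP.≤-trans (ℤP.+-monoˡ-≤ 1ℤ (e≤ A)) (proj₁ (L A A⊆ ne)) , λ t → proj₂ (L A A⊆ ne) (ℤP.≤-trans t (ℤP.+-monoˡ-≤ 1ℤ (e≤ A)))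

      cr-other : ∀ {u} → u ≢ x → u ≢ y → ∀ B → cr H u B ≡ cr G u B
      cr-other {u} n₁ n₂ B = trans (cr-addEdge G x y n u B) (trans (cong (λ z → cr G u B + z) (cong₂ (λ b c → gate b ⟦ B y ⟧ + gate c ⟦ B x ⟧) (≢⇒== n₁) (≢⇒== n₂))) (ℤP.+-identityʳ _))

      -- Adding u to F in G subdivides the edge xy.
      subdivide : ∀ {S S′ u} → Adds G S u S′ → Forest H S → (∀ A → A ⊆ S → cr G u A ≤ ⟦ A x ⟧ + ⟦ A y ⟧) → Forest G S′
      subdivide {S} {S′} {u} ad F h = insert-forest G ad (Forest-remove F) λ A A⊆ ne →
          subdivide-arith (e G A) (e H A) (cr G u A) (card A) ⟦ A x ⟧ ⟦ A y ⟧ ⟦ A x ∧ A y ⟧ (e-addEdge G x y n A) (h A A⊆) (bool (A x) (A y)) (F A A⊆ ne)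
        where
        bool : ∀ b c → ⟦ b ⟧ + ⟦ c ⟧ ≤ 1ℤ + ⟦ b ∧ c ⟧
        bool true true = ℤP.≤-refl
        bool true false = ℤP.≤-refl
        bool false true = ℤP.≤-refl
        bool false false = 0≤ 1

  private
    F₁-bound-arith : ∀ x y → 0ℤ ≤ y → x ≤ y + x
    F₁-bound-arith x y h = by h (solve (x ∷ y ∷ []))

    add-arith : ∀ e k c → e + 1ℤ ≤ c → k ≤ 1ℤ → e + k ≤ c
    add-arith e k c h h′ = by (h ⊞ h′) (solve (e ∷ k ∷ c ∷ []))

    aux-arith : ∀ x y z → x ≡ y + z → x ≤ + 2 → + 2 ≤ z → y ≤ 0ℤ
    aux-arith _ y z refl h h′ = by (h ⊞ h′) (solve (y ∷ z ∷ []))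

    extend-both-arith : ∀ d x y z → d ≡ x + y → d ≡ + 3 → + 2 ≤ z → z ≤ y → x ≤ 1ℤ
    extend-both-arith _ x y z refl h h′ h″ = by (eq h ⊞ h′ ⊞ h″) (solve (x ∷ y ∷ z ∷ []))

    extend-both-arith-2 : ∀ d x y z f → d ≡ x + y → d ≡ + 3 → y ≡ z + f → + 2 ≤ z → 0ℤ ≤ f → x + f ≤ 1ℤ
    extend-both-arith-2 _ x _ z f refl h refl h′ h″ = by (eq h ⊞ h′) (solve (x ∷ z ∷ f ∷ []))

    rest-arith : ∀ d a b c r → d ≡ a + c → c ≡ b + r → d ≡ + 2 → 1ℤ ≤ a → 1ℤ ≤ b → r ≤ 0ℤ
    rest-arith _ a b _ r refl refl h h′ h″ = by (eq h ⊞ h′ ⊞ h″) (solve (a ∷ b ∷ r ∷ []))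

    bound-arith-2 : ∀ c a b d r → c ≤ a + d → d ≤ b + r → r ≤ 0ℤ → c ≤ a + b
    bound-arith-2 c a b d r h₁ h₂ h₃ = by (h₁ ⊞ h₂ ⊞ h₃) (solve (c ∷ a ∷ b ∷ d ∷ r ∷ []))

    both-arith : ∀ d a b c r → d ≡ a + c → c ≡ b + r → 1ℤ ≤ a → 1ℤ ≤ b → 0ℤ ≤ r → + 2 ≤ d
    both-arith _ a b _ r refl refl h h′ h″ = by (h ⊞ h′ ⊞ h″) (solve (a ∷ b ∷ r ∷ []))

    valid′-arith-2 : ∀ m p e e′ z q t → e′ ≡ e + 1ℤ → t ≡ (p - + 4 * m * e) + q - z → q ≡ + 4 * m - 1ℤ → + 4 * m * + 2 ≤ z → ℤ.-1ℤ ≤ t → ℤ.-1ℤ ≤ p - + 4 * m * e′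
    valid′-arith-2 m p e _ z _ _ refl refl refl h₁ h₂ = by (h₁ ⊞ h₂ ⊞ 0≤ 1) (solve (m ∷ p ∷ e ∷ z ∷ []))

    valid⁺-arith-2 : ∀ m r → + 4 * m ≤ r → ℤ.-1ℤ ≤ r - + 2 * m * + 2
    valid⁺-arith-2 m r l = by (l ⊞ 0≤ 1) (solve (m ∷ r ∷ []))

    no-double-arith : ∀ m r p q z t → r ≡ p → p ≤ + 8 * m - 1ℤ → q ≡ + 4 * m - 1ℤ → + 4 * m * + 2 ≤ z → t ≡ r + q - z → + 4 * m ≤ t → 1ℤ ≤ 0ℤ
    no-double-arith m _ p _ z _ refl h₁ refl h₂ refl h₃ = ℤP.≤-trans {j = p - z} (by h₃ (solve (m ∷ p ∷ z ∷ []))) (by (h₁ ⊞ h₂ ⊞ 0≤ 1) (solve (m ∷ p ∷ z ∷ [])))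

    result-arith : ∀ d a b → d ≡ a + b → d ≡ + 2 → a ≤ 1ℤ → 1ℤ ≤ b
    result-arith _ a b refl h h′ = by (eq′ h ⊞ h′) (solve (a ∷ b ∷ []))

    pot-le-eq : ∀ m → + 4 * m + + 4 * m - 1ℤ ≡ + 8 * m - 1ℤ
    pot-le-eq = solve-∀

    Adjacent-arith : ∀ d x y → d ≡ x + y → d ≡ + 3 → 1ℤ ≤ x → y ≤ + 2
    Adjacent-arith _ x y refl h h′ = by (eq h ⊞ h′) (solve (x ∷ y ∷ []))

    third-arith : ∀ a b c → a ≡ 1ℤ + b → b ≡ 1ℤ + c → + 3 ≤ a → 1ℤ ≤ c
    third-arith _ _ c refl refl h = by h (solve (c ∷ []))

    pot-m-arith : ∀ m → 0ℤ ≤ m → m ≤ + 2 * m + 1ℤ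
    pot-m-arith m h = by (h ⊞ 0≤ 1) (solve (m ∷ []))

    pot-m-eq : ∀ m → + 8 * m + 1ℤ - + 2 * m ≡ + 6 * m + 1ℤ
    pot-m-eq = solve-∀

  module Even (m : ℕ) (1≤m : 1 ℕ.≤ m) {N : ℕ} where
    open EvenParams m 1≤m using (μ; σ; 0≤μ; pot-val; params) public
    open Step params {N} public

    1≤μ : 1ℤ ≤ μ
    1≤μ = +≤+ 1≤m

    m+m≡s : m ℕ.+ m ≡ s
    m+m≡s = cong (m ℕ.+_) (sym (ℕP.+-identityʳ m))

    m≤s : m ℕ.≤ s
    m≤s = subst (m ℕ.≤_) m+m≡s (ℕP.m≤m+n m m)

    pot-m : pot m ≡ + 6 * μ + 1ℤ
    pot-m = trans (pot-val m (pot-m-arith μ 0≤μ)) (pot-m-eq μ)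

    module Reduce (G : Graph N) (ω : Fin N → ℕ) (V : Sub N) (pos : Pos ω) (valid : Valid G ω V) (ih : IH V) (gap : Gap G ω V) where
      open Sparse G ω V pos valid ih gap public

      pot-le : ∀ v → pot (ω v) ≤ + 8 * μ - 1ℤ
      pot-le v = ℤP.≤-trans (pot-hi (ω v) (pos v)) (eq (pot-le-eq μ))

      -- Delete both vertices and add m to the weights of the other neighbours of u.
      module Adjacent {u w : Fin N} (u∈ : u ∈ V) (w∈ : w ∈ V) (du : cr G u V ≡ + 3) (dw : cr G w V ≡ + 3) (ωu : ω u ≡ m) (ωw : ω w ≡ m) (adj : 1ℤ ≤ a G u w) where

        open Raise G ω u m

        u≢w : u ≢ w
        u≢w refl = 1≰0 (subst (1ℤ ≤_) (a-irr G u) adj)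

        U : Sub N
        U = V -′ u -′ w

        U⊆V : U ⊆ V
        U⊆V v q = -′-⊆ {A = V} u v (-′-⊆ {A = V -′ u} w v q)

        ∈U : ∀ {v} → v ∈ V → v ≢ u → v ≢ w → v ∈ U
        ∈U {v} p n n′ = -′-intro {A = V -′ u} (-′-intro {A = V} p n) n′

        w∈′ : w ∈ (V -′ u)
        w∈′ = -′-intro {A = V} w∈ (u≢w ∘ sym)

        cr-u : cr G u V ≡ a G u w + cr G u U
        cr-u = trans (sym (cr-self G u V)) (∑-pt _ w∈′)

        cr-w : cr G w V ≡ a G w u + cr G w U
        cr-w = trans (∑-pt _ u∈) (cong (λ z → a G w u + z) (sym (cr-self G w (V -′ u))))

        cr-u≤2 : cr G u U ≤ + 2
        cr-u≤2 = Adjacent-arith (cr G u V) (a G u w) (cr G u U) cr-u du adj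

        adj′ : 1ℤ ≤ a G w u
        adj′ = subst (1ℤ ≤_) (a-sym G u w) adj

        cr-w≤2 : cr G w U ≤ + 2
        cr-w≤2 = Adjacent-arith (cr G w V) (a G w u) (cr G w U) cr-w dw adj′

        smaller : card U + 1ℤ ≤ card V
        smaller = ℤP.≤-trans (ℤP.+-monoˡ-≤ 1ℤ (∑-⊆ (λ v q → -′-⊆ {A = V -′ u} w v q) λ _ _ → 0≤ 1)) (del-smaller u∈)

        valid⁺ : Valid G ω⁺ U
        valid⁺ A A⊆ with ≤⊎+1≤ (card (A ∩ Nb)) 0ℤ
        ... | inj₁ l = ℤP.≤-trans (valid⁺-arith (ρ G ω A) (+ 2 * μ) (valid A λ v q → U⊆V v (A⊆ v q))) (lower A 0ℤ l)
        ... | inj₂ l₁ with card-pos⁻¹ (ℤP.≤-trans l₁ (∑-⊆ (λ v q → proj₁ (∩⁻ A Nb q)) λ _ _ → 0≤ 1))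
        ...   | u₁ , u₁∈ with find (A -′ u₁)
        ...     | inj₂ none = single-valid G u₁∈ none
        -- With `w` deleted, at most two raised neighbours remain, and `2 * 2m = K` is covered by
        -- the gap.
        ...     | inj₁ (u₂ , u₂∈) = ℤP.≤-trans (valid⁺-arith-2 μ (ρ G ω A) (gap A (λ v q → U⊆V v (A⊆ v q)) (two-of u₁∈ u₂∈) u u∈ u∉A)) (lower A (+ 2) (ℤP.≤-trans (card-Nb A) (ℤP.≤-trans (cr-⊆ G u A⊆) cr-u≤2)))
          where
          u∉A : A u ≡ false
          u∉A = ≢true λ q → -′-≢ V (-′-⊆ {A = V -′ u} w u (A⊆ u q)) refl

        ω⁺-pos : Pos ω⁺
        ω⁺-pos v = ℕP.≤-trans (pos v) (ω≤ω⁺ v)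

        module _ (c : Sub N) (L⁺ : Light G s ω⁺ (U ∩ c)) (F : Forest G (U ∖ c)) where

          private
            M = U ∩ c
            FS = U ∖ c
            L : Light G s ω M
            L = Light-mono G (λ v _ → ω≤ω⁺ v) L⁺

            cr-split : ∀ v → cr G v U ≡ cr G v M + cr G v FS
            cr-split v = ∑-split U c _

            no-M : ∀ v → cr G v U ≤ + 2 → + 2 ≤ cr G v FS → cr G v M ≤ 0ℤ
            no-M v h h′ = aux-arith (cr G v U) (cr G v M) (cr G v FS) (cr-split v) h h′

            ωu≤s : ω u ℕ.≤ s
            ωu≤s = subst (ℕ._≤ s) (sym ωu) m≤s

            ωw≤s : ω w ℕ.≤ s
            ωw≤s = subst (ℕ._≤ s) (sym ωw) m≤s

            col : Bool → Bool → Sub N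
            col bu bw v = if v == u then bu else (if v == w then bw else c v)

            col-val : ∀ {bu bw v b₁ b₂} → (v == u) ≡ b₁ → (v == w) ≡ b₂ → col bu bw v ≡ (if b₁ then bu else (if b₂ then bw else c v))
            col-val {bu} {bw} {v} = cong₂ (λ b₁ b₂ → if b₁ then bu else (if b₂ then bw else c v))

            cases : ∀ {bu bw v} → v ∈ V → (v ≡ u × col bu bw v ≡ bu) ⊎ (v ≡ w × col bu bw v ≡ bw) ⊎ (v ∈ U × col bu bw v ≡ c v)
            cases {bu} {bw} {v} v∈ with true⊎false (v == u) | true⊎false (v == w)
            ... | inj₁ p | _ = inj₁ (==⇒≡ p , col-val {v = v} p refl)
            ... | inj₂ p | inj₁ p′ = inj₂ (inj₁ (==⇒≡ p′ , col-val {v = v} p p′))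
            ... | inj₂ p | inj₂ p′ = inj₂ (inj₂ (∈U v∈ (==-false p) (==-false p′) , col-val {v = v} p p′))

            M-cases : ∀ {bu bw v} → v ∈ V ∩ col bu bw → (v ≡ u × bu ≡ true) ⊎ (v ≡ w × bw ≡ true) ⊎ v ∈ M
            M-cases {bu} {bw} {v} q with cases {bu} {bw} (proj₁ (∩⁻ V (col bu bw) q))
            ... | inj₁ (p , r) = inj₁ (p , trans (sym r) (proj₂ (∩⁻ V (col bu bw) q)))
            ... | inj₂ (inj₁ (p , r)) = inj₂ (inj₁ (p , trans (sym r) (proj₂ (∩⁻ V (col bu bw) q))))
            ... | inj₂ (inj₂ (p , r)) = inj₂ (inj₂ (∩⁺ U c p (trans (sym r) (proj₂ (∩⁻ V (col bu bw) q)))))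

            F-cases : ∀ {bu bw v} → v ∈ V ∖ col bu bw → (v ≡ u × bu ≡ false) ⊎ (v ≡ w × bw ≡ false) ⊎ v ∈ FS
            F-cases {bu} {bw} {v} q with cases {bu} {bw} (proj₁ (∖⁻ V (col bu bw) q))
            ... | inj₁ (p , r) = inj₁ (p , trans (sym r) (proj₂ (∖⁻ V (col bu bw) q)))
            ... | inj₂ (inj₁ (p , r)) = inj₂ (inj₁ (p , trans (sym r) (proj₂ (∖⁻ V (col bu bw) q))))
            ... | inj₂ (inj₂ (p , r)) = inj₂ (inj₂ (∖⁺ U c p (trans (sym r) (proj₂ (∖⁻ V (col bu bw) q)))))

            case-else : ∀ {P Q R : Set} → (P → ⊥) → (Q → ⊥) → P ⊎ Q ⊎ R → R
            case-else np nq (inj₁ p) = ⊥-elim (np p)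
            case-else np nq (inj₂ (inj₁ q)) = ⊥-elim (nq q)
            case-else np nq (inj₂ (inj₂ r)) = r

          extend-both : Colorable G s ω V
          extend-both with extend G FS u F | extend G FS w F
          -- Both are refused by F, so each sends two edges there and none to M. The edge between
          -- them is then simple, and the pair weighs `2m = s`.
          ... | inj₂ bu | inj₂ bw = col true true ,
                insert-pair G {u = u} {w} (λ v q n n′ → case-else (n ∘ proj₁) (n′ ∘ proj₁) (M-cases q)) L (no-M u cr-u≤2 bu) (no-M w cr-w≤2 bw)
                  (extend-both-arith (cr G u V) (a G u w) (cr G u U) (cr G u FS) cr-u du bu (cr-⊆ G u λ v q → proj₁ (∖⁻ U c q)))
                  (subst₂ (λ x y → x ℕ.+ y ℕ.≤ s) (sym ωu) (sym ωw) (ℕP.≤-reflexive m+m≡s)) ,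
                Forest-⊆ G (λ v q → case-else (λ { (_ , ()) }) (λ { (_ , ()) }) (F-cases q)) F
          ... | inj₂ bu | inj₁ ok = col true false ,
                insert-isolated G {u = u} (λ v q n → case-else (n ∘ proj₁) (λ { (_ , ()) }) (M-cases q)) L ωu≤s (no-M u cr-u≤2 bu) ,
                ok _ (λ v q n → case-else (λ { (_ , ()) }) (n ∘ proj₁) (F-cases q))
          ... | inj₁ ok | inj₂ bw = col false true ,
                insert-isolated G {u = w} (λ v q n → case-else (λ { (_ , ()) }) (n ∘ proj₁) (M-cases q)) L ωw≤s (no-M w cr-w≤2 bw) ,
                ok _ (λ v q n → case-else (n ∘ proj₁) (λ { (_ , ()) }) (F-cases q))
          ... | inj₁ _ | inj₁ ok with ≤⊎+1≤ (cr G u M) 1ℤ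
          -- The vertex `u` joins at most one tree of M, through a neighbour at which `m` was
          -- reserved; `w` goes to F.
          ...   | inj₁ one = col true false ,
                insert-light G {u = u} (λ v q n → case-else (n ∘ proj₁) (λ { (_ , ()) }) (M-cases q)) L ωu≤s
                  (λ A A⊆ ne → ℤP.≤-trans (cr-⊆ G u A⊆) one , λ o t → weight A A⊆ ne t (∑-pos A o)) ,
                ok _ (λ v q n → case-else (λ { (_ , ()) }) (n ∘ proj₁) (F-cases q))
            where
            weight : ∀ A → A ⊆ M → Nonempty A → card A ≤ e G A + 1ℤ → (∃ λ v → v ∈ A × 1ℤ ≤ a G u v) → + ω u + wt ω A ≤ + s
            weight A A⊆ ne t (v , v∈ , r) = ℤP.≤-trans (subst (λ x → + x + wt ω A ≤ wt ω⁺ A) (sym ωu) (room v∈ r)) (proj₂ (L⁺ A A⊆ ne) t)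
          -- Two edges from `u` go to M, so at most one goes to F enlarged by `w`, and `u` can
          -- follow `w` into F.
          ...   | inj₂ two = col false false , Light-⊆ G (λ v q → case-else (λ { (_ , ()) }) (λ { (_ , ()) }) (M-cases q)) L ,
                insert-forest G {S = F₁} {u = u} (λ v q n → -′-intro {A = V ∖ col false false} q n) Fw add
            where
            F₁ = (V ∖ col false false) -′ u
            Fw : Forest G F₁
            Fw = ok F₁ λ v q n → case-else (λ p → -′-≢ (V ∖ col false false) q (proj₁ p)) (n ∘ proj₁) (F-cases (-′-⊆ {A = V ∖ col false false} u v q))
            F₁-bound : cr G u F₁ ≤ a G u w + cr G u FS
            F₁-bound with true⊎false (F₁ w)
            ... | inj₁ y = ℤP.≤-trans (eq (∑-pt _ y)) (ℤP.+-monoʳ-≤ (a G u w) (cr-⊆ G u λ v q → sub v (-′-⊆ {A = F₁} w v q) (-′-≢ F₁ q)))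
              where
              sub : ∀ v → v ∈ F₁ → v ≢ w → v ∈ FS
              sub v q n = case-else (λ p → -′-≢ (V ∖ col false false) q (proj₁ p)) (n ∘ proj₁) (F-cases (-′-⊆ {A = V ∖ col false false} u v q))
            ... | inj₂ n = ℤP.≤-trans (cr-⊆ G u λ v q → sub v q λ { refl → true≢false q n }) (F₁-bound-arith (cr G u FS) (a G u w) (a-nn G u w))
              where
              sub : ∀ v → v ∈ F₁ → v ≢ w → v ∈ FS
              sub v q n = case-else (λ p → -′-≢ (V ∖ col false false) q (proj₁ p)) (n ∘ proj₁) (F-cases (-′-⊆ {A = V ∖ col false false} u v q))
            add : ∀ A → A ⊆ F₁ → Nonempty A → e G A + cr G u A ≤ card A
            add A A⊆ ne = add-arith (e G A) (cr G u A) (card A) (Fw A A⊆ ne) (ℤP.≤-trans (cr-⊆ G u A⊆) (ℤP.≤-trans F₁-bound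
                (extend-both-arith-2 (cr G u V) (a G u w) (cr G u U) (cr G u M) (cr G u FS) cr-u du (cr-split u) two (cr-nn G u FS))))

        result : Colorable G s ω V
        result with ih U G ω⁺ smaller ω⁺-pos valid⁺
        ... | c , L , F = extend-both c L F

      third : + 3 ≤ card V → ∀ {x y} → x ∈ V → y ∈ V → x ≢ y → ∃ λ w → w ∈ V × w ≢ x × w ≢ y
      third 3≤V {x} {y} x∈ y∈ n with card-pos⁻¹ (third-arith (card V) (card (V -′ x)) (card (V -′ x -′ y)) (∑-pt _ x∈) (∑-pt _ (-′-intro {A = V} y∈ (n ∘ sym))) 3≤V)
      ... | w , q = w , -′-⊆ {A = V} x w (-′-⊆ {A = V -′ x} y w q) , -′-≢ V (-′-⊆ {A = V -′ x} y w q) , -′-≢ (V -′ x) q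

      cr-drop : ∀ {u x} A → a G u x ≤ 1ℤ → cr G u A ≤ ⟦ A x ⟧ + cr G u (A -′ x)
      cr-drop {u} {x} A h with true⊎false (A x)
      ... | inj₁ y = ℤP.≤-trans (eq (∑-pt _ y)) (ℤP.+-monoˡ-≤ _ (ℤP.≤-trans h (eq (cong ⟦_⟧ (sym y)))))
      ... | inj₂ n = ℤP.≤-trans (cr-⊆ G u λ v q → -′-intro {A = A} q λ { refl → true≢false q n }) (eq (trans (sym (ℤP.+-identityˡ _)) (cong (λ b → ⟦ b ⟧ + cr G u (A -′ x)) (sym n))))

      -- A forced-F vertex of degree 2 is replaced by an edge between its neighbours.
      module DegreeTwo {f : Fin N} (f∈ : f ∈ V) (ωf : s ℕ.< ω f) (df : cr G f V ≡ + 2) (3≤V : + 3 ≤ card V) where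

        -- A double edge would give the pair potential at most `(8m - 1) + (4m - 1) - 8m = 4m - 2`,
        -- below the gap; a third vertex of `V` makes the pair proper.
        no-double : ∀ {x} → x ∈ V → a G f x ≤ 1ℤ
        no-double {x} x∈ with ≤⊎+1≤ (a G f x) 1ℤ
        ... | inj₁ l = l
        ... | inj₂ l = ⊥-elim (1≰0 (no-double-arith μ (ρ G ω ⁅ x ⁆) (pot (ω x)) (pot (ω f)) (K * cr G f ⁅ x ⁆) (ρ G ω (⁅ x ⁆ ∪ ⁅ f ⁆))
                (single-ρ G {A = ⁅ x ⁆} (==-refl x) (λ v → none v)) (pot-le x) (pot-top (ω f) ωf) (subst (λ z → K * + 2 ≤ K * z) (sym (∑-⁅⁆ x _)) (K*-mono l))
                (ρ-ins {A = ⁅ x ⁆} {f} (≢⇒== (x≢f ∘ sym))) (gap (⁅ x ⁆ ∪ ⁅ f ⁆) sub (two-of (∪ˡ ⁅ x ⁆ ⁅ f ⁆ (==-refl x)) (-′-intro {A = ⁅ x ⁆ ∪ ⁅ f ⁆} (∪ʳ ⁅ x ⁆ ⁅ f ⁆ (==-refl f)) (x≢f ∘ sym)))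
                  (proj₁ w) (proj₁ (proj₂ w)) (cong₂ Data.Bool._∨_ (≢⇒== (proj₁ (proj₂ (proj₂ w)))) (≢⇒== (proj₂ (proj₂ (proj₂ w))))))))
          where
          x≢f : x ≢ f
          x≢f refl = 1≰0 (ℤP.≤-trans (+≤+ (s≤s z≤n)) (subst (+ 2 ≤_) (a-irr G f) l))
          w = third 3≤V x∈ f∈ x≢f
          none : ∀ v → (⁅ x ⁆ -′ x) v ≡ false
          none v = ≢true λ q → -′-≢ ⁅ x ⁆ q (==⇒≡ (-′-⊆ {A = ⁅ x ⁆} x v q))
          sub : ⁅ x ⁆ ∪ ⁅ f ⁆ ⊆ V
          sub v q with ∪⁻ ⁅ x ⁆ ⁅ f ⁆ q
          ... | inj₁ r = subst (_∈ V) (sym (==⇒≡ r)) x∈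
          ... | inj₂ r = subst (_∈ V) (sym (==⇒≡ r)) f∈

        nb₁ : ∃ λ x → x ∈ V × 1ℤ ≤ a G f x
        nb₁ = ∑-pos V (ℤP.≤-trans (+≤+ (s≤s z≤n)) (eq′ df))

        module Subdivide {x y : Fin N} (x∈ : x ∈ V) (fx : 1ℤ ≤ a G f x) (y∈x : y ∈ (V -′ x)) (fy : 1ℤ ≤ a G f y) where

          y∈ : y ∈ V
          y∈ = -′-⊆ {A = V} x y y∈x

          x≢y : x ≢ y
          x≢y h = -′-≢ V y∈x (sym h)

          G′ : Graph N
          G′ = addEdge G x y x≢y

          rest : cr G f (V -′ x -′ y) ≤ 0ℤ
          rest = rest-arith (cr G f V) (a G f x) (a G f y) (cr G f (V -′ x)) (cr G f (V -′ x -′ y)) (∑-pt _ x∈) (∑-pt _ y∈x) df fx fy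

          bound : ∀ A → A ⊆ V → cr G f A ≤ ⟦ A x ⟧ + ⟦ A y ⟧
          bound A A⊆ = bound-arith-2 (cr G f A) ⟦ A x ⟧ ⟦ A y ⟧ (cr G f (A -′ x)) (cr G f (A -′ x -′ y)) (cr-drop A (no-double x∈))
              (subst (λ b → cr G f (A -′ x) ≤ ⟦ b ⟧ + cr G f (A -′ x -′ y)) Ay (cr-drop (A -′ x) (no-double y∈)))
              (ℤP.≤-trans (cr-⊆ G f λ v q → -′-intro {A = V -′ x} (-′-intro {A = V} (A⊆ v (-′-⊆ {A = A} x v (-′-⊆ {A = A -′ x} y v q))) (-′-≢ A (-′-⊆ {A = A -′ x} y v q))) (-′-≢ (A -′ x) q)) rest)
            where
            Ay : (A -′ x) y ≡ A y
            Ay with true⊎false (A y)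
            ... | inj₁ p = trans (-′-intro {A = A} p (x≢y ∘ sym)) (sym p)
            ... | inj₂ p = trans (≢true λ q → true≢false (-′-⊆ {A = A} x y q) p) (sym p)

          both : ∀ {A} → x ∈ A → y ∈ A → + 2 ≤ cr G f A
          both {A} p q = both-arith (cr G f A) (a G f x) (a G f y) (cr G f (A -′ x)) (cr G f (A -′ x -′ y)) (∑-pt _ p) (∑-pt _ (-′-intro {A = A} q (x≢y ∘ sym))) fx fy (cr-nn G f (A -′ x -′ y))

          valid′ : Valid G′ ω (V -′ f)
          valid′ A A⊆ with true⊎false (A x ∧ A y)
          ... | inj₂ n = subst (ℤ.-1ℤ ≤_) (cong (λ z → ∑ A (λ v → pot (ω v)) - K * z) (sym (trans (e-addEdge G x y x≢y A) (trans (cong (λ b → e G A + ⟦ b ⟧) n) (ℤP.+-identityʳ _))))) (valid A A⊆V)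
            where
            A⊆V : A ⊆ V
            A⊆V v q = -′-⊆ {A = V} f v (A⊆ v q)
          -- Trading `f` for the edge gains one: `f` contributes at most `(K - 1) - 2K`, the new
          -- edge `-K`.
          ... | inj₁ b = valid′-arith-2 μ (∑ A (λ v → pot (ω v))) (e G A) (e G′ A) (K * cr G f A) (pot (ω f)) (ρ G ω (A ∪ ⁅ f ⁆)) (trans (e-addEdge G x y x≢y A) (cong (λ z → e G A + ⟦ z ⟧) b))
                  (ρ-ins (≢true λ q → -′-≢ V (A⊆ f q) refl)) (pot-top (ω f) ωf) (K*-mono (both (proj₁ (∧-true b)) (proj₂ (∧-true {A x} b)))) (valid (A ∪ ⁅ f ⁆) sub)
            where
            sub : A ∪ ⁅ f ⁆ ⊆ V
            sub v q with ∪⁻ A ⁅ f ⁆ q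
            ... | inj₁ r = -′-⊆ {A = V} f v (A⊆ v r)
            ... | inj₂ r = subst (_∈ V) (sym (==⇒≡ r)) f∈

          result : Colorable G s ω V
          result with ih (V -′ f) G′ ω (del-smaller f∈) pos valid′
          ... | c , L , F = c -′ f , Light-⊆ G (Place.toF-M G V f c) (Light-remove G x≢y L) ,
                subdivide G x≢y (Place.toF-F G V f c) F λ A A⊆ → bound A λ v q → -′-⊆ {A = V} f v (proj₁ (∖⁻ (V -′ f) c (A⊆ v q)))

        result : Colorable G s ω V
        result with nb₁
        ... | x , x∈ , fx with ∑-pos (V -′ x) (result-arith (cr G f V) (a G f x) (cr G f (V -′ x)) (∑-pt _ x∈) df (no-double x∈))
        ...   | y , y∈ , fy = Subdivide.result x∈ fx y∈ fy

  -- A vertex of weight 1 with four cubic neighbours.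

  private
    M-u₄-arith : ∀ d a b f m → d ≡ a + b → d ≡ + 3 → 1ℤ ≤ a → + 2 ≤ f → f + m ≤ b → m ≤ 0ℤ
    M-u₄-arith _ a b f m refl h h₁ h₂ h₃ = by (eq h ⊞ h₁ ⊞ h₂ ⊞ h₃) (solve (a ∷ b ∷ f ∷ m ∷ []))

    one-arith : ∀ m r t → + 4 * m ≤ t → t ≤ r - + 2 * m + 1ℤ → + 6 * m - 1ℤ ≤ r
    one-arith m r t h h′ = by (h ⊞ h′) (solve (m ∷ r ∷ t ∷ []))

    two-arms-arith : ∀ c a p b r → c ≡ a + p → p ≡ b + r → 1ℤ ≤ a → 1ℤ ≤ b → 0ℤ ≤ r → + 2 ≤ c
    two-arms-arith _ a _ b r refl refl h h′ h″ = by (h ⊞ h′ ⊞ h″) (solve (a ∷ b ∷ r ∷ []))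

    two-arms-arith-2 : ∀ m r s t z → + 4 * m ≤ z → s ≤ r - + 2 * m + 1ℤ → t ≤ s - + 2 * m + 1ℤ → z ≤ t + + 8 * m - 1ℤ - + 4 * m * + 2 → + 8 * m - 1ℤ ≤ r
    two-arms-arith-2 m r s t z h h′ h″ h‴ = by (h ⊞ h′ ⊞ h″ ⊞ h‴) (solve (m ∷ r ∷ s ∷ t ∷ z ∷ []))

    three-arms-arith : ∀ c a p b q d r → c ≡ a + p → p ≡ b + q → q ≡ d + r → 1ℤ ≤ a → 1ℤ ≤ b → 1ℤ ≤ d → 0ℤ ≤ r → + 3 ≤ c
    three-arms-arith _ a _ b _ d r refl refl refl h h′ h″ h‴ = by (h ⊞ h′ ⊞ h″ ⊞ h‴) (solve (a ∷ b ∷ d ∷ r ∷ []))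

    three-arms-arith-2 : ∀ m r s t q z → + 4 * m ≤ z → s ≤ r - + 2 * m + 1ℤ → t ≤ s - + 2 * m + 1ℤ → q ≤ t - + 2 * m + 1ℤ → z ≤ q + + 8 * m - 1ℤ - + 4 * m * + 3 → + 14 * m - + 2 ≤ r
    three-arms-arith-2 m r s t q z h₁ h₂ h₃ h₄ h₅ = by (h₁ ⊞ h₂ ⊞ h₃ ⊞ h₄ ⊞ h₅) (solve (m ∷ r ∷ s ∷ t ∷ q ∷ z ∷ []))

    rest-arith-2 : ∀ d a b c p q r → d ≡ a + p → p ≡ b + q → q ≡ c + r → d ≡ + 3 → 1ℤ ≤ a → 1ℤ ≤ b → 1ℤ ≤ c → r ≤ 0ℤ
    rest-arith-2 _ a b c _ _ r refl refl refl h h₁ h₂ h₃ = by (eq h ⊞ h₁ ⊞ h₂ ⊞ h₃) (solve (a ∷ b ∷ c ∷ r ∷ []))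

    add-u-arith : ∀ m r p z t → t ≡ r + p - z → p ≡ + 6 * m + 1ℤ → + 4 * m * + 2 ≤ z → t ≤ r - + 2 * m + 1ℤ
    add-u-arith m r _ z _ refl refl h = by h (solve (m ∷ r ∷ z ∷ []))

    w-isolated-arith : ∀ d a b c e p q r t z → d ≡ a + p → p ≡ b + q → q ≡ c + r → r ≡ e + t → d ≤ + 4 → 1ℤ ≤ a → 1ℤ ≤ b → 1ℤ ≤ c → 1ℤ ≤ e → z ≤ t → z ≤ 0ℤ
    w-isolated-arith _ a b c e _ _ _ t z refl refl refl refl h h₁ h₂ h₃ h₄ h₅ = by (h ⊞ h₁ ⊞ h₂ ⊞ h₃ ⊞ h₄ ⊞ h₅) (solve (a ∷ b ∷ c ∷ e ∷ t ∷ z ∷ []))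

    valid₃-arith : ∀ m p e e′ b → e′ ≡ e + b → + 4 * m * b - 1ℤ ≤ p - + 4 * m * e → ℤ.-1ℤ ≤ p - + 4 * m * e′
    valid₃-arith m p e _ b refl h = by h (solve (m ∷ p ∷ e ∷ b ∷ []))

    valid₃-arith-2 : ∀ e a b c → e + a + b + c ≡ e + (a + b + c)
    valid₃-arith-2 = solve-∀

    valid₃-arith-3 : ∀ m r → ℤ.-1ℤ ≤ r → + 4 * m * 0ℤ - 1ℤ ≤ r
    valid₃-arith-3 m r h = by h (solve (m ∷ r ∷ []))

    valid₃-arith-4 : ∀ m r → 1ℤ ≤ m → + 6 * m - 1ℤ ≤ r → + 4 * m * 1ℤ - 1ℤ ≤ r
    valid₃-arith-4 m r h h′ = by (h ⊞ h ⊞ h′ ⊞ 0≤ 2) (solve (m ∷ r ∷ []))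

    valid₃-arith-5 : ∀ m r → + 8 * m - 1ℤ ≤ r → + 4 * m * + 2 - 1ℤ ≤ r
    valid₃-arith-5 m r h = by h (solve (m ∷ r ∷ []))

    valid₃-arith-6 : ∀ m r → 1ℤ ≤ m → + 14 * m - + 2 ≤ r → + 4 * m * + 3 - 1ℤ ≤ r
    valid₃-arith-6 m r h h′ = by (h ⊞ h ⊞ h′ ⊞ 0≤ 1) (solve (m ∷ r ∷ []))

    arm-arith : ∀ d a b → d ≡ a + b → d ≡ + 3 → a ≤ 1ℤ → + 2 ≤ b
    arm-arith _ a b refl h h′ = by (eq′ h ⊞ h′) (solve (a ∷ b ∷ []))

    arm-arith-2 : ∀ d a b → d ≡ a + b → + 2 ≤ d → a ≤ 1ℤ → 1ℤ ≤ b
    arm-arith-2 _ a b refl h h′ = by (h ⊞ h′) (solve (a ∷ b ∷ []))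

    add-w-arith : ∀ m r p y z t → t ≡ r + p - z → p ≤ + 8 * m - 1ℤ → y ≤ z → t ≤ r + + 8 * m - 1ℤ - y
    add-w-arith m r p y z _ refl h h′ = by (h ⊞ h′) (solve (m ∷ r ∷ p ∷ y ∷ z ∷ []))

  module Star (m : ℕ) (1≤m : 1 ℕ.≤ m) {N : ℕ} (G : Graph N) (ω : Fin N → ℕ) (V : Sub N) where
    open Even m 1≤m {N}

    record CubicVertex (u : Fin N) : Set where
      field
        ∈V : u ∈ V
        deg : cr G u V ≡ + 3
        weight : ω u ≡ m
        simple : ∀ v → v ∈ V → a G u v ≤ 1ℤ

    module Hub (pos : Pos ω) (valid : Valid G ω V) (ih : IH V) (gap : Gap G ω V)
      (w : Fin N) (w∈ : w ∈ V) (dw : cr G w V ≤ + 4) (ωw : ω w ≡ 1) where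
      open Reduce G ω V pos valid ih gap

      record Arm : Set where
        field
          u : Fin N
          cubic : CubicVertex u
          wu : 1ℤ ≤ a G w u
          x : Fin N
          x∈w : x ∈ (V -′ w)
          ux : 1ℤ ≤ a G u x
          y : Fin N
          y∈wx : y ∈ (V -′ w -′ x)
          uy : 1ℤ ≤ a G u y
        open CubicVertex cubic public

        uw : 1ℤ ≤ a G u w
        uw = subst (1ℤ ≤_) (a-sym G w u) wu

        u≢w : u ≢ w
        u≢w h = 1≰0 (subst (1ℤ ≤_) (trans (cong (a G u) (sym h)) (a-irr G u)) uw)

        x∈ : x ∈ V
        x∈ = -′-⊆ {A = V} w x x∈w

        y∈ : y ∈ V
        y∈ = -′-⊆ {A = V} w y (-′-⊆ {A = V -′ w} x y y∈wx)

        x≢y : x ≢ y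
        x≢y h = -′-≢ (V -′ w) y∈wx (sym h)

        rest : cr G u (V -′ w -′ x -′ y) ≤ 0ℤ
        rest = rest-arith-2 (cr G u V) (a G u w) (a G u x) (a G u y) (cr G u (V -′ w)) (cr G u (V -′ w -′ x)) (cr G u (V -′ w -′ x -′ y))
            (∑-pt _ w∈) (∑-pt _ x∈w) (∑-pt _ y∈wx) deg uw ux uy

        bound : ∀ A → A ⊆ V → A w ≡ false → cr G u A ≤ ⟦ A x ⟧ + ⟦ A y ⟧
        bound A A⊆ w∉ = bound-arith-2 (cr G u A) ⟦ A x ⟧ ⟦ A y ⟧ (cr G u (A -′ x)) (cr G u (A -′ x -′ y)) (cr-drop A (simple x x∈))
            (subst (λ b → cr G u (A -′ x) ≤ ⟦ b ⟧ + cr G u (A -′ x -′ y)) Ay (cr-drop (A -′ x) (simple y y∈)))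
            (ℤP.≤-trans (cr-⊆ G u λ v q → -′-intro {A = V -′ w -′ x} (-′-intro {A = V -′ w} (-′-intro {A = V} (A⊆ v (in-A v q)) λ { refl → true≢false (in-A v q) w∉ }) (-′-≢ A (-′-⊆ {A = A -′ x} y v q))) (-′-≢ (A -′ x) q)) rest)
          where
          in-A : ∀ v → v ∈ (A -′ x -′ y) → v ∈ A
          in-A v q = -′-⊆ {A = A} x v (-′-⊆ {A = A -′ x} y v q)
          Ay : (A -′ x) y ≡ A y
          Ay with true⊎false (A y)
          ... | inj₁ p = trans (-′-intro {A = A} p (x≢y ∘ sym)) (sym p)
          ... | inj₂ p = trans (≢true λ q → true≢false (-′-⊆ {A = A} x y q) p) (sym p)

        both : ∀ {A} → x ∈ A → y ∈ A → + 2 ≤ cr G u A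
        both {A} p q = both-arith (cr G u A) (a G u x) (a G u y) (cr G u (A -′ x)) (cr G u (A -′ x -′ y)) (∑-pt _ p) (∑-pt _ (-′-intro {A = A} q (x≢y ∘ sym))) ux uy (cr-nn G u (A -′ x -′ y))

        -- `u` brings `6m + 1` and at least two edges, each worth `4m`.
        add-u : ∀ {B} → B u ≡ false → x ∈ B → y ∈ B → ρ G ω (B ∪ ⁅ u ⁆) ≤ ρ G ω B - + 2 * μ + 1ℤ
        add-u {B} u∉ p q = add-u-arith μ (ρ G ω B) (pot (ω u)) (K * cr G u B) (ρ G ω (B ∪ ⁅ u ⁆)) (ρ-ins u∉) (trans (cong pot weight) pot-m) (K*-mono (both p q))

      arm : ∀ {u} → CubicVertex u → 1ℤ ≤ a G w u → Arm
      arm {u} cubic wu = record { cubic = cubic ; wu = wu ; x∈w = proj₁ (proj₂ nb₁) ; ux = proj₂ (proj₂ nb₁) ; y∈wx = proj₁ (proj₂ nb₂) ; uy = proj₂ (proj₂ nb₂) }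
        where
        open CubicVertex cubic
        two : + 2 ≤ cr G u (V -′ w)
        two = arm-arith (cr G u V) (a G u w) (cr G u (V -′ w)) (∑-pt _ w∈) deg (simple w w∈)
        nb₁ : ∃ λ x → x ∈ (V -′ w) × 1ℤ ≤ a G u x
        nb₁ = ∑-pos (V -′ w) (ℤP.≤-trans (+≤+ (s≤s z≤n)) two)
        x = proj₁ nb₁
        nb₂ : ∃ λ y → y ∈ (V -′ w -′ x) × 1ℤ ≤ a G u y
        nb₂ = ∑-pos (V -′ w -′ x) (arm-arith-2 (cr G u (V -′ w)) (a G u x) (cr G u (V -′ w -′ x)) (∑-pt _ (proj₁ (proj₂ nb₁))) two (simple x (-′-⊆ {A = V} w x (proj₁ (proj₂ nb₁)))))

      add-w : ∀ {B} k → B w ≡ false → k ≤ cr G w B → ρ G ω (B ∪ ⁅ w ⁆) ≤ ρ G ω B + + 8 * μ - 1ℤ - + 4 * μ * k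
      add-w {B} k w∉ h = add-w-arith μ (ρ G ω B) (pot (ω w)) (+ 4 * μ * k) (K * cr G w B) (ρ G ω (B ∪ ⁅ w ⁆)) (ρ-ins w∉) (pot-le w) (K*-mono h)

      -- Delete w and u₁, …, u₄, and join the two other neighbours of uᵢ for i ≤ 3. Then w goes to M, while u₁, u₂, u₃ go to F and subdivide the new edges.
      module Four (A₁ A₂ A₃ A₄ : Arm)
        (n₁₂ : a G (Arm.u A₁) (Arm.u A₂) ≤ 0ℤ) (n₁₃ : a G (Arm.u A₁) (Arm.u A₃) ≤ 0ℤ) (n₁₄ : a G (Arm.u A₁) (Arm.u A₄) ≤ 0ℤ)
        (n₂₃ : a G (Arm.u A₂) (Arm.u A₃) ≤ 0ℤ) (n₂₄ : a G (Arm.u A₂) (Arm.u A₄) ≤ 0ℤ) (n₃₄ : a G (Arm.u A₃) (Arm.u A₄) ≤ 0ℤ)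
        (d₁₂ : Arm.u A₁ ≢ Arm.u A₂) (d₁₃ : Arm.u A₁ ≢ Arm.u A₃) (d₁₄ : Arm.u A₁ ≢ Arm.u A₄)
        (d₂₃ : Arm.u A₂ ≢ Arm.u A₃) (d₂₄ : Arm.u A₂ ≢ Arm.u A₄) (d₃₄ : Arm.u A₃ ≢ Arm.u A₄) where

        open Arm

        u₁ u₂ u₃ u₄ : Fin N
        u₁ = u A₁
        u₂ = u A₂
        u₃ = u A₃
        u₄ = u A₄

        D₀ D₁ D₂ D₃ Del : Sub N
        D₀ = ⁅ w ⁆
        D₁ = D₀ ∪ ⁅ u₁ ⁆
        D₂ = D₁ ∪ ⁅ u₂ ⁆
        D₃ = D₂ ∪ ⁅ u₃ ⁆
        Del = D₃ ∪ ⁅ u₄ ⁆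

        Del-cases : ∀ {v} → v ∈ Del → v ≡ w ⊎ v ≡ u₁ ⊎ v ≡ u₂ ⊎ v ≡ u₃ ⊎ v ≡ u₄
        Del-cases {v} q with ∪⁻ D₃ ⁅ u₄ ⁆ q
        ... | inj₂ r = inj₂ (inj₂ (inj₂ (inj₂ (==⇒≡ r))))
        ... | inj₁ q₃ with ∪⁻ D₂ ⁅ u₃ ⁆ q₃
        ...   | inj₂ r = inj₂ (inj₂ (inj₂ (inj₁ (==⇒≡ r))))
        ...   | inj₁ q₂ with ∪⁻ D₁ ⁅ u₂ ⁆ q₂
        ...     | inj₂ r = inj₂ (inj₂ (inj₁ (==⇒≡ r)))
        ...     | inj₁ q₁ with ∪⁻ D₀ ⁅ u₁ ⁆ q₁
        ...       | inj₂ r = inj₂ (inj₁ (==⇒≡ r))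
        ...       | inj₁ r = inj₁ (==⇒≡ r)

        w∈Del : w ∈ Del
        w∈Del = ∈-keep D₃ u₄ (∈-keep D₂ u₃ (∈-keep D₁ u₂ (∈-keep D₀ u₁ (==-refl w))))
        u₁∈Del : u₁ ∈ Del
        u₁∈Del = ∈-keep D₃ u₄ (∈-keep D₂ u₃ (∈-keep D₁ u₂ (∈-new D₀ u₁)))
        u₂∈Del : u₂ ∈ Del
        u₂∈Del = ∈-keep D₃ u₄ (∈-keep D₂ u₃ (∈-new D₁ u₂))
        u₃∈Del : u₃ ∈ Del
        u₃∈Del = ∈-keep D₃ u₄ (∈-new D₂ u₃)
        u₄∈Del : u₄ ∈ Del
        u₄∈Del = ∈-new D₃ u₄

        U : Sub N
        U = V ∖ Del

        U⊆V : U ⊆ V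
        U⊆V v q = proj₁ (∖⁻ V Del q)

        ∉U : ∀ {A v} → A ⊆ U → v ∈ Del → A v ≡ false
        ∉U A⊆ d = ≢true λ q → true≢false d (proj₂ (∖⁻ V Del (A⊆ _ q)))

        smaller : card U + 1ℤ ≤ card V
        smaller = ℤP.≤-trans (ℤP.+-monoˡ-≤ 1ℤ (∑-⊆ (λ v q → -′-intro {A = V} (U⊆V v q) λ { refl → true≢false w∈Del (proj₂ (∖⁻ V Del q)) }) λ _ _ → 0≤ 1)) (del-smaller w∈)

        w-isolated : cr G w U ≤ 0ℤ
        w-isolated = w-isolated-arith (cr G w V) (a G w u₁) (a G w u₂) (a G w u₃) (a G w u₄) (cr G w (V -′ u₁)) (cr G w (V -′ u₁ -′ u₂)) (cr G w (V -′ u₁ -′ u₂ -′ u₃)) (cr G w (V -′ u₁ -′ u₂ -′ u₃ -′ u₄)) (cr G w U)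
            (∑-pt _ (∈V A₁)) (∑-pt _ i₂) (∑-pt _ i₃) (∑-pt _ i₄) dw (wu A₁) (wu A₂) (wu A₃) (wu A₄) (cr-⊆ G w sub)
          where
          i₂ : u₂ ∈ (V -′ u₁)
          i₂ = -′-intro {A = V} (∈V A₂) (d₁₂ ∘ sym)
          i₃ : u₃ ∈ (V -′ u₁ -′ u₂)
          i₃ = -′-intro {A = V -′ u₁} (-′-intro {A = V} (∈V A₃) (d₁₃ ∘ sym)) (d₂₃ ∘ sym)
          i₄ : u₄ ∈ (V -′ u₁ -′ u₂ -′ u₃)
          i₄ = -′-intro {A = V -′ u₁ -′ u₂} (-′-intro {A = V -′ u₁} (-′-intro {A = V} (∈V A₄) (d₁₄ ∘ sym)) (d₂₄ ∘ sym)) (d₃₄ ∘ sym)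
          out : ∀ {v z} → v ∈ U → z ∈ Del → v ≢ z
          out q d refl = true≢false d (proj₂ (∖⁻ V Del q))
          sub : U ⊆ V -′ u₁ -′ u₂ -′ u₃ -′ u₄
          sub v q = -′-intro {A = V -′ u₁ -′ u₂ -′ u₃} (-′-intro {A = V -′ u₁ -′ u₂} (-′-intro {A = V -′ u₁} (-′-intro {A = V} (U⊆V v q) (out q u₁∈Del)) (out q u₂∈Del)) (out q u₃∈Del)) (out q u₄∈Del)

        G₁ G₂ G₃ : Graph N
        G₁ = addEdge G (x A₁) (y A₁) (x≢y A₁)
        G₂ = addEdge G₁ (x A₂) (y A₂) (x≢y A₂)
        G₃ = addEdge G₂ (x A₃) (y A₃) (x≢y A₃)

        module _ (A : Sub N) (A⊆ : A ⊆ U) where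

          private
            A⊆V : A ⊆ V
            A⊆V v q = U⊆V v (A⊆ v q)

            enough : ∀ B {p q} → p ∈ B → q ∈ B → p ≢ q → + 2 ≤ card B
            enough B p q n = two-of {A = B} p (-′-intro {A = B} q (n ∘ sym))

          -- The gap is applied to `A` with `u X`, which is proper because it misses `u₄`. Leaving
          -- the fourth arm without a new edge guarantees such a missed vertex in all three
          -- estimates.
          one : ∀ (X : Arm) → u X ∈ Del → u X ≢ u₄ → x X ∈ A → y X ∈ A → + 6 * μ - 1ℤ ≤ ρ G ω A
          one X d n p q = one-arith μ (ρ G ω A) (ρ G ω B) (gap B (⊆-add A (u X) A⊆V (∈V X)) (enough B (∈-keep A (u X) p) (∈-keep A (u X) q) (x≢y X)) u₄ (∈V A₄) (∉-add A (u X) (∉U A⊆ u₄∈Del) (n ∘ sym)))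
              (add-u X {A} (∉U A⊆ d) p q)
            where
            B = A ∪ ⁅ u X ⁆

          -- Adding the two arms alone yields `4m + 2(2m - 1) = 8m - 2`, one less than two new edges
          -- require. Adding the hub as well, with at most `8m - 1` and at least two edges, gains
          -- the missing unit.
          two-arms : ∀ (X Y : Arm) → u X ∈ Del → u Y ∈ Del → u X ≢ u₄ → u Y ≢ u₄ → u X ≢ u Y → x X ∈ A → y X ∈ A → x Y ∈ A → y Y ∈ A → + 8 * μ - 1ℤ ≤ ρ G ω A
          two-arms X Y d d′ n n′ n″ p q p′ q′ = two-arms-arith-2 μ (ρ G ω A) (ρ G ω B₁) (ρ G ω B₂) (ρ G ω B₃)
              (gap B₃ (⊆-add B₂ w (⊆-add B₁ (u Y) (⊆-add A (u X) A⊆V (∈V X)) (∈V Y)) w∈) (enough B₃ (up p) (up q) (x≢y X)) u₄ (∈V A₄)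
                (∉-add B₂ w (∉-add B₁ (u Y) (∉-add A (u X) (∉U A⊆ u₄∈Del) (n ∘ sym)) (n′ ∘ sym)) (u≢w A₄)))
              (add-u X {A} (∉U A⊆ d) p q) (add-u Y {B₁} (∉-add A (u X) (∉U A⊆ d′) (n″ ∘ sym)) (∈-keep A (u X) p′) (∈-keep A (u X) q′))
              (add-w {B₂} (+ 2) (∉-add B₁ (u Y) (∉-add A (u X) (∉U A⊆ w∈Del) (u≢w X ∘ sym)) (u≢w Y ∘ sym)) (two-arms-arith (cr G w B₂) (a G w (u X)) (cr G w (B₂ -′ u X)) (a G w (u Y)) (cr G w (B₂ -′ u X -′ u Y))
                (∑-pt _ X∈) (∑-pt _ Y∈) (wu X) (wu Y) (cr-nn G w (B₂ -′ u X -′ u Y))))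
            where
            B₁ = A ∪ ⁅ u X ⁆
            B₂ = B₁ ∪ ⁅ u Y ⁆
            B₃ = B₂ ∪ ⁅ w ⁆
            up : ∀ {v} → v ∈ A → v ∈ B₃
            up r = ∈-keep B₂ w (∈-keep B₁ (u Y) (∈-keep A (u X) r))
            X∈ : u X ∈ B₂
            X∈ = ∈-keep B₁ (u Y) (∈-new A (u X))
            Y∈ : u Y ∈ (B₂ -′ u X)
            Y∈ = -′-intro {A = B₂} (∈-new B₁ (u Y)) (n″ ∘ sym)

          -- Again with the hub: `4m + 3(2m - 1) - (8m - 1) + 12m = 14m -
          -- 2`, which is at least the `12m - 1` needed for three edges.
          three-arms : x A₁ ∈ A → y A₁ ∈ A → x A₂ ∈ A → y A₂ ∈ A → x A₃ ∈ A → y A₃ ∈ A → + 14 * μ - + 2 ≤ ρ G ω A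
          three-arms p₁ q₁ p₂ q₂ p₃ q₃ = three-arms-arith-2 μ (ρ G ω A) (ρ G ω B₁) (ρ G ω B₂) (ρ G ω B₃) (ρ G ω B₄)
              (gap B₄ (⊆-add B₃ w (⊆-add B₂ u₃ (⊆-add B₁ u₂ (⊆-add A u₁ A⊆V (∈V A₁)) (∈V A₂)) (∈V A₃)) w∈) (enough B₄ (up p₁) (up q₁) (x≢y A₁)) u₄ (∈V A₄)
                (∉-add B₃ w (∉-add B₂ u₃ (∉-add B₁ u₂ (∉-add A u₁ (∉U A⊆ u₄∈Del) (d₁₄ ∘ sym)) (d₂₄ ∘ sym)) (d₃₄ ∘ sym)) (u≢w A₄)))
              (add-u A₁ {A} (∉U A⊆ u₁∈Del) p₁ q₁) (add-u A₂ {B₁} (∉-add A u₁ (∉U A⊆ u₂∈Del) (d₁₂ ∘ sym)) (∈-keep A u₁ p₂) (∈-keep A u₁ q₂))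
              (add-u A₃ {B₂} (∉-add B₁ u₂ (∉-add A u₁ (∉U A⊆ u₃∈Del) (d₁₃ ∘ sym)) (d₂₃ ∘ sym)) (∈-keep B₁ u₂ (∈-keep A u₁ p₃)) (∈-keep B₁ u₂ (∈-keep A u₁ q₃)))
              (add-w {B₃} (+ 3) (∉-add B₂ u₃ (∉-add B₁ u₂ (∉-add A u₁ (∉U A⊆ w∈Del) (u≢w A₁ ∘ sym)) (u≢w A₂ ∘ sym)) (u≢w A₃ ∘ sym))
                (three-arms-arith (cr G w B₃) (a G w u₁) (cr G w (B₃ -′ u₁)) (a G w u₂) (cr G w (B₃ -′ u₁ -′ u₂)) (a G w u₃) (cr G w (B₃ -′ u₁ -′ u₂ -′ u₃))
                  (∑-pt _ i₁) (∑-pt _ i₂) (∑-pt _ i₃) (wu A₁) (wu A₂) (wu A₃) (cr-nn G w (B₃ -′ u₁ -′ u₂ -′ u₃))))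
            where
            B₁ = A ∪ ⁅ u₁ ⁆
            B₂ = B₁ ∪ ⁅ u₂ ⁆
            B₃ = B₂ ∪ ⁅ u₃ ⁆
            B₄ = B₃ ∪ ⁅ w ⁆
            up : ∀ {v} → v ∈ A → v ∈ B₄
            up r = ∈-keep B₃ w (∈-keep B₂ u₃ (∈-keep B₁ u₂ (∈-keep A u₁ r)))
            i₁ : u₁ ∈ B₃
            i₁ = ∈-keep B₂ u₃ (∈-keep B₁ u₂ (∈-new A u₁))
            i₂ : u₂ ∈ (B₃ -′ u₁)
            i₂ = -′-intro {A = B₃} (∈-keep B₂ u₃ (∈-new B₁ u₂)) (d₁₂ ∘ sym)
            i₃ : u₃ ∈ (B₃ -′ u₁ -′ u₂)
            i₃ = -′-intro {A = B₃ -′ u₁} (-′-intro {A = B₃} (∈-new B₂ u₃) (d₁₃ ∘ sym)) (d₂₃ ∘ sym)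

        Bit : Arm → Sub N → Bool
        Bit X A = A (x X) ∧ A (y X)

        Bit-x : ∀ X A → Bit X A ≡ true → x X ∈ A
        Bit-x X A h = proj₁ (∧-true h)

        Bit-y : ∀ X A → Bit X A ≡ true → y X ∈ A
        Bit-y X A h = proj₂ (∧-true {A (x X)} h)

        e₃ : ∀ A → e G₃ A ≡ e G A + ⟦ Bit A₁ A ⟧ + ⟦ Bit A₂ A ⟧ + ⟦ Bit A₃ A ⟧
        e₃ A = trans (e-addEdge G₂ (x A₃) (y A₃) (x≢y A₃) A) (cong (_+ ⟦ Bit A₃ A ⟧) (trans (e-addEdge G₁ (x A₂) (y A₂) (x≢y A₂) A) (cong (_+ ⟦ Bit A₂ A ⟧) (e-addEdge G (x A₁) (y A₁) (x≢y A₁) A))))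

        valid₃ : Valid G₃ ω U
        valid₃ A A⊆ = valid₃-arith μ (∑ A (λ v → pot (ω v))) (e G A) (e G₃ A) (⟦ Bit A₁ A ⟧ + ⟦ Bit A₂ A ⟧ + ⟦ Bit A₃ A ⟧) (trans (e₃ A) (valid₃-arith-2 (e G A) ⟦ Bit A₁ A ⟧ ⟦ Bit A₂ A ⟧ ⟦ Bit A₃ A ⟧))
            (go (Bit A₁ A) refl (Bit A₂ A) refl (Bit A₃ A) refl)
          where
          go : ∀ b₁ → Bit A₁ A ≡ b₁ → ∀ b₂ → Bit A₂ A ≡ b₂ → ∀ b₃ → Bit A₃ A ≡ b₃ → + 4 * μ * (⟦ Bit A₁ A ⟧ + ⟦ Bit A₂ A ⟧ + ⟦ Bit A₃ A ⟧) - 1ℤ ≤ ρ G ω A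
          go b₁ p₁ b₂ p₂ b₃ p₃ = subst (λ z → + 4 * μ * z - 1ℤ ≤ ρ G ω A) (sym (cong₂ _+_ (cong₂ _+_ (cong ⟦_⟧ p₁) (cong ⟦_⟧ p₂)) (cong ⟦_⟧ p₃))) (cs b₁ p₁ b₂ p₂ b₃ p₃)
            where
            X₁ = Bit-x A₁ A
            X₂ = Bit-x A₂ A
            X₃ = Bit-x A₃ A
            Y₁ = Bit-y A₁ A
            Y₂ = Bit-y A₂ A
            Y₃ = Bit-y A₃ A
            cs : ∀ b₁ → Bit A₁ A ≡ b₁ → ∀ b₂ → Bit A₂ A ≡ b₂ → ∀ b₃ → Bit A₃ A ≡ b₃ → + 4 * μ * (⟦ b₁ ⟧ + ⟦ b₂ ⟧ + ⟦ b₃ ⟧) - 1ℤ ≤ ρ G ω A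
            cs false _ false _ false _ = valid₃-arith-3 μ (ρ G ω A) (valid A λ v q → U⊆V v (A⊆ v q))
            cs true p false _ false _ = valid₃-arith-4 μ (ρ G ω A) 1≤μ (one A A⊆ A₁ u₁∈Del d₁₄ (X₁ p) (Y₁ p))
            cs false _ true p false _ = valid₃-arith-4 μ (ρ G ω A) 1≤μ (one A A⊆ A₂ u₂∈Del d₂₄ (X₂ p) (Y₂ p))
            cs false _ false _ true p = valid₃-arith-4 μ (ρ G ω A) 1≤μ (one A A⊆ A₃ u₃∈Del d₃₄ (X₃ p) (Y₃ p))
            cs true p true q false _ = valid₃-arith-5 μ (ρ G ω A) (two-arms A A⊆ A₁ A₂ u₁∈Del u₂∈Del d₁₄ d₂₄ d₁₂ (X₁ p) (Y₁ p) (X₂ q) (Y₂ q))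
            cs true p false _ true q = valid₃-arith-5 μ (ρ G ω A) (two-arms A A⊆ A₁ A₃ u₁∈Del u₃∈Del d₁₄ d₃₄ d₁₃ (X₁ p) (Y₁ p) (X₃ q) (Y₃ q))
            cs false _ true p true q = valid₃-arith-5 μ (ρ G ω A) (two-arms A A⊆ A₂ A₃ u₂∈Del u₃∈Del d₂₄ d₃₄ d₂₃ (X₂ p) (Y₂ p) (X₃ q) (Y₃ q))
            cs true p true q true r = valid₃-arith-6 μ (ρ G ω A) 1≤μ (three-arms A A⊆ (X₁ p) (Y₁ p) (X₂ q) (Y₂ q) (X₃ r) (Y₃ r))

        -- The ends of the new edge of an arm are neighbours of its cubic vertex. As the cubic
        -- vertices are pairwise nonadjacent, no new edge ends at one of them.
        apart : ∀ (X : Arm) {z} → a G (u X) z ≤ 0ℤ → z ≢ x X × z ≢ y X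
        apart X h = (λ { refl → 1≰0 (ℤP.≤-trans (ux X) h) }) , (λ { refl → 1≰0 (ℤP.≤-trans (uy X) h) })

        module _ (c : Sub N) (L₃ : Light G₃ s ω (U ∩ c)) (F₃ : Forest G₃ (U ∖ c)) where

          private
            M = U ∩ c
            S₀ = U ∖ c
            S₃ = S₀ ∪ ⁅ u₃ ⁆
            S₂ = S₃ ∪ ⁅ u₂ ⁆
            S₁ = S₂ ∪ ⁅ u₁ ⁆

            L : Light G s ω M
            L = Light-remove G (x≢y A₁) (Light-remove G₁ (x≢y A₂) (Light-remove G₂ (x≢y A₃) L₃))

            adds : ∀ {S z} → Adds G S z (S ∪ ⁅ z ⁆)
            adds {S} {z} v q n with ∪⁻ S ⁅ z ⁆ q
            ... | inj₁ r = r
            ... | inj₂ r = ⊥-elim (n (==⇒≡ r))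

            S₀⊆V : S₀ ⊆ V
            S₀⊆V v q = U⊆V v (proj₁ (∖⁻ U c q))
            S₃⊆V = ⊆-add S₀ u₃ S₀⊆V (∈V A₃)
            S₂⊆V = ⊆-add S₃ u₂ S₃⊆V (∈V A₂)
            S₁⊆V = ⊆-add S₂ u₁ S₂⊆V (∈V A₁)

            w∉S₀ : S₀ w ≡ false
            w∉S₀ = ≢true λ q → true≢false w∈Del (proj₂ (∖⁻ V Del (proj₁ (∖⁻ U c q))))
            w∉S₃ = ∉-add S₀ u₃ w∉S₀ (u≢w A₃ ∘ sym)
            w∉S₂ = ∉-add S₃ u₂ w∉S₃ (u≢w A₂ ∘ sym)

            w∉ : ∀ {S A : Sub N} → A ⊆ S → S w ≡ false → A w ≡ false
            w∉ h n = ≢true λ q → true≢false (h w q) n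

            -- The new edges are undone in reverse order; the degree of each reinserted vertex must
            -- be read in a graph still containing the earlier new edges, which do not touch it.
            F₂ : Forest G₂ S₃
            F₂ = subdivide G₂ (x≢y A₃) {u = u₃} (adds {S₀}) F₃ λ A A⊆ → subst (_≤ ⟦ A (x A₃) ⟧ + ⟦ A (y A₃) ⟧)
              (sym (trans (cr-other G₁ (x≢y A₂) (proj₁ (apart A₂ n₂₃)) (proj₂ (apart A₂ n₂₃)) A) (cr-other G (x≢y A₁) (proj₁ (apart A₁ n₁₃)) (proj₂ (apart A₁ n₁₃)) A)))
              (bound A₃ A (λ v q → S₀⊆V v (A⊆ v q)) (w∉ A⊆ w∉S₀))

            F₁ : Forest G₁ S₂
            F₁ = subdivide G₁ (x≢y A₂) {u = u₂} (adds {S₃}) F₂ λ A A⊆ → subst (_≤ ⟦ A (x A₂) ⟧ + ⟦ A (y A₂) ⟧)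
              (sym (cr-other G (x≢y A₁) (proj₁ (apart A₁ n₁₂)) (proj₂ (apart A₁ n₁₂)) A))
              (bound A₂ A (λ v q → S₃⊆V v (A⊆ v q)) (w∉ A⊆ w∉S₃))

            F₀ : Forest G S₁
            F₀ = subdivide G (x≢y A₁) {u = u₁} (adds {S₂}) F₁ λ A A⊆ → bound A₁ A (λ v q → S₂⊆V v (A⊆ v q)) (w∉ A⊆ w∉S₂)

            ωw≤s : ω w ℕ.≤ s
            ωw≤s = subst (ℕ._≤ s) (sym ωw) (ℕP.≤-trans 1≤m m≤s)

            M-w : cr G w M ≤ 0ℤ
            M-w = ℤP.≤-trans (cr-⊆ G w λ v q → proj₁ (∩⁻ U c q)) w-isolated

            c₁ = (c ∖ Del) ∪ ⁅ w ⁆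

            M-c₁ : ∀ v → v ∈ V ∩ c₁ → v ≢ w → v ∈ M
            M-c₁ v q n with ∩⁻ V c₁ q
            ... | v∈ , r with ∪⁻ (c ∖ Del) ⁅ w ⁆ r
            ...   | inj₁ r′ = ∩⁺ U c (∖⁺ V Del v∈ (proj₂ (∖⁻ c Del r′))) (proj₁ (∖⁻ c Del r′))
            ...   | inj₂ r′ = ⊥-elim (n (==⇒≡ r′))

            F-c₁ : ∀ v → v ∈ V ∖ c₁ → v ≢ u₄ → v ∈ S₁
            F-c₁ v q n with ∖⁻ V c₁ q
            ... | v∈ , r with true⊎false (Del v)
            ...   | inj₂ d = ∈-keep S₂ u₁ (∈-keep S₃ u₂ (∈-keep S₀ u₃ (∖⁺ U c (∖⁺ V Del v∈ d) (≢true λ h → true≢false (∪ˡ (c ∖ Del) ⁅ w ⁆ (∖⁺ c Del h d)) r))))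
            ...   | inj₁ d with Del-cases d
            ...     | inj₁ refl = ⊥-elim (true≢false (∪ʳ (c ∖ Del) ⁅ w ⁆ (==-refl w)) r)
            ...     | inj₂ (inj₁ refl) = ∈-new S₂ u₁
            ...     | inj₂ (inj₂ (inj₁ refl)) = ∈-keep S₂ u₁ (∈-new S₃ u₂)
            ...     | inj₂ (inj₂ (inj₂ (inj₁ refl))) = ∈-keep S₂ u₁ (∈-keep S₃ u₂ (∈-new S₀ u₃))
            ...     | inj₂ (inj₂ (inj₂ (inj₂ refl))) = ⊥-elim (n refl)

            c₂ = c₁ ∪ ⁅ u₄ ⁆

            light₁ : Light G s ω (V ∩ c₁)
            light₁ = insert-isolated G {S = M} {S′ = V ∩ c₁} {u = w} M-c₁ L ωw≤s M-w

            shrink : ∀ v → v ∈ V ∩ c₂ → v ≢ u₄ → v ∈ V ∩ c₁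
            shrink v q n with ∩⁻ V c₂ q
            ... | v∈ , r with ∪⁻ c₁ ⁅ u₄ ⁆ r
            ...   | inj₁ r′ = ∩⁺ V c₁ v∈ r′
            ...   | inj₂ r′ = ⊥-elim (n (==⇒≡ r′))

            light₂ : cr G u₄ M ≤ 0ℤ → Light G s ω (V ∩ c₂)
            light₂ h = insert-pair G {S = M} {S′ = V ∩ c₂} {u = u₄} {w} (λ v q n n′ → M-c₁ v (shrink v q n) n′) L h M-w (simple A₄ w w∈)
              (subst₂ (λ p q → p ℕ.+ q ℕ.≤ s) (sym (weight A₄)) (sym ωw) (subst (m ℕ.+ 1 ℕ.≤_) m+m≡s (ℕP.+-monoʳ-≤ m 1≤m)))

            forest₂ : Forest G (V ∖ c₂)
            forest₂ = Forest-⊆ G {S = S₁} {S′ = V ∖ c₂} sub F₀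
              where
              sub : V ∖ c₂ ⊆ S₁
              sub v q with ∖⁻ V c₂ q
              ... | v∈ , r = F-c₁ v (∖⁺ V c₁ v∈ (≢true λ h → true≢false (∈-keep c₁ u₄ h) r)) λ h → true≢false (∈-new c₁ u₄) (subst (λ z → c₂ z ≡ false) h r)

            U-no : ∀ {v} → v ∈ U → v ∈ Del → ⊥
            U-no q d = true≢false d (proj₂ (∖⁻ V Del q))

            disjoint : ∀ v → v ∈ S₁ → v ∈ M → ⊥
            disjoint v q r with ∩⁻ U c r | ∪⁻ S₂ ⁅ u₁ ⁆ q
            ... | v∈ , _ | inj₂ t = U-no v∈ (subst (_∈ Del) (sym (==⇒≡ t)) u₁∈Del)
            ... | v∈ , c∈ | inj₁ q₂ with ∪⁻ S₃ ⁅ u₂ ⁆ q₂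
            ...   | inj₂ t = U-no v∈ (subst (_∈ Del) (sym (==⇒≡ t)) u₂∈Del)
            ...   | inj₁ q₃ with ∪⁻ S₀ ⁅ u₃ ⁆ q₃
            ...     | inj₂ t = U-no v∈ (subst (_∈ Del) (sym (==⇒≡ t)) u₃∈Del)
            ...     | inj₁ t = true≢false c∈ (proj₂ (∖⁻ U c t))

            in-V : ∀ v → v ∈ S₁ ⊎ v ∈ M → v ∈ (V -′ w)
            in-V v (inj₁ q) = -′-intro {A = V} (S₁⊆V v q) λ h → true≢false (subst (_∈ S₁) h q) (∉-add S₂ u₁ w∉S₂ (u≢w A₁ ∘ sym))
            in-V v (inj₂ q) = -′-intro {A = V} (U⊆V v (proj₁ (∩⁻ U c q))) λ h → U-no (proj₁ (∩⁻ U c q)) (subst (_∈ Del) (sym h) w∈Del)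

            -- One edge of `u₄` goes to the hub and two go to `S₁`, so none is left. Hence `u₄` and
            -- `w` form a component of M of weight `m + 1 ≤ s`.
            M-u₄ : + 2 ≤ cr G u₄ S₁ → cr G u₄ M ≤ 0ℤ
            M-u₄ blocked = M-u₄-arith (cr G u₄ V) (a G u₄ w) (cr G u₄ (V -′ w)) (cr G u₄ S₁) (cr G u₄ M) (∑-pt _ w∈) (deg A₄) (uw A₄) blocked
                (ℤP.≤-trans (eq (sym (∑-∪ S₁ M _ λ v q → ≢true λ r → disjoint v q r))) (cr-⊆ G u₄ {A = S₁ ∪ M} {B = V -′ w} λ v q → in-V v (∪⁻ S₁ M q)))

          extend-star : (∀ S′ → Adds G S₁ u₄ S′ → Forest G S′) ⊎ + 2 ≤ cr G u₄ S₁ → Colorable G s ω V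
          extend-star (inj₁ ok) = c₁ , light₁ , ok (V ∖ c₁) F-c₁
          extend-star (inj₂ blocked) = c₂ , light₂ (M-u₄ blocked) , forest₂

          star : Colorable G s ω V
          star = extend-star (extend G S₁ u₄ F₀)

        result : Colorable G s ω V
        result with ih U G₃ ω smaller pos valid₃
        ... | c , L , F = star c L F

  -- The final colouring for even s

  private
    num₂-eq : ∀ s → s * + 2 ≤ + 2 * s + 1ℤ
    num₂-eq s = by (0≤ 1) (solve (s ∷ []))

    matched-arith : ∀ e c x c₀ y → c ≡ 1ℤ + c₀ → + 2 * e ≡ x + y → y ≤ c₀ → x ≤ 0ℤ → c ≤ e + 1ℤ → 0ℤ + 1ℤ ≤ e → 1ℤ ≤ 0ℤ
    matched-arith e _ x c₀ y refl h₀ h₁ h₂ h₃ h₄ = ℤP.≤-trans {j = e} h₄ (by (eq h₀ ⊞ h₁ ⊞ h₂ ⊞ h₃) (solve (e ∷ x ∷ c₀ ∷ y ∷ [])))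

    single-arith : ∀ x y → x ≡ 1ℤ + y → 1ℤ ≤ y → x ≤ 1ℤ → 1ℤ ≤ 0ℤ
    single-arith _ y refl h h′ = ℤP.≤-trans {j = y} h (by h′ (solve (y ∷ [])))

    go-arith-6 : ∀ e c → + 2 * e ≤ c → 0ℤ + 1ℤ ≤ e → e + 1ℤ ≤ c
    go-arith-6 e c h h′ = by (h ⊞ h′) (solve (e ∷ c ∷ []))

    go-arith-7 : ∀ e c → + 2 * e ≤ c → c ≤ e + 1ℤ → e ≤ 1ℤ
    go-arith-7 e c h h′ = by (h ⊞ h′) (solve (e ∷ c ∷ []))

  module _ {N : ℕ} (G : Graph N) where

    double-cr : ∀ A {f} → (∀ v → v ∈ A → cr G v A ≤ f v) → + 2 * e G A ≤ ∑ A f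
    double-cr A h = ℤP.≤-trans (eq (sym (2e G A))) (∑-mono A h)

    -- Degrees at most 1 give `2e(A) ≤ |A|`, so a tree has at most two vertices; in a tree with an
    -- edge both are matched and each weighs at most `s/2`.
    matching-light : ∀ {s ω S} → (∀ v → v ∈ S → ω v ℕ.≤ s) → (∀ v → v ∈ S → cr G v S ≤ 1ℤ) → (∀ v → v ∈ S → 1ℤ ≤ cr G v S → + 2 * + ω v ≤ + s) → Light G s ω S
    matching-light {s} {ω} {S} ω≤ one pair A A⊆ (v₀ , v₀∈) = go (≤⊎+1≤ (e G A) 0ℤ)
      where
      deg : ∀ v → v ∈ A → cr G v A ≤ 1ℤ
      deg v q = ℤP.≤-trans (cr-⊆ G v A⊆) (one v (A⊆ v q))
      2e≤ : + 2 * e G A ≤ card A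
      2e≤ = double-cr A deg
      single : card A ≤ 1ℤ → wt ω A ≤ + s
      single h with find (A -′ v₀)
      ... | inj₂ none = ℤP.≤-trans (eq (single-∑ G v₀∈ none _)) (+≤+ (ω≤ v₀ (A⊆ v₀ v₀∈)))
      ... | inj₁ (w , q) = ⊥-elim (1≰0 (single-arith (card A) (card (A -′ v₀)) (∑-pt _ v₀∈) (card-pos q) h))
      go : e G A ≤ 0ℤ ⊎ 0ℤ + 1ℤ ≤ e G A → e G A + 1ℤ ≤ card A × (card A ≤ e G A + 1ℤ → wt ω A ≤ + s)
      go (inj₁ z) = ℤP.≤-trans (ℤP.+-monoˡ-≤ 1ℤ z) (card-pos v₀∈) , λ t → single (ℤP.≤-trans t (ℤP.+-monoˡ-≤ 1ℤ z))
      go (inj₂ p) = go-arith-6 (e G A) (card A) 2e≤ p , λ t → halve-≤ (ℤP.≤-trans (heavy t) (num₂ (card A) (ℤP.≤-trans t (ℤP.+-monoˡ-≤ 1ℤ (go-arith-7 (e G A) (card A) 2e≤ t)))))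
        where
        num₂ : ∀ c → c ≤ + 2 → + s * c ≤ + 2 * + s + 1ℤ
        num₂ c h = ℤP.≤-trans (ℤP.*-monoˡ-≤-nonNeg (+ s) h) (num₂-eq (+ s))
        matched : card A ≤ e G A + 1ℤ → ∀ v → v ∈ A → 1ℤ ≤ cr G v A
        matched t v v∈ with ≤⊎+1≤ (cr G v A) 0ℤ
        ... | inj₂ l = l
        ... | inj₁ l = ⊥-elim (1≰0 (matched-arith (e G A) (card A) (cr G v A) (card (A -′ v)) (∑ (A -′ v) (λ u → cr G u A)) (∑-pt _ v∈) (trans (sym (2e G A)) (∑-pt _ v∈))
                (∑-mono (A -′ v) λ u q → deg u (-′-⊆ {A = A} v u q)) l t p))
        heavy : card A ≤ e G A + 1ℤ → + 2 * wt ω A ≤ + s * card A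
        heavy t = ℤP.≤-trans (eq (sym (∑-* A (+ 2) _))) (ℤP.≤-trans (∑-mono A λ v q → ℤP.≤-trans (pair v (A⊆ v q) (ℤP.≤-trans (matched t v q) (cr-⊆ G v A⊆))) (eq (sym (ℤP.*-identityʳ (+ s))))) (eq (∑-* A (+ s) _)))

  -- Colourings in which F is T with one or two further vertices.

  private
    yz-arith : ∀ x y c t → x + y ≤ c → + 2 ≤ x → c ≤ t + 1ℤ → t ≤ 1ℤ → y ≤ 0ℤ
    yz-arith x y c t h₁ h₂ h₃ h₄ = by (h₁ ⊞ h₂ ⊞ h₃ ⊞ h₄) (solve (x ∷ y ∷ c ∷ t ∷ []))

    rest-arith-3 : ∀ o x y z t → o ≡ x + y → t ≤ x → z ≤ y → z + t ≤ o
    rest-arith-3 _ x y z t refl h h′ = by (h ⊞ h′) (solve (x ∷ y ∷ z ∷ t ∷ []))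

    light-arith : ∀ x t o → x + t ≤ o → o ≤ t + 1ℤ → x ≤ 1ℤ
    light-arith x t o h h′ = by (h ⊞ h′) (solve (x ∷ t ∷ o ∷ []))

    light-arith-2 : ∀ x t o → x + t ≤ o → o ≡ t → x ≤ 0ℤ
    light-arith-2 x t o h h′ = by (h ⊞ eq h′) (solve (x ∷ t ∷ o ∷ []))

    add-arith-2 : ∀ e k c → e ≤ 0ℤ → k ≤ c → e + k ≤ c
    add-arith-2 e k c h h′ = by (h ⊞ h′) (solve (e ∷ k ∷ c ∷ []))

    add-arith-3 : ∀ e e₀ k l b l₀ c c₀ d f → e ≡ e₀ + k → l ≡ b + l₀ → c ≡ 1ℤ + c₀ → e₀ ≤ 0ℤ → b ≤ 0ℤ → k + l₀ ≤ c₀ + d → d ≤ f → f ≤ 1ℤ → e + l ≤ c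
    add-arith-3 _ e₀ k _ b l₀ _ c₀ d f refl refl refl h₁ h₂ h₃ h₄ h₅ = by (h₁ ⊞ h₂ ⊞ h₃ ⊞ h₄ ⊞ h₅) (solve (e₀ ∷ k ∷ b ∷ l₀ ∷ c₀ ∷ d ∷ f ∷ []))

    p≤1-arith : ∀ p q r w → p + (q + (r + w)) ≤ + 3 → 1ℤ ≤ q → 1ℤ ≤ r → 0ℤ ≤ w → p ≤ 1ℤ
    p≤1-arith p q r w h h₁ h₂ h₃ = by (h ⊞ h₁ ⊞ h₂ ⊞ h₃) (solve (p ∷ q ∷ r ∷ w ∷ []))

    q≤1-arith : ∀ p q r w → p + (q + (r + w)) ≤ + 3 → 1ℤ ≤ p → 1ℤ ≤ r → 0ℤ ≤ w → q ≤ 1ℤ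
    q≤1-arith p q r w h h₁ h₂ h₃ = by (h ⊞ h₁ ⊞ h₂ ⊞ h₃) (solve (p ∷ q ∷ r ∷ w ∷ []))

    r≤1-arith : ∀ p q r w → p + (q + (r + w)) ≤ + 3 → 1ℤ ≤ p → 1ℤ ≤ q → 0ℤ ≤ w → r ≤ 1ℤ
    r≤1-arith p q r w h h₁ h₂ h₃ = by (h ⊞ h₁ ⊞ h₂ ⊞ h₃) (solve (p ∷ q ∷ r ∷ w ∷ []))

    others-arith : ∀ p q r w v x → p + (q + (r + w)) ≤ + 3 → 1ℤ ≤ p → 1ℤ ≤ q → 1ℤ ≤ r → w ≡ v + x → 0ℤ ≤ x → v ≤ 0ℤ
    others-arith p q r _ v x h h₁ h₂ h₃ refl h₄ = by (h ⊞ h₁ ⊞ h₂ ⊞ h₃ ⊞ h₄) (solve (p ∷ q ∷ r ∷ v ∷ x ∷ []))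

    alone-arith : ∀ z w r → z + (w + r) ≤ + 3 → 1ℤ ≤ z → 0ℤ ≤ r → w ≤ + 2
    alone-arith z w r h h′ h″ = by (h ⊞ h′ ⊞ h″) (solve (z ∷ w ∷ r ∷ []))

    rest-arith-4 : ∀ c x d x′ r → c ≡ x + d → d ≡ x′ + r → 1ℤ ≤ + 3 - c → 1ℤ ≤ x → 1ℤ ≤ x′ → r ≤ 0ℤ
    rest-arith-4 _ x _ x′ r refl refl h h₁ h₂ = by (h ⊞ h₁ ⊞ h₂) (solve (x ∷ x′ ∷ r ∷ []))

    w-two-arith : ∀ c x d x′ r → c ≡ x + d → d ≡ x′ + r → + 2 ≤ c → r ≤ 0ℤ → + 2 ≤ x + x′
    w-two-arith _ x _ x′ r refl refl h h′ = by (h ⊞ h′) (solve (x ∷ x′ ∷ r ∷ []))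

    wt₁-arith : ∀ x y → + 2 ≤ x + y → y ≤ 1ℤ → 1ℤ ≤ x
    wt₁-arith x y h h′ = by (h ⊞ h′) (solve (x ∷ y ∷ []))

    contra-arith : ∀ m r₁ r₂ r₃ r₄ r₅ p₁ p₂ p₃ p₄ p₅ k₂ k₃ k₄ k₅ → r₁ ≡ p₁ → r₂ ≡ r₁ + p₂ - k₂ → r₃ ≡ r₂ + p₃ - k₃ → r₄ ≡ r₃ + p₄ - k₄ → r₅ ≡ r₄ + p₅ - k₅ →
      p₁ ≤ + 8 * m - 1ℤ → p₂ ≤ + 8 * m - 1ℤ → p₃ ≤ + 8 * m - 1ℤ → p₄ ≡ + 6 * m + 1ℤ → p₅ ≡ + 6 * m + 1ℤ →
      + 4 * m * + 2 ≤ k₂ → 0ℤ ≤ k₃ → + 4 * m * + 3 ≤ k₄ → + 4 * m * + 3 ≤ k₅ → + 4 * m ≤ r₅ → 1ℤ ≤ 0ℤ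
    contra-arith m _ _ _ _ _ p₁ p₂ p₃ _ _ k₂ k₃ k₄ k₅ refl refl refl refl refl h₁ h₂ h₃ refl refl g₂ g₃ g₄ g₅ h =
      ℤP.≤-trans {j = p₁ + p₂ + p₃ + + 8 * m + + 3 - k₂ - k₃ - k₄ - k₅} (by h (solve (m ∷ p₁ ∷ p₂ ∷ p₃ ∷ k₂ ∷ k₃ ∷ k₄ ∷ k₅ ∷ [])))
        (by (h₁ ⊞ h₂ ⊞ h₃ ⊞ g₂ ⊞ g₃ ⊞ g₄ ⊞ g₅) (solve (m ∷ p₁ ∷ p₂ ∷ p₃ ∷ k₂ ∷ k₃ ∷ k₄ ∷ k₅ ∷ [])))

    Z≤3-arith : ∀ e c t → c ≤ e → + 2 * e ≤ t + c → t ≤ + 3 → c ≤ + 3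
    Z≤3-arith e c t h h′ h″ = by (h ⊞ h ⊞ h′ ⊞ h″) (solve (e ∷ c ∷ t ∷ []))

    triangle-arith : ∀ c c₁ e e₁ k x → c ≡ 1ℤ + c₁ → c₁ ≡ 1ℤ → e ≡ e₁ + k → e₁ ≡ 0ℤ → k ≡ x → x ≤ 1ℤ → c ≤ e → 1ℤ ≤ 0ℤ
    triangle-arith _ _ _ _ _ x refl refl refl refl refl h h′ = ℤP.≤-trans {j = x - 1ℤ} (by h′ (solve (x ∷ []))) (by h (solve (x ∷ [])))

    triangle-arith-2 : ∀ c c₁ c₂ c₃ → c ≡ 1ℤ + c₁ → c₁ ≡ 1ℤ + c₂ → c₂ ≡ 1ℤ + c₃ → 1ℤ ≤ c₃ → c ≤ + 3 → 1ℤ ≤ 0ℤ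
    triangle-arith-2 _ _ _ c₃ refl refl refl h h′ = ℤP.≤-trans {j = c₃} h (by h′ (solve (c₃ ∷ [])))

    triangle-arith-3 : ∀ c c₁ c₂ e e₁ e₂ k₁ k₂ x y w v → c ≡ 1ℤ + c₁ → c₁ ≡ 1ℤ + c₂ → c₂ ≡ 1ℤ → e ≡ e₁ + k₁ → e₁ ≡ e₂ + k₂ → e₂ ≡ 0ℤ → k₂ ≡ x → k₁ ≡ y + v → v ≡ w → c ≤ e → + 3 ≤ x + (y + w)
    triangle-arith-3 _ _ _ _ _ _ _ _ x y w _ refl refl refl refl refl refl refl refl refl h = by h (solve (x ∷ y ∷ w ∷ []))

    triangle-arith-4 : ∀ x y w → + 3 ≤ x + (y + w) → x ≤ 1ℤ → w ≤ 1ℤ → 1ℤ ≤ y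
    triangle-arith-4 x y w h h₁ h₂ = by (h ⊞ h₁ ⊞ h₂) (solve (x ∷ y ∷ w ∷ []))

    triangle-arith-5 : ∀ x y w → + 3 ≤ x + (y + w) → x ≤ 1ℤ → y ≤ 1ℤ → 1ℤ ≤ w
    triangle-arith-5 x y w h h₁ h₂ = by (h ⊞ h₁ ⊞ h₂) (solve (x ∷ y ∷ w ∷ []))

    triangle-arith-6 : ∀ x y w → + 3 ≤ x + (y + w) → y ≤ 1ℤ → w ≤ 1ℤ → 1ℤ ≤ x
    triangle-arith-6 x y w h h₁ h₂ = by (h ⊞ h₁ ⊞ h₂) (solve (x ∷ y ∷ w ∷ []))

    2≤s-arith : ∀ m → 1ℤ ≤ m → + 2 * 1ℤ ≤ + 2 * m
    2≤s-arith m h = by (h ⊞ h) (solve (m ∷ []))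

    lo-arith : ∀ x → x ≤ x + 1ℤ
    lo-arith x = by (0≤ 1) (solve (x ∷ []))

    Com-bound-arith : ∀ x → x + 1ℤ ≤ + 2 → x ≤ 1ℤ + 0ℤ
    Com-bound-arith x h = by h (solve (x ∷ []))

    a≤cr-arith : ∀ c x y → c ≡ x + y → 0ℤ ≤ y → x ≤ c
    a≤cr-arith _ x y refl h = by h (solve (x ∷ y ∷ []))

    many-arith : ∀ k c t → k ≤ c → c ≤ t + 1ℤ → k - 1ℤ ≤ t
    many-arith k c t h h′ = by (h ⊞ h′) (solve (k ∷ c ∷ t ∷ []))

    both-arith-2 : ∀ x y → + 2 ≤ x + y → x ≤ 1ℤ → 1ℤ ≤ y
    both-arith-2 x y h h′ = by (h ⊞ h′) (solve (x ∷ y ∷ []))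

    colour-arith : ∀ x → x + 1ℤ ≤ + 2 → x ≤ 1ℤ
    colour-arith x h = by h (solve (x ∷ []))

  module Final (m : ℕ) (1≤m : 1 ℕ.≤ m) {N : ℕ} (G : Graph N) (ω : Fin N → ℕ) (V : Sub N) where
    open Even m 1≤m {N}
    open Star m 1≤m G ω V using (CubicVertex)
    open CubicVertex

    module EndGame (pos : Pos ω) (valid : Valid G ω V) (ih : IH V) (gap : Gap G ω V) (T : Sub N) (T⊆V : T ⊆ V)
      (cubicT : ∀ t → t ∈ T → CubicVertex t) (indep : ∀ t → t ∈ T → cr G t T ≤ 0ℤ)
      (nn : ∀ o → o ∈ V ∖ T → 0ℤ ≤ + 3 - cr G o T)
      (kind : ∀ o → o ∈ V ∖ T → (ω o ≡ 1 × cr G o (V ∖ T) ≡ + 3 - cr G o T + 1ℤ) ⊎ (ω o ≡ m ℕ.+ 1 × cr G o (V ∖ T) ≡ + 3 - cr G o T))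
      (total : ∑ (V ∖ T) (λ o → + 3 - cr G o T) ≤ + 3) where

      open Reduce G ω V pos valid ih gap

      O : Sub N
      O = V ∖ T

      -- By `lo` and `hi` this is also the degree of `o` inside `O`, up to one: equal to it at
      -- weight `m + 1`, one less at weight 1.
      τ : Fin N → ℤ
      τ o = + 3 - cr G o T

      O⊆V : O ⊆ V
      O⊆V v q = proj₁ (∖⁻ V T q)

      O∉T : ∀ {v} → v ∈ O → T v ≡ false
      O∉T q = proj₂ (∖⁻ V T q)

      1≤s′ : 1 ℕ.≤ s
      1≤s′ = ℕP.≤-trans 1≤m m≤s

      2≤s : + 2 * + 1 ≤ + s
      2≤s = ℤP.≤-trans (2≤s-arith μ 1≤μ) (eq (sym σ))

      lo : ∀ o → o ∈ O → τ o ≤ cr G o O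
      lo o q with kind o q
      ... | inj₁ (_ , h) = ℤP.≤-trans (lo-arith (τ o)) (eq′ h)
      ... | inj₂ (_ , h) = eq′ h

      hi : ∀ o → o ∈ O → cr G o O ≤ τ o + 1ℤ
      hi o q with kind o q
      ... | inj₁ (_ , h) = eq h
      ... | inj₂ (_ , h) = ℤP.≤-trans (eq h) (lo-arith (τ o))

      -- By `cover`, a vertex outside `X` keeps at most one edge inside M, and none if its weight is
      -- `m + 1`. So M is a matching on vertices of weight 1 together with isolated vertices.
      module Colour (X : Sub N) (X⊆ : X ⊆ O) (F : Forest G (T ∪ X)) (cover : ∀ v → v ∈ O ∖ X → τ v ≤ cr G v X) where

        M : Sub N
        M = V ∩ (O ∖ X)

        M⊆ : M ⊆ O ∖ X
        M⊆ v q = proj₂ (∩⁻ V (O ∖ X) q)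

        M∈O : ∀ {v} → v ∈ M → v ∈ O
        M∈O {v} q = proj₁ (∖⁻ O X (M⊆ v q))

        rest : ∀ v → v ∈ M → cr G v M + τ v ≤ cr G v O
        rest v q = rest-arith-3 (cr G v O) (cr G v X) (cr G v (O ∖ X)) (cr G v M) (τ v) (∑-sub _ X⊆) (cover v (M⊆ v q)) (cr-⊆ G v M⊆)

        light : Light G s ω M
        light = matching-light G w≤ deg≤1 pair
          where
          w≤ : ∀ v → v ∈ M → ω v ℕ.≤ s
          w≤ v q with kind v (M∈O q)
          ... | inj₁ (h , _) = subst (ℕ._≤ s) (sym h) 1≤s′
          ... | inj₂ (h , _) = subst (ℕ._≤ s) (sym h) (subst (m ℕ.+ 1 ℕ.≤_) m+m≡s (ℕP.+-monoʳ-≤ m 1≤m))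
          deg≤1 : ∀ v → v ∈ M → cr G v M ≤ 1ℤ
          deg≤1 v q = light-arith (cr G v M) (τ v) (cr G v O) (rest v q) (hi v (M∈O q))
          pair : ∀ v → v ∈ M → 1ℤ ≤ cr G v M → + 2 * + ω v ≤ + s
          pair v q l with kind v (M∈O q)
          ... | inj₁ (h , _) = subst (λ x → + 2 * + x ≤ + s) (sym h) 2≤s
          ... | inj₂ (_ , h) = ⊥-elim (1≰0 (ℤP.≤-trans l (light-arith-2 (cr G v M) (τ v) (cr G v O) (rest v q) h)))

        result : Colorable G s ω V
        result = O ∖ X , light , Forest-⊆ G {S = T ∪ X} sub F
          where
          sub : V ∖ (O ∖ X) ⊆ T ∪ X
          sub v q with ∖⁻ V (O ∖ X) q | true⊎false (T v) | true⊎false (X v)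
          ... | _ | inj₁ t | _ = ∪ˡ T X t
          ... | _ | _ | inj₁ x = ∪ʳ T X x
          ... | v∈ , n | inj₂ t | inj₂ x = ⊥-elim (true≢false (∖⁺ O X (∖⁺ V T v∈ t) x) n)

      e-T : ∀ A → A ⊆ T → e G A ≤ 0ℤ
      e-T A A⊆ = halve-≤ (ℤP.≤-trans (double-cr G A {λ _ → 0ℤ} λ v q → ℤP.≤-trans (cr-⊆ G v A⊆) (indep v (A⊆ v q))) (ℤP.≤-trans (eq (∑-0 A)) (0≤ 1)))

      a≤1 : ∀ {z t} → z ∈ O → t ∈ T → a G z t ≤ 1ℤ
      a≤1 {z} {t} p q = subst (_≤ 1ℤ) (a-sym G t z) (simple (cubicT t q) z (O⊆V z p))

      forest-T : Forest G T
      forest-T A A⊆ (v , v∈) = ℤP.≤-trans (ℤP.+-monoˡ-≤ 1ℤ (e-T A A⊆)) (card-pos v∈)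

      cr-card : ∀ {z} A → z ∈ O → A ⊆ T → cr G z A ≤ card A
      cr-card A p A⊆ = ∑-mono A λ t q → a≤1 p (A⊆ t q)

      -- `T` spans no edge and `z` has only simple edges to it, so the union is a star and isolated
      -- vertices.
      forest-one : ∀ {z} → z ∈ O → Forest G (T ∪ ⁅ z ⁆)
      forest-one {z} p = insert-forest G {S = T} {u = z} ad forest-T λ A A⊆ _ → add-arith-2 (e G A) (cr G z A) (card A) (e-T A A⊆) (cr-card A p A⊆)
        where
        ad : Adds G T z (T ∪ ⁅ z ⁆)
        ad v q n with ∪⁻ T ⁅ z ⁆ q
        ... | inj₁ r = r
        ... | inj₂ r = ⊥-elim (n (==⇒≡ r))

      Com : Fin N → Fin N → Sub N
      Com z y t = does (+ 2 ≤? a G z t + a G y t)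

      Com-true : ∀ {z y t} → t ∈ Com z y → + 2 ≤ a G z t + a G y t
      Com-true {z} {y} {t} q with + 2 ≤? a G z t + a G y t
      ... | yes r = r

      Com-bound : ∀ {z y t} → z ∈ O → y ∈ O → t ∈ T → a G z t + a G y t ≤ 1ℤ + ⟦ Com z y t ⟧
      Com-bound {z} {y} {t} p q r with + 2 ≤? a G z t + a G y t
      ... | yes _ = a≤1 p r ⊞ a≤1 q r
      ... | no n = Com-bound-arith (a G z t + a G y t) (≰⇒+1≤ n)

      common : Fin N → Fin N → ℤ
      common z y = ∑ T (λ t → ⟦ Com z y t ⟧)

      -- Two stars with nonadjacent centres that share at most one leaf.
      forest-two : ∀ {z y} → z ∈ O → y ∈ O → z ≢ y → a G y z ≤ 0ℤ → common z y ≤ 1ℤ → Forest G (T ∪ (⁅ z ⁆ ∪ ⁅ y ⁆))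
      forest-two {z} {y} z∈ y∈ n none few = insert-forest G {S = T ∪ ⁅ z ⁆} {u = y} ad (forest-one z∈) add
        where
        ad : Adds G (T ∪ ⁅ z ⁆) y (T ∪ (⁅ z ⁆ ∪ ⁅ y ⁆))
        ad v q n with ∪⁻ T (⁅ z ⁆ ∪ ⁅ y ⁆) q
        ... | inj₁ r = ∪ˡ T ⁅ z ⁆ r
        ... | inj₂ r with ∪⁻ ⁅ z ⁆ ⁅ y ⁆ r
        ...   | inj₁ r′ = ∪ʳ T ⁅ z ⁆ r′
        ...   | inj₂ r′ = ⊥-elim (n (==⇒≡ r′))
        in-T : ∀ {A} → A ⊆ T ∪ ⁅ z ⁆ → ∀ v → v ∈ A → v ≢ z → v ∈ T
        in-T A⊆ v q n with ∪⁻ T ⁅ z ⁆ (A⊆ v q)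
        ... | inj₁ r = r
        ... | inj₂ r = ⊥-elim (n (==⇒≡ r))
        add : ∀ A → A ⊆ T ∪ ⁅ z ⁆ → Nonempty A → e G A + cr G y A ≤ card A
        add A A⊆ _ with true⊎false (A z)
        ... | inj₂ z∉ = add-arith-2 (e G A) (cr G y A) (card A) (e-T A A⊆T) (cr-card A y∈ A⊆T)
          where
          A⊆T : A ⊆ T
          A⊆T v q = in-T {A} A⊆ v q λ { refl → true≢false q z∉ }
        ... | inj₁ z∈A = add-arith-3 (e G A) (e G A₀) (cr G z A₀) (cr G y A) (a G y z) (cr G y A₀) (card A) (card A₀) (∑ A₀ (λ t → ⟦ Com z y t ⟧)) (common z y)
            (e-pt G z∈A) (∑-pt _ z∈A) (∑-pt _ z∈A) (e-T A₀ A₀⊆) none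
            (ℤP.≤-trans (eq (sym (∑-+ A₀ _ _))) (ℤP.≤-trans (∑-mono A₀ λ t q → Com-bound z∈ y∈ (A₀⊆ t q)) (eq (∑-+ A₀ _ _)))) (∑-⊆ A₀⊆ λ t _ → ⟦⟧-nn (Com z y t)) few
          where
          A₀ = A -′ z
          A₀⊆ : A₀ ⊆ T
          A₀⊆ v q = in-T {A} A⊆ v (-′-⊆ {A = A} z v q) (-′-≢ A q)

      light-T : Light G s ω T
      light-T = matching-light G (λ t q → subst (ℕ._≤ s) (sym (weight (cubicT t q))) m≤s) (λ t q → ℤP.≤-trans (indep t q) (0≤ 1)) λ t q l → ⊥-elim (1≰0 (ℤP.≤-trans l (indep t q)))

      forest-O : Forest G O → Colorable G s ω V
      forest-O F = T , Light-⊆ G {S = T} (λ v q → proj₂ (∩⁻ V T q)) light-T , F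

      a≤cr : ∀ {u v A} → v ∈ A → a G u v ≤ cr G u A
      a≤cr {u} {v} {A} q = a≤cr-arith (cr G u A) (a G u v) (cr G u (A -′ v)) (∑-pt _ q) (cr-nn G u (A -′ v))

      a₂≤cr : ∀ {u v w A} → v ∈ A → w ∈ (A -′ v) → a G u v + a G u w ≤ cr G u A
      a₂≤cr {u} {v} {w} {A} p q = ℤP.≤-trans (ℤP.+-monoʳ-≤ (a G u v) (a≤cr q)) (eq (sym (∑-pt _ p)))

      a₃≤cr : ∀ {u v w x A} → v ∈ A → w ∈ (A -′ v) → x ∈ (A -′ v -′ w) → a G u v + (a G u w + a G u x) ≤ cr G u A
      a₃≤cr {u} {v} {w} {x} {A} p q r = ℤP.≤-trans (ℤP.+-monoʳ-≤ (a G u v) (a₂≤cr q r)) (eq (sym (∑-pt _ p)))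

      flip : ∀ {k u v} → k ≤ a G u v → k ≤ a G v u
      flip {k} {u} {v} = subst (k ≤_) (a-sym G u v)

      sum-nn : ∀ A → A ⊆ O → 0ℤ ≤ ∑ A τ
      sum-nn A A⊆ = ∑-nn A λ v q → nn v (A⊆ v q)

      -- Nonnegative integers of sum at most 3: three positive ones must all be 1, and the others
      -- vanish.
      module Three {p q r : Fin N} (p∈ : p ∈ O) (q∈ : q ∈ (O -′ p)) (r∈ : r ∈ (O -′ p -′ q)) (τp : 1ℤ ≤ τ p) (τq : 1ℤ ≤ τ q) (τr : 1ℤ ≤ τ r) where

        W : Sub N
        W = O -′ p -′ q -′ r

        W⊆O : W ⊆ O
        W⊆O v h = -′-⊆ {A = O} p v (-′-⊆ {A = O -′ p} q v (-′-⊆ {A = O -′ p -′ q} r v h))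

        sum≤3 : τ p + (τ q + (τ r + ∑ W τ)) ≤ + 3
        sum≤3 = ℤP.≤-trans (eq (sym (trans (∑-pt _ p∈) (cong (λ z → τ p + z) (trans (∑-pt _ q∈) (cong (λ z → τ q + z) (∑-pt _ r∈))))))) total

        p≤1 : τ p ≤ 1ℤ
        p≤1 = p≤1-arith (τ p) (τ q) (τ r) (∑ W τ) sum≤3 τq τr (sum-nn W W⊆O)

        q≤1 : τ q ≤ 1ℤ
        q≤1 = q≤1-arith (τ p) (τ q) (τ r) (∑ W τ) sum≤3 τp τr (sum-nn W W⊆O)

        r≤1 : τ r ≤ 1ℤ
        r≤1 = r≤1-arith (τ p) (τ q) (τ r) (∑ W τ) sum≤3 τp τq (sum-nn W W⊆O)

        others : ∀ v → v ∈ O → v ≢ p → v ≢ q → v ≢ r → τ v ≤ 0ℤ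
        others v v∈ n₁ n₂ n₃ = others-arith (τ p) (τ q) (τ r) (∑ W τ) (τ v) (∑ (W -′ v) τ) sum≤3 τp τq τr (∑-pt _ v∈W) (sum-nn (W -′ v) λ x h → W⊆O x (-′-⊆ {A = W} v x h))
          where
          v∈W : v ∈ W
          v∈W = -′-intro {A = O -′ p -′ q} (-′-intro {A = O -′ p} (-′-intro {A = O} v∈ n₁) n₂) n₃

      many : ∀ {v k} → v ∈ O → k ≤ cr G v O → k - 1ℤ ≤ τ v
      many {v} {k} q h = many-arith k (cr G v O) (τ v) h (hi v q)

      ⁅⁆⊆ : ∀ {z} → z ∈ O → ⁅ z ⁆ ⊆ O
      ⁅⁆⊆ z∈ v q = subst (_∈ O) (sym (==⇒≡ q)) z∈

      module Double {z w : Fin N} (z∈ : z ∈ O) (w∈ : w ∈ O) (n : z ≢ w) (dbl : + 2 ≤ a G z w) where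

        w∈′ : w ∈ (O -′ z)
        w∈′ = -′-intro {A = O} w∈ (n ∘ sym)

        R : Sub N
        R = O -′ z -′ w

        R⊆O : R ⊆ O
        R⊆O v h = -′-⊆ {A = O} z v (-′-⊆ {A = O -′ z} w v h)

        τz : 1ℤ ≤ τ z
        τz = many z∈ (ℤP.≤-trans dbl (a≤cr w∈))

        τw : 1ℤ ≤ τ w
        τw = many w∈ (ℤP.≤-trans (flip dbl) (a≤cr z∈))

        alone : (∀ v → v ∈ R → τ v ≤ 0ℤ) → Colorable G s ω V
        alone none = Colour.result ⁅ z ⁆ (⁅⁆⊆ z∈) (forest-one z∈) cover
          where
          w≤2 : τ w ≤ + 2
          w≤2 = alone-arith (τ z) (τ w) (∑ R τ) (ℤP.≤-trans (eq (sym (trans (∑-pt _ z∈) (cong (λ x → τ z + x) (∑-pt _ w∈′))))) total) τz (sum-nn R R⊆O)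
          cover : ∀ v → v ∈ O ∖ ⁅ z ⁆ → τ v ≤ cr G v ⁅ z ⁆
          cover v q with true⊎false (v == w)
          ... | inj₂ h = ℤP.≤-trans (none v (-′-intro {A = O -′ z} q (==-false h))) (cr-nn G v ⁅ z ⁆)
          -- As `τ z` takes one of the three units, `τ w` is at most 2 and the double edge to `z`
          -- covers it.
          ... | inj₁ h = subst (λ x → τ x ≤ cr G x ⁅ z ⁆) (sym (==⇒≡ h)) (ℤP.≤-trans w≤2 (ℤP.≤-trans (flip dbl) (eq (sym (∑-⁅⁆ z _)))))

        module Third {y : Fin N} (y∈R : y ∈ R) (τy : 1ℤ ≤ τ y) where
          open Three z∈ w∈′ y∈R τz τw τy public

          y∈ : y ∈ O
          y∈ = R⊆O y y∈R

          y≢z : y ≢ z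
          y≢z = -′-≢ O (-′-⊆ {A = O -′ z} w y y∈R)

          y≢w : y ≢ w
          y≢w = -′-≢ (O -′ z) y∈R

          -- Now `τ z = 1`, so `z` has degree at most 2 inside `O`, and the double edge uses it up.
          yz : a G y z ≤ 0ℤ
          yz = subst (_≤ 0ℤ) (a-sym G z y) (yz-arith (a G z w) (a G z y) (cr G z O) (τ z) (a₂≤cr w∈ (-′-intro {A = O} y∈ y≢w)) dbl (hi z z∈) p≤1)

          via : common z y ≤ 1ℤ → Colorable G s ω V
          via few = Colour.result X (⊆-add ⁅ z ⁆ y (⁅⁆⊆ z∈) y∈) (forest-two z∈ y∈ (y≢z ∘ sym) yz few) cover
            where
            X = ⁅ z ⁆ ∪ ⁅ y ⁆
            cover : ∀ v → v ∈ O ∖ X → τ v ≤ cr G v X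
            cover v q with true⊎false (v == w)
            ... | inj₂ h = ℤP.≤-trans (others v (proj₁ (∖⁻ O X q)) (λ g → true≢false (subst (_∈ X) (sym g) (∈-keep ⁅ z ⁆ y (==-refl z))) (proj₂ (∖⁻ O X q)))
                    (==-false h) (λ g → true≢false (subst (_∈ X) (sym g) (∈-new ⁅ z ⁆ y)) (proj₂ (∖⁻ O X q)))) (cr-nn G v X)
            ... | inj₁ h = subst (λ x → τ x ≤ cr G x X) (sym (==⇒≡ h)) (ℤP.≤-trans q≤1 (ℤP.≤-trans (ℤP.≤-trans (+≤+ (s≤s z≤n)) (flip dbl)) (a≤cr {A = X} (∈-keep ⁅ z ⁆ y (==-refl z)))))

      ⟦⟧-true : ∀ {b} → 1ℤ ≤ ⟦ b ⟧ → b ≡ true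
      ⟦⟧-true {true} _ = refl
      ⟦⟧-true {false} h = ⊥-elim (1≰0 h)

      ⟦⟧≤1 : ∀ b → ⟦ b ⟧ ≤ 1ℤ
      ⟦⟧≤1 true = ℤP.≤-refl
      ⟦⟧≤1 false = 0≤ 1

      both : ∀ {z y t} → z ∈ O → y ∈ O → t ∈ T → t ∈ Com z y → 1ℤ ≤ a G z t × 1ℤ ≤ a G y t
      both {z} {y} {t} p q r h = wt₁-arith (a G z t) (a G y t) (Com-true h) (a≤1 q r) , both-arith-2 (a G z t) (a G y t) (Com-true h) (a≤1 p r)

      -- If y shares two T-neighbours with z and with w, these are the same two, and together with z, w, y they span too many edges.
      module Crowded {z w y : Fin N} (z∈ : z ∈ O) (w∈ : w ∈ O) (n : z ≢ w) (dbl : + 2 ≤ a G z w) (y∈ : y ∈ O) (y≢z : y ≢ z) (y≢w : y ≢ w)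
        (τy : 1ℤ ≤ τ y) (yz : a G y z ≤ 0ℤ) (yw : a G y w ≤ 0ℤ) (cz : + 2 ≤ common z y) (cw : + 2 ≤ common w y) where

        first : ∃ λ t → t ∈ T × 1ℤ ≤ ⟦ Com z y t ⟧
        first = ∑-pos T (ℤP.≤-trans (+≤+ (s≤s z≤n)) cz)

        t : Fin N
        t = proj₁ first

        t∈ : t ∈ T
        t∈ = proj₁ (proj₂ first)

        second : ∃ λ t′ → t′ ∈ (T -′ t) × 1ℤ ≤ ⟦ Com z y t′ ⟧
        second = ∑-pos (T -′ t) (arm-arith-2 (common z y) ⟦ Com z y t ⟧ (∑ (T -′ t) λ x → ⟦ Com z y x ⟧) (∑-pt _ t∈) cz (⟦⟧≤1 (Com z y t)))

        t′ : Fin N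
        t′ = proj₁ second

        t′∈t : t′ ∈ (T -′ t)
        t′∈t = proj₁ (proj₂ second)

        t′∈ : t′ ∈ T
        t′∈ = -′-⊆ {A = T} t t′ t′∈t

        zt = both z∈ y∈ t∈ (⟦⟧-true (proj₂ (proj₂ first)))
        zt′ = both z∈ y∈ t′∈ (⟦⟧-true (proj₂ (proj₂ second)))

        T₀ : Sub N
        T₀ = T -′ t -′ t′

        rest : cr G y T₀ ≤ 0ℤ
        rest = rest-arith-4 (cr G y T) (a G y t) (cr G y (T -′ t)) (a G y t′) (cr G y T₀) (∑-pt _ t∈) (∑-pt _ t′∈t) τy (proj₂ zt) (proj₂ zt′)

        w-rest : ∑ T₀ (λ x → ⟦ Com w y x ⟧) ≤ 0ℤ
        w-rest = ℤP.≤-trans (∑-mono T₀ go) (eq (∑-0 T₀))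
          where
          go : ∀ x → x ∈ T₀ → ⟦ Com w y x ⟧ ≤ 0ℤ
          go x q with true⊎false (Com w y x)
          ... | inj₂ h = eq (cong ⟦_⟧ h)
          ... | inj₁ h = ⊥-elim (1≰0 (ℤP.≤-trans (proj₂ (both w∈ y∈ (-′-⊆ {A = T} t x (-′-⊆ {A = T -′ t} t′ x q)) h)) (ℤP.≤-trans (a≤cr q) rest)))

        w-two : + 2 ≤ ⟦ Com w y t ⟧ + ⟦ Com w y t′ ⟧
        w-two = w-two-arith (common w y) ⟦ Com w y t ⟧ (∑ (T -′ t) λ x → ⟦ Com w y x ⟧) ⟦ Com w y t′ ⟧ (∑ T₀ λ x → ⟦ Com w y x ⟧) (∑-pt _ t∈) (∑-pt _ t′∈t) cw w-rest

        wt₁ : 1ℤ ≤ a G w t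
        wt₁ = proj₁ (both w∈ y∈ t∈ (⟦⟧-true (wt₁-arith ⟦ Com w y t ⟧ ⟦ Com w y t′ ⟧ w-two (⟦⟧≤1 (Com w y t′)))))

        wt₂ : 1ℤ ≤ a G w t′
        wt₂ = proj₁ (both w∈ y∈ t′∈ (⟦⟧-true (arm-arith-2 (⟦ Com w y t ⟧ + ⟦ Com w y t′ ⟧) ⟦ Com w y t ⟧ ⟦ Com w y t′ ⟧ refl w-two (⟦⟧≤1 (Com w y t)))))

        T≢O : ∀ {x o} → x ∈ T → o ∈ O → x ≢ o
        T≢O p q h = true≢false (subst (_∈ T) h p) (O∉T q)

        B₁ B₂ B₃ B₄ B₅ : Sub N
        B₁ = ⁅ z ⁆
        B₂ = B₁ ∪ ⁅ w ⁆
        B₃ = B₂ ∪ ⁅ y ⁆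
        B₄ = B₃ ∪ ⁅ t ⁆
        B₅ = B₄ ∪ ⁅ t′ ⁆

        ∉B₃ : ∀ {x} → x ≢ z → x ≢ w → x ≢ y → B₃ x ≡ false
        ∉B₃ p q r = ∉-add B₂ y (∉-add B₁ w (≢⇒== p) q) r

        three : ∀ {x} B → B₃ ⊆ B → 1ℤ ≤ a G z x → 1ℤ ≤ a G w x → 1ℤ ≤ a G y x → + 3 ≤ cr G x B
        three {x} B B⊇ p q r = ℤP.≤-trans (flip p ⊞ (flip q ⊞ flip r)) (ℤP.≤-trans (a₃≤cr {x} {z} {w} {y} {B₃} (∈-keep B₂ y (∈-keep B₁ w (==-refl z)))
            (-′-intro {A = B₃} (∈-keep B₂ y (∈-new B₁ w)) (n ∘ sym)) (-′-intro {A = B₃ -′ z} (-′-intro {A = B₃} (∈-new B₂ y) y≢z) y≢w)) (cr-⊆ G x B⊇))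

        -- A vertex missed by the five below, needed for the gap: `y` has a neighbour in `O`, which
        -- is neither `z` nor `w`.
        outside : ∃ λ x → x ∈ O × 1ℤ ≤ a G y x
        outside = ∑-pos O (ℤP.≤-trans τy (lo y y∈))

        x : Fin N
        x = proj₁ outside

        x∈ : x ∈ O
        x∈ = proj₁ (proj₂ outside)

        x-not : ∀ {v} → a G y v ≤ 0ℤ → x ≢ v
        x-not h g = 1≰0 (ℤP.≤-trans (proj₂ (proj₂ outside)) (subst (λ v → a G y v ≤ 0ℤ) (sym g) h))

        contra : ⊥
        -- The five vertices bring at most `3(8m - 1) + 2(6m + 1)` and span at least `2 + 3 + 3`
        -- edges worth `4m` each; the rest is `4m - 1`, below the gap.
        contra = 1≰0 (contra-arith μ (ρ G ω B₁) (ρ G ω B₂) (ρ G ω B₃) (ρ G ω B₄) (ρ G ω B₅) (pot (ω z)) (pot (ω w)) (pot (ω y)) (pot (ω t)) (pot (ω t′))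
            (K * cr G w B₁) (K * cr G y B₂) (K * cr G t B₃) (K * cr G t′ B₄)
            (single-ρ G {A = B₁} (==-refl z) (λ v → ≢true λ q → -′-≢ B₁ q (==⇒≡ (-′-⊆ {A = B₁} z v q))))
            (ρ-ins {A = B₁} {w} (≢⇒== (n ∘ sym))) (ρ-ins {A = B₂} {y} (∉-add B₁ w (≢⇒== y≢z) y≢w))
            (ρ-ins {A = B₃} {t} (∉B₃ (T≢O t∈ z∈) (T≢O t∈ w∈) (T≢O t∈ y∈)))
            (ρ-ins {A = B₄} {t′} (∉-add B₃ t (∉B₃ (T≢O t′∈ z∈) (T≢O t′∈ w∈) (T≢O t′∈ y∈)) (-′-≢ T t′∈t)))
            (pot-le z) (pot-le w) (pot-le y) (trans (cong pot (weight (cubicT t t∈))) pot-m) (trans (cong pot (weight (cubicT t′ t′∈))) pot-m)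
            (K*-mono (ℤP.≤-trans (flip dbl) (eq (sym (∑-⁅⁆ z _))))) (*-nn 0≤K (cr-nn G y B₂))
            (K*-mono (three B₃ (λ _ q → q) (proj₁ zt) wt₁ (proj₂ zt)))
            (K*-mono (three B₄ (λ _ q → ∈-keep B₃ t q) (proj₁ zt′) wt₂ (proj₂ zt′)))
            (gap B₅ sub (two-of {A = B₅} (∈-keep B₄ t′ (∈-new B₃ t)) (-′-intro {A = B₅} (∈-new B₄ t′) (-′-≢ T t′∈t))) x (O⊆V x x∈)
              (∉-add B₄ t′ (∉-add B₃ t (∉B₃ (x-not yz) (x-not yw) (x-not (eq (a-irr G y)))) (T≢O t∈ x∈ ∘ sym)) (T≢O t′∈ x∈ ∘ sym))))
          where
          sub : B₅ ⊆ V
          sub = ⊆-add B₄ t′ (⊆-add B₃ t (⊆-add B₂ y (⊆-add B₁ w (λ v q → subst (_∈ V) (sym (==⇒≡ q)) (O⊆V z z∈)) (O⊆V w w∈)) (O⊆V y y∈)) (T⊆V t t∈)) (T⊆V t′ t′∈)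

      -- Either end of the double edge may go to F with the third vertex `y`, so it is enough that
      -- `y` has at most one common neighbour in `T` with one of them.
      double : ∀ {z w} → z ∈ O → w ∈ O → z ≢ w → + 2 ≤ a G z w → Colorable G s ω V
      double {z} {w} z∈ w∈ n dbl with FinP.any? (λ y → ((O -′ z -′ w) y Data.Bool.≟ true) ×-dec (1ℤ ≤? τ y))
      ... | no none = Double.alone z∈ w∈ n dbl λ v q → noF-eq (τ v) (≰⇒+1≤ λ h → none (v , q , h))
      ... | yes (y , y∈R , τy) = go (≤⊎+1≤ (common z y) 1ℤ) (≤⊎+1≤ (common w y) 1ℤ)
        where
        module zw = Double.Third z∈ w∈ n dbl y∈R τy
        module wz = Double.Third w∈ z∈ (n ∘ sym) (flip dbl) (-′-intro {A = O -′ w} (-′-intro {A = O} zw.y∈ zw.y≢w) zw.y≢z) τy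
        go : common z y ≤ 1ℤ ⊎ 1ℤ + 1ℤ ≤ common z y → common w y ≤ 1ℤ ⊎ 1ℤ + 1ℤ ≤ common w y → Colorable G s ω V
        go (inj₁ h) _ = zw.via h
        go _ (inj₁ h) = wz.via h
        go (inj₂ h) (inj₂ h′) = ⊥-elim (Crowded.contra z∈ w∈ n dbl zw.y∈ zw.y≢z zw.y≢w τy zw.yz wz.yz h h′)

      module Simple (single : ∀ {p q} → p ∈ O → q ∈ O → a G p q ≤ 1ℤ) (Z : Sub N) (Z⊆ : Z ⊆ O) (dense : card Z ≤ e G Z) where

        -- The degrees inside `Z` sum to `2e(Z) ≥ 2|Z|`, but also to at most the sum of `τ + 1`,
        -- which is at most `3 + |Z|`.
        Z≤3 : card Z ≤ + 3
        Z≤3 = Z≤3-arith (e G Z) (card Z) (∑ Z τ) dense (ℤP.≤-trans (double-cr G Z {λ v → τ v + 1ℤ} λ v q → ℤP.≤-trans (cr-⊆ G v Z⊆) (hi v (Z⊆ v q))) (eq (∑-+ Z τ _)))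
            (ℤP.≤-trans (∑-⊆ Z⊆ nn) total)

        -- Each corner has degree at least 2 in `O`, so `τ` is 1 at the corners and 0 elsewhere; one
        -- corner in F covers the other two.
        module Triangle {z p q : Fin N} (z∈ : z ∈ O) (p∈ : p ∈ (O -′ z)) (q∈ : q ∈ (O -′ z -′ p)) (zp : 1ℤ ≤ a G z p) (zq : 1ℤ ≤ a G z q) (pq : 1ℤ ≤ a G p q) where

          private
            p∈O : p ∈ O
            p∈O = -′-⊆ {A = O} z p p∈
            q∈z : q ∈ (O -′ z)
            q∈z = -′-⊆ {A = O -′ z} p q q∈
            q∈O : q ∈ O
            q∈O = -′-⊆ {A = O} z q q∈z
            q≢p : q ≢ p
            q≢p = -′-≢ (O -′ z) q∈

          open Three z∈ p∈ q∈ (many z∈ (ℤP.≤-trans (zp ⊞ zq) (a₂≤cr p∈O (-′-intro {A = O} q∈O q≢p))))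
            (many p∈O (ℤP.≤-trans (flip zp ⊞ pq) (a₂≤cr z∈ q∈z))) (many q∈O (ℤP.≤-trans (flip zq ⊞ flip pq) (a₂≤cr z∈ p∈)))

          colour : Colorable G s ω V
          colour = Colour.result ⁅ z ⁆ (⁅⁆⊆ z∈) (forest-one z∈) cover
            where
            cover : ∀ v → v ∈ O ∖ ⁅ z ⁆ → τ v ≤ cr G v ⁅ z ⁆
            cover v h with true⊎false (v == p) | true⊎false (v == q)
            ... | inj₁ g | _ = subst (λ x → τ x ≤ cr G x ⁅ z ⁆) (sym (==⇒≡ g)) (ℤP.≤-trans q≤1 (ℤP.≤-trans (flip zp) (eq (sym (∑-⁅⁆ z _)))))
            ... | _ | inj₁ g = subst (λ x → τ x ≤ cr G x ⁅ z ⁆) (sym (==⇒≡ g)) (ℤP.≤-trans r≤1 (ℤP.≤-trans (flip zq) (eq (sym (∑-⁅⁆ z _)))))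
            ... | inj₂ g | inj₂ g′ = ℤP.≤-trans (others v (-′-⊆ {A = O} z v h) (-′-≢ O h) (==-false g) (==-false g′)) (cr-nn G v ⁅ z ⁆)

        triangle : ∀ {z} → z ∈ Z → Colorable G s ω V
        triangle {z} z∈ with find (Z -′ z)
        ... | inj₂ none = ⊥-elim (1≰0 (subst₂ _≤_ (single-card G z∈ none) (single-e G z∈ none) dense))
        ... | inj₁ (p , p∈) with find (Z -′ z -′ p)
        ...   | inj₂ none = ⊥-elim (1≰0 (triangle-arith (card Z) (card Z₁) (e G Z) (e G Z₁) (cr G z Z₁) (a G z p) (∑-pt _ z∈) (single-card G p∈ none) (e-pt G z∈) (single-e G p∈ none) (single-∑ G p∈ none _)
                  (single (Z⊆ z z∈) (Z⊆ p (-′-⊆ {A = Z} z p p∈))) dense))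
          where
          Z₁ = Z -′ z
        ...   | inj₁ (q , q∈) with find (Z -′ z -′ p -′ q)
        ...     | inj₁ (r , r∈) = ⊥-elim (1≰0 (triangle-arith-2 (card Z) (card (Z -′ z)) (card (Z -′ z -′ p)) (card (Z -′ z -′ p -′ q)) (∑-pt _ z∈) (∑-pt _ p∈) (∑-pt _ q∈) (card-pos r∈) Z≤3))
        ...     | inj₂ none = Triangle.colour (Z⊆ z z∈) (-′-intro {A = O} p∈O (-′-≢ Z p∈)) (-′-intro {A = O -′ z} (-′-intro {A = O} q∈O (-′-≢ Z q∈z)) (-′-≢ (Z -′ z) q∈))
                  (triangle-arith-4 (a G p q) (a G z p) (a G z q) three (single p∈O q∈O) (single z∈O q∈O)) (triangle-arith-5 (a G p q) (a G z p) (a G z q) three (single p∈O q∈O) (single z∈O p∈O))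
                  (triangle-arith-6 (a G p q) (a G z p) (a G z q) three (single z∈O p∈O) (single z∈O q∈O))
          where
          Z₁ = Z -′ z
          Z₂ = Z -′ z -′ p
          z∈O = Z⊆ z z∈
          p∈O : p ∈ O
          p∈O = Z⊆ p (-′-⊆ {A = Z} z p p∈)
          q∈z : q ∈ Z₁
          q∈z = -′-⊆ {A = Z₁} p q q∈
          q∈O : q ∈ O
          q∈O = Z⊆ q (-′-⊆ {A = Z} z q q∈z)
          three : + 3 ≤ a G p q + (a G z p + a G z q)
          three = triangle-arith-3 (card Z) (card Z₁) (card Z₂) (e G Z) (e G Z₁) (e G Z₂) (cr G z Z₁) (cr G p Z₂) (a G p q) (a G z p) (a G z q) (cr G z Z₂)
            (∑-pt _ z∈) (∑-pt _ p∈) (single-card G q∈ none) (e-pt G z∈) (e-pt G p∈) (single-e G q∈ none) (single-∑ G q∈ none _) (∑-pt _ p∈) (single-∑ G q∈ none _) dense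

      colour : Colorable G s ω V
      colour with anySub? {P = λ Z → Z ⊆ O × Nonempty Z × card Z ≤ e G Z} (λ Z → ⊆-dec Z O ×-dec (FinP.any? (λ v → Z v Data.Bool.≟ true) ×-dec (card Z ≤? e G Z)))
          (λ h (p , (v , q) , r) → ⊆-resp h p , (v , trans (sym (h v)) q) , subst₂ _≤_ (∑-set h) (e-cong G h) r)
      ... | no none = forest-O λ A A⊆ ne → ≰⇒+1≤ λ h → none (A , A⊆ , ne , h)
      ... | yes (Z , Z⊆ , (v , v∈) , dense) with FinP.any? (λ z → (O z Data.Bool.≟ true) ×-dec FinP.any? (λ w → (O w Data.Bool.≟ true) ×-dec (+ 2 ≤? a G z w)))
      ...   | yes (z , z∈ , w , w∈ , dbl) = double z∈ w∈ (λ h → 1≰0 (ℤP.≤-trans (+≤+ (s≤s z≤n)) (ℤP.≤-trans dbl (eq (trans (cong (a G z) (sym h)) (a-irr G z)))))) dbl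
      ...   | no none = Simple.triangle (λ {p} {q} p∈ q∈ → colour-arith (a G p q) (≰⇒+1≤ λ h → none (p , p∈ , q , q∈ , h))) Z Z⊆ dense v∈

  -- Discharging for even `s`.

  private
    lem-eq : ∀ n bO → bO ≡ (ℤ.- + 2 * n + bO) + + 2 * n
    lem-eq = solve-∀

    lem-eq-2 : ∀ n → ℤ.- + 2 * ℤ.-1ℤ + + 2 * n ≡ + 2 + + 2 * n
    lem-eq-2 = solve-∀

    num-eq : ∀ x y → y ≡ x + y - x
    num-eq = solve-∀

    num-eq-2 : ∀ x → + 4 - x ≡ + 3 - x + 1ℤ
    num-eq-2 = solve-∀

    num-eq-3 : ∀ n bO → ℤ.- + 2 * n + bO ≡ ℤ.- + 2 * ℤ.-1ℤ → bO ≡ + 2 + + 2 * n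
    num-eq-3 n bO h = trans (lem-eq n bO) (trans (cong (λ y → y + + 2 * n) h) (lem-eq-2 n))

    βT-arith : ∀ m c p → c ≡ + 3 → p ≡ + 6 * m + 1ℤ → + 4 * m * c + ℤ.- + 2 * p ≡ ℤ.- + 2 * 1ℤ
    βT-arith m _ _ refl refl = solve (m ∷ [])

    crO-arith : ∀ c x y → c ≡ x + y → c ≡ + 3 → x ≡ 0ℤ → y ≡ + 3 * 1ℤ
    crO-arith _ _ y refl h refl = trans (sym (ℤP.+-identityˡ y)) h

    kind-arith : ∀ c x y → c ≡ x + y → c ≡ + 4 → y ≡ + 3 - x + 1ℤ
    kind-arith _ x y refl h = trans (num-eq x y) (trans (cong (_- x) h) (num-eq-2 x))

    kind-arith-2 : ∀ c x y → c ≡ x + y → c ≡ + 3 → y ≡ + 3 - x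
    kind-arith-2 _ x y refl h = trans (num-eq x y) (cong (_- x) h)

    six-arith : ∀ c → 0ℤ ≤ c → + 6 * 1ℤ ≤ + 2 * c + + 7
    six-arith c h = by (h ⊞ h ⊞ 0≤ 1) (solve (c ∷ []))

    δ-kind-eq : ∀ x → + 3 * + 2 + ℤ.- + 2 * x ≡ + 2 * (+ 3 - x)
    δ-kind-eq = solve-∀

    δ-big-arith : ∀ c d b → + 2 * c + + 7 ≤ + 3 * b → d ≤ c → + 7 ≤ + 3 * b + ℤ.- + 2 * d
    δ-big-arith c d b h h′ = by (h ⊞ h′ ⊞ h′) (solve (c ∷ d ∷ b ∷ []))

    δ-sum-arith : ∀ n b bT bO r x → b ≡ ℤ.- + 2 * r → b ≡ bT + bO → r ≡ ℤ.-1ℤ → bT ≡ ℤ.- + 2 * n → x ≡ + 3 * n → + 3 * bO + ℤ.- + 2 * x ≡ + 6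
    δ-sum-arith n _ _ bO _ _ h refl refl refl refl = trans (cong (λ y → + 3 * y + ℤ.- + 2 * (+ 3 * n)) (num-eq-3 n bO h)) (solve (n ∷ []))

    kinds-arith : ∀ s x y → s ≡ + 6 → s ≡ x + y → + 7 ≤ x → 0ℤ ≤ y → 1ℤ ≤ 0ℤ
    kinds-arith _ x y h refl h₁ h₂ = ℤP.≤-trans {j = x - + 6} (by h₁ (solve (x ∷ []))) (by (eq h ⊞ h₂) (solve (x ∷ y ∷ [])))

    num-eq-4 : ∀ m → m ≡ + 2 * m - m
    num-eq-4 = solve-∀

    num-eq-5 : ∀ m x → 0ℤ - (+ 2 * m - m) ≡ (x + + 2 * m * + 2 + m + 1ℤ) - (ℤ.-1ℤ + + 4 * m + + 2 * m + 1ℤ + x + 1ℤ + 0ℤ)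
    num-eq-5 = solve-∀

    empty-arith : ∀ r c b → b ≡ ℤ.- + 2 * r → + 6 * c ≤ + 3 * b → ℤ.-1ℤ ≤ r → + 3 ≤ c → 1ℤ ≤ 0ℤ
    empty-arith r c _ refl h h′ h″ = ℤP.≤-trans {j = + 6 * c - + 17} (by (*-monoˡ {+ 6} (0≤ 6) h″) (solve (c ∷ []))) (by (h ⊞ *-monoˡ {+ 6} (0≤ 6) h′ ⊞ 0≤ 11) (solve (r ∷ c ∷ [])))

    h≤m-arith : ∀ h s m → s ≡ + 2 * m → + 2 * h ≤ s → + 2 * h ≤ + 2 * m + 1ℤ
    h≤m-arith h _ m refl l = by (l ⊞ 0≤ 1) (solve (h ∷ m ∷ []))

    ρ≡-arith : ∀ r m h x → r + + 4 * m + + 2 * h + 1ℤ ≤ x → x ≤ + 2 * h * + 3 → h ≤ m → r ≤ ℤ.-1ℤ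
    ρ≡-arith r m h x l l′ l″ = by (l ⊞ l′ ⊞ l″ ⊞ l″ ⊞ l″ ⊞ l″) (solve (r ∷ m ∷ h ∷ x ∷ []))

    ω≡m-arith : ∀ r m h x → r ≡ ℤ.-1ℤ → r + + 4 * m + + 2 * h + 1ℤ ≤ x → x ≤ + 2 * h * + 3 → + 4 * m ≤ + 4 * h
    ω≡m-arith _ m h x refl l l′ = by (l ⊞ l′) (solve (m ∷ h ∷ x ∷ []))

    d≥3-arith : ∀ r m h x → r ≡ ℤ.-1ℤ → h ≡ m → r + + 4 * m + + 2 * h + 1ℤ ≤ x → x ≤ + 2 * h * + 2 → 1ℤ ≤ m → 1ℤ ≤ 0ℤ
    d≥3-arith _ m _ x refl refl l l′ l″ = ℤP.≤-trans {j = m} l″ (ℤP.≤-trans {j = + 2 * m - m} (eq (num-eq-4 m)) (by (l ⊞ l′ ⊞ l″ ⊞ 0≤ 1) (num-eq-5 m x)))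

    simple′-arith : ∀ d d₀ c x c₀ → d ≡ 1ℤ + d₀ → c ≡ x + c₀ → + 3 ≤ d → c ≡ + 3 → 1ℤ + 1ℤ ≤ x → d₀ ≤ c₀ → 1ℤ ≤ 0ℤ
    simple′-arith _ d₀ _ x c₀ refl refl h₁ h₂ h₃ h₄ = ℤP.≤-trans {j = d₀ - 1ℤ} (by h₁ (solve (d₀ ∷ []))) (by (eq h₂ ⊞ h₃ ⊞ h₄) (solve (d₀ ∷ x ∷ c₀ ∷ [])))

    low-arith : ∀ h s m → s ≡ + 2 * m → h ≤ m → + 2 * h ≤ s
    low-arith h _ m refl l = by (l ⊞ l) (solve (h ∷ m ∷ []))

    next-arith : ∀ k → 0ℤ ≤ k → 1ℤ ≤ k + 1ℤ
    next-arith k h = by h (solve (k ∷ []))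

    next-arith-2 : ∀ k c x r → c ≡ x + r → k + 1ℤ ≤ c → x ≤ 1ℤ → k ≤ r
    next-arith-2 k _ x r refl h h′ = by (h ⊞ h′) (solve (k ∷ x ∷ r ∷ []))

    stars-arith : ∀ x → x + 1ℤ ≤ + 4 → x ≤ + 3
    stars-arith x h = by h (solve (x ∷ []))

    balance-arith : ∀ k c e p → c ≡ + 2 * e → k * c + ℤ.- + 2 * p ≡ ℤ.- + 2 * (p - k * e)
    balance-arith k _ e p refl = solve (k ∷ e ∷ p ∷ [])

    pot-ω-arith : ∀ s m → s ≡ + 2 * m → s ≤ + 2 * m + 1ℤ
    pot-ω-arith _ m refl = by (0≤ 1) (solve (m ∷ []))

    classify-arith : ∀ c m p → 0ℤ ≤ + 12 * ((c - + 3) * (m - 1ℤ)) → 0ℤ ≤ + 10 * (c - + 3) → 0ℤ ≤ + 12 * (m - 1ℤ) → p ≡ + 4 * m - 1ℤ → + 2 * c + + 7 ≤ + 3 * (+ 4 * m * c + ℤ.- + 2 * p)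
    classify-arith c m _ h₁ h₂ h₃ refl = by (h₁ ⊞ h₂ ⊞ h₃ ⊞ 0≤ 5) (solve (c ∷ m ∷ []))

    classify-arith-2 : ∀ c m p → 0ℤ ≤ + 12 * ((c - + 5) * (m - 1ℤ)) → 0ℤ ≤ + 10 * (c - + 5) → 0ℤ ≤ + 12 * (m - 1ℤ) → p ≤ + 8 * m - 1ℤ → + 2 * c + + 7 ≤ + 3 * (+ 4 * m * c + ℤ.- + 2 * p)
    classify-arith-2 c m p h₁ h₂ h₃ h₄ = by (h₁ ⊞ h₂ ⊞ h₃ ⊞ h₄ ⊞ h₄ ⊞ h₄ ⊞ h₄ ⊞ h₄ ⊞ h₄ ⊞ 0≤ 1) (solve (c ∷ m ∷ p ∷ []))

    classify-arith-3 : ∀ c m p w → c ≡ + 4 → w ≡ 1ℤ → p ≡ + 8 * m + 1ℤ - + 2 * w → + 4 * m * c + ℤ.- + 2 * p ≡ + 2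
    classify-arith-3 _ m _ _ refl refl refl = solve (m ∷ [])

    classify-arith-4 : ∀ c m p w → c ≡ + 4 → p ≡ + 8 * m + 1ℤ - + 2 * w → + 2 ≤ w → + 2 * c + + 7 ≤ + 3 * (+ 4 * m * c + ℤ.- + 2 * p)
    classify-arith-4 _ m _ w refl refl h = by (*-monoˡ {+ 12} (0≤ 12) h ⊞ 0≤ 3) (solve (m ∷ w ∷ []))

    classify-arith-5 : ∀ c m p w → c ≡ + 3 → w ≡ m + 1ℤ → p ≡ + 8 * m + 1ℤ - + 2 * w → + 4 * m * c + ℤ.- + 2 * p ≡ + 2
    classify-arith-5 _ m _ _ refl refl refl = solve (m ∷ [])

    classify-arith-6 : ∀ c m p w → c ≡ + 3 → p ≡ + 8 * m + 1ℤ - + 2 * w → m + + 2 ≤ w → + 2 * c + + 7 ≤ + 3 * (+ 4 * m * c + ℤ.- + 2 * p)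
    classify-arith-6 _ m _ w refl refl h = by (*-monoˡ {+ 12} (0≤ 12) h ⊞ 0≤ 5) (solve (m ∷ w ∷ []))

  module EvenCase (m : ℕ) (1≤m : 1 ℕ.≤ m) {N : ℕ} where
    open Even m 1≤m {N}

    module Irreducible (G : Graph N) (ω : Fin N → ℕ) (V : Sub N) (pos : Pos ω) (valid : Valid G ω V) (ih : IH V) (gap : Gap G ω V) (3≤V : + 3 ≤ card V) where
      open Reduce G ω V pos valid ih gap
      open Star m 1≤m G ω V
      open CubicVertex

      Whole : Fin N → Set
      Whole u = + 2 * + ω u * card (V ∩ Raise.Nb G ω u (ω u)) ≤ ρ G ω V + K + + 2 * + ω u

      few : ∀ {u} → u ∈ V → cr G u V ≤ + 2 → Colorable G s ω V
      few {u} u∈ d with ω u ℕ.≤? s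
      ... | yes h = low-degree u∈ h d
      ... | no h with ≤⊎+1≤ (cr G u V) 1ℤ
      ...   | inj₁ d′ = pendant u∈ d′
      ...   | inj₂ d′ = DegreeTwo.result u∈ (ℕP.≰⇒> h) (ℤP.≤-antisym d d′) 3≤V

      module _ (deg3 : ∀ v → v ∈ V → + 3 ≤ cr G v V) (tight : ∀ v → v ∈ V → + 2 * + ω v ≤ + s → cr G v V ≤ + 3 → ¬ Whole v) where

        T : Sub N
        T v = V v ∧ (does (+ 2 * + ω v ≤? + s) ∧ does (cr G v V ≤? + 3))

        T⁻ : ∀ {v} → v ∈ T → v ∈ V × + 2 * + ω v ≤ + s × cr G v V ≤ + 3
        T⁻ {v} h with V v | + 2 * + ω v ≤? + s | cr G v V ≤? + 3
        ... | true | yes p | yes q = refl , p , q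

        T⁺ : ∀ {v} → v ∈ V → + 2 * + ω v ≤ + s → cr G v V ≤ + 3 → v ∈ T
        T⁺ {v} h p q with + 2 * + ω v ≤? + s | cr G v V ≤? + 3
        ... | yes _ | yes _ = ∧-intro h refl
        ... | no n | _ = ⊥-elim (n p)
        ... | _ | no n = ⊥-elim (n q)

        T⊆V : T ⊆ V
        T⊆V v q = proj₁ (T⁻ q)

        O : Sub N
        O = V ∖ T

        -- Failure of `Whole` reads `ρ(V) + 4m + 2h + 1 ≤ 2h d` with `h ≤ m` and at most `d ≤ 3`
        -- distinct neighbours. This leaves only `ρ(V) = -1`, `h = m`, `d = 3`.
        module Tight {t : Fin N} (t∈ : t ∈ T) where

          open Raise G ω t (ω t)

          t∈V : t ∈ V
          t∈V = T⊆V t t∈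

          cr≡3 : cr G t V ≡ + 3
          cr≡3 = ℤP.≤-antisym (proj₂ (proj₂ (T⁻ t∈))) (deg3 t t∈V)

          h≤m : + ω t ≤ μ
          h≤m = halve-≤ (h≤m-arith (+ ω t) (+ s) μ σ (proj₁ (proj₂ (T⁻ t∈))))

          d : ℤ
          d = card (V ∩ Nb)

          d≤3 : d ≤ + 3
          d≤3 = ℤP.≤-trans (card-Nb V) (eq cr≡3)

          over : ρ G ω V + + 4 * μ + + 2 * + ω t + 1ℤ ≤ + 2 * + ω t * d
          over = ≰⇒+1≤ (tight t t∈V (proj₁ (proj₂ (T⁻ t∈))) (proj₂ (proj₂ (T⁻ t∈))))

          six : + 2 * + ω t * d ≤ + 2 * + ω t * + 3
          six = *-monoˡ (*-nn (0≤ 2) (0≤ (ω t))) d≤3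

          ρ≡ : ρ G ω V ≡ ℤ.-1ℤ
          ρ≡ = ℤP.≤-antisym (ρ≡-arith (ρ G ω V) μ (+ ω t) (+ 2 * + ω t * d) over six h≤m) (valid V λ _ q → q)

          ω≡m : ω t ≡ m
          ω≡m = ℕP.≤-antisym (ℤP.drop‿+≤+ h≤m) (ℤP.drop‿+≤+ (ℤP.*-cancelˡ-≤-pos μ (+ ω t) (+ 4) (ω≡m-arith (ρ G ω V) μ (+ ω t) (+ 2 * + ω t * d) ρ≡ over six)))

          d≥3 : + 3 ≤ d
          d≥3 with ≤⊎+1≤ d (+ 2)
          ... | inj₂ l = l
          ... | inj₁ l = ⊥-elim (1≰0 (d≥3-arith (ρ G ω V) μ (+ ω t) (+ 2 * + ω t * d) ρ≡ (cong +_ ω≡m) over (*-monoˡ {k = + 2 * + ω t} (*-nn (0≤ 2) (0≤ (ω t))) l) 1≤μ))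

          simple′ : ∀ v → v ∈ V → a G t v ≤ 1ℤ
          simple′ v v∈ with ≤⊎+1≤ (a G t v) 1ℤ
          ... | inj₁ l = l
          ... | inj₂ l = ⊥-elim (1≰0 (simple′-arith d (card ((V ∩ Nb) -′ v)) (cr G t V) (a G t v) (cr G t (V -′ v)) (∑-pt _ (∩⁺ V Nb v∈ (Nb-intro (ℤP.≤-trans (+≤+ (s≤s z≤n)) l)))) (∑-pt _ v∈) d≥3 cr≡3 l
                  (ℤP.≤-trans (∑-⊆ sub λ _ _ → 0≤ 1) (card-Nb (V -′ v)))))
            where
            sub : (V ∩ Nb) -′ v ⊆ (V -′ v) ∩ Nb
            sub x q with ∩⁻ V Nb (-′-⊆ {A = V ∩ Nb} v x q)
            ... | p , r = ∩⁺ (V -′ v) Nb (-′-intro {A = V} p (-′-≢ (V ∩ Nb) q)) r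

        cubicT : ∀ t → t ∈ T → CubicVertex t
        cubicT t t∈ = record { ∈V = T⊆V t t∈ ; deg = Tight.cr≡3 t∈ ; weight = Tight.ω≡m t∈ ; simple = Tight.simple′ t∈ }

        -- The charge. On `T` it equals `12m - 2(6m + 1) = -2`.
        β : Fin N → ℤ
        β v = K * cr G v V + ℤ.- + 2 * pot (ω v)

        balance : ∑ V β ≡ ℤ.- + 2 * ρ G ω V
        balance = trans (∑-+ V _ _) (trans (cong₂ _+_ (∑-* V K _) (∑-* V (ℤ.- + 2) _)) (balance-arith K (cross G V V) (e G V) (∑ V (λ v → pot (ω v))) (2e G V)))

        Kind : Fin N → Set
        Kind o = (ω o ≡ 1 × cr G o V ≡ + 4) ⊎ (ω o ≡ m ℕ.+ 1 × cr G o V ≡ + 3)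

        pot-ω : ∀ o → ω o ℕ.≤ s → pot (ω o) ≡ + 8 * μ + 1ℤ - + 2 * + ω o
        pot-ω o h = pot-val (ω o) (ℤP.≤-trans (+≤+ h) (pot-ω-arith (+ s) μ σ))

        -- The threshold `2d + 7` is chosen so that a vertex beyond the two kinds keeps at least 7
        -- after paying 2 along each edge to `T`, more than the total of 6 available below.
        classify : ∀ o → o ∈ O → (Kind o × β o ≡ + 2) ⊎ + 2 * cr G o V + + 7 ≤ + 3 * β o
        classify o o∈ with ω o ℕ.≤? s
        ... | no h = inj₂ (classify-arith (cr G o V) μ (pot (ω o)) (*-nn {+ 12} (0≤ 12) (*-nn (ℤP.i≤j⇒0≤j-i (deg3 o o∈V)) (ℤP.i≤j⇒0≤j-i 1≤μ))) (*-nn {+ 10} (0≤ 10) (ℤP.i≤j⇒0≤j-i (deg3 o o∈V))) (*-nn {+ 12} (0≤ 12) (ℤP.i≤j⇒0≤j-i 1≤μ)) (pot-top (ω o) (ℕP.≰⇒> h)))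
          where
          o∈V = proj₁ (∖⁻ V T o∈)
        ... | yes h with ≤⊎+1≤ (cr G o V) (+ 4)
        ...   | inj₂ c = inj₂ (classify-arith-2 (cr G o V) μ (pot (ω o)) (*-nn {+ 12} (0≤ 12) (*-nn (ℤP.i≤j⇒0≤j-i c) (ℤP.i≤j⇒0≤j-i 1≤μ))) (*-nn {+ 10} (0≤ 10) (ℤP.i≤j⇒0≤j-i c)) (*-nn {+ 12} (0≤ 12) (ℤP.i≤j⇒0≤j-i 1≤μ)) (pot-le o))
        ...   | inj₁ c with ≤⊎+1≤ (cr G o V) (+ 3) | ω o ℕ.≤? 1 | ω o ℕ.≤? (m ℕ.+ 1)
        ...     | inj₂ c′ | yes w | _ = inj₁ (inj₁ (ω≡1 , c≡4) , classify-arith-3 (cr G o V) μ (pot (ω o)) (+ ω o) c≡4 (cong +_ ω≡1) (pot-ω o h))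
          where
          ω≡1 = ℕP.≤-antisym w (pos o)
          c≡4 = ℤP.≤-antisym c c′
        ...     | inj₂ c′ | no w | _ = inj₂ (classify-arith-4 (cr G o V) μ (pot (ω o)) (+ ω o) (ℤP.≤-antisym c c′) (pot-ω o h) (+≤+ (ℕP.≰⇒> w)))
        ...     | inj₁ c′ | _ | yes w = inj₁ (inj₂ (ω≡m+1 , c≡3) , classify-arith-5 (cr G o V) μ (pot (ω o)) (+ ω o) c≡3 (trans (cong +_ ω≡m+1) (ℤP.pos-+ m 1)) (pot-ω o h))
          where
          c≡3 = ℤP.≤-antisym c′ (deg3 o (proj₁ (∖⁻ V T o∈)))
          low : m ℕ.+ 1 ℕ.≤ ω o
          low = subst (ℕ._≤ ω o) (ℕP.+-comm 1 m) (ℕP.≰⇒> λ l → true≢false (T⁺ (proj₁ (∖⁻ V T o∈)) (low-arith (+ ω o) (+ s) μ σ (+≤+ l)) c′) (proj₂ (∖⁻ V T o∈)))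
          ω≡m+1 = ℕP.≤-antisym w low
        ...     | inj₁ c′ | _ | no w = inj₂ (classify-arith-6 (cr G o V) μ (pot (ω o)) (+ ω o) (ℤP.≤-antisym c′ (deg3 o (proj₁ (∖⁻ V T o∈)))) (pot-ω o h) (ℤP.≤-trans (eq (lem m)) (+≤+ (ℕP.≰⇒> w))))
          where
          lem : ∀ m → + m + + 2 ≡ + suc (m ℕ.+ 1)
          lem m = trans (sym (ℤP.pos-+ m 2)) (cong +_ (ℕP.+-suc m 1))

        module _ (apart : ∀ t u → t ∈ T → u ∈ T → a G t u ≤ 0ℤ) where

          indep : ∀ t → t ∈ T → cr G t T ≤ 0ℤ
          indep t t∈ = ℤP.≤-trans (∑-mono T λ u u∈ → apart t u t∈ u∈) (eq (∑-0 T))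

          a≤1 : ∀ {z t} → z ∈ V → t ∈ T → a G z t ≤ 1ℤ
          a≤1 {z} {t} p q = subst (_≤ 1ℤ) (a-sym G t z) (simple (cubicT t q) z p)

          next : ∀ {w} → w ∈ V → ∀ k S → k + 1ℤ ≤ cr G w S → 0ℤ ≤ k → S ⊆ T → ∃ λ u → u ∈ S × 1ℤ ≤ a G w u × k ≤ cr G w (S -′ u)
          next {w} w∈ k S h h₀ S⊆ with ∑-pos S (ℤP.≤-trans (next-arith k h₀) h)
          ... | u , u∈ , l = u , u∈ , l , next-arith-2 k (cr G w S) (a G w u) (cr G w (S -′ u)) (∑-pt _ u∈) h (a≤1 w∈ (S⊆ u u∈))

          -- A vertex of weight 1 and degree 4 with all its edges going to `T` is the only one for
          -- which `3 - d_T` could be negative; it is reducible as a hub.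
          star : ∀ {w} → w ∈ V → ω w ≡ 1 → cr G w V ≤ + 4 → + 4 ≤ cr G w T → Colorable G s ω V
          star {w} w∈ ωw dw four with next w∈ (+ 3) T four (0≤ 3) (λ _ q → q)
          ... | u₁ , i₁ , l₁ , h₁ with next w∈ (+ 2) (T -′ u₁) h₁ (0≤ 2) (λ v q → -′-⊆ {A = T} u₁ v q)
          ...   | u₂ , i₂ , l₂ , h₂ with next w∈ 1ℤ (T -′ u₁ -′ u₂) h₂ (0≤ 1) (λ v q → -′-⊆ {A = T} u₁ v (-′-⊆ {A = T -′ u₁} u₂ v q))
          ...     | u₃ , i₃ , l₃ , h₃ with ∑-pos (T -′ u₁ -′ u₂ -′ u₃) h₃
          ...       | u₄ , i₄ , l₄ = Four.result (arm (cubicT u₁ i₁) l₁) (arm (cubicT u₂ T₂) l₂) (arm (cubicT u₃ T₃) l₃) (arm (cubicT u₄ T₄) l₄)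
                    (apart u₁ u₂ i₁ T₂) (apart u₁ u₃ i₁ T₃) (apart u₁ u₄ i₁ T₄) (apart u₂ u₃ T₂ T₃) (apart u₂ u₄ T₂ T₄) (apart u₃ u₄ T₃ T₄)
                    (-′-≢ T i₂ ∘ sym) (-′-≢ T j₃ ∘ sym) (-′-≢ T k₄ ∘ sym) (-′-≢ (T -′ u₁) i₃ ∘ sym) (-′-≢ (T -′ u₁) j₄ ∘ sym) (-′-≢ (T -′ u₁ -′ u₂) i₄ ∘ sym)
            where
            open Hub pos valid ih gap w w∈ dw ωw
            T₂ : u₂ ∈ T
            T₂ = -′-⊆ {A = T} u₁ u₂ i₂
            j₃ : u₃ ∈ (T -′ u₁)
            j₃ = -′-⊆ {A = T -′ u₁} u₂ u₃ i₃
            T₃ : u₃ ∈ T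
            T₃ = -′-⊆ {A = T} u₁ u₃ j₃
            j₄ : u₄ ∈ (T -′ u₁ -′ u₂)
            j₄ = -′-⊆ {A = T -′ u₁ -′ u₂} u₃ u₄ i₄
            k₄ : u₄ ∈ (T -′ u₁)
            k₄ = -′-⊆ {A = T -′ u₁} u₂ u₄ j₄
            T₄ : u₄ ∈ T
            T₄ = -′-⊆ {A = T} u₁ u₄ k₄

          module _ (no-star : ∀ w → w ∈ V → ω w ≡ 1 → cr G w V ≤ + 4 → cr G w T ≤ + 3) where

            -- Without `T` every charge is at least 2, for a total of at least 6, while the total
            -- `-2ρ(V)` is at most 2.
            empty : (∀ v → T v ≡ false) → ⊥
            empty none = 1≰0 (empty-arith (ρ G ω V) (card V) (∑ V β) balance (ℤP.≤-trans (eq (sym (∑-* V (+ 6) _))) (ℤP.≤-trans (∑-mono V six) (eq (∑-* V (+ 3) β)))) (valid V λ _ q → q) 3≤V)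
              where
              six : ∀ v → v ∈ V → + 6 * 1ℤ ≤ + 3 * β v
              six v v∈ with classify v (∖⁺ V T v∈ (none v))
              ... | inj₁ (_ , h) = eq (cong (λ x → + 3 * x) (sym h))
              ... | inj₂ h = ℤP.≤-trans (six-arith (cr G v V) (cr-nn G v V)) h

            module _ {t₀ : Fin N} (t₀∈ : t₀ ∈ T) where

              -- Three times the charge that remains at `o` when it sends `2/3` along each edge to
              -- `T`; this brings every vertex of `T`, with its three edges into `O`, from -2 to 0.
              δ : Fin N → ℤ
              δ o = + 3 * β o + ℤ.- + 2 * cr G o T

              crT≤ : ∀ o → cr G o T ≤ cr G o V
              crT≤ o = cr-⊆ G o T⊆V

              kind-T : ∀ {o} → o ∈ O → Kind o → cr G o T ≤ + 3
              kind-T {o} o∈ (inj₁ (h , c)) = no-star o (proj₁ (∖⁻ V T o∈)) h (eq c)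
              kind-T {o} o∈ (inj₂ (h , c)) = ℤP.≤-trans (crT≤ o) (eq c)

              δ-kind : ∀ {o} → β o ≡ + 2 → δ o ≡ + 2 * (+ 3 - cr G o T)
              δ-kind {o} h = trans (cong (λ x → + 3 * x + ℤ.- + 2 * cr G o T) h) (δ-kind-eq (cr G o T))

              δ-big : ∀ {o} → + 2 * cr G o V + + 7 ≤ + 3 * β o → + 7 ≤ δ o
              δ-big {o} h = δ-big-arith (cr G o V) (cr G o T) (β o) h (crT≤ o)

              slack-nn : ∀ {o} → o ∈ O → Kind o → 0ℤ ≤ + 3 - cr G o T
              slack-nn o∈ k = ℤP.i≤j⇒0≤j-i (kind-T o∈ k)

              δ-nn : ∀ o → o ∈ O → 0ℤ ≤ δ o
              δ-nn o o∈ with classify o o∈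
              ... | inj₁ (k , h) = ℤP.≤-trans (*-nn (0≤ 2) (slack-nn o∈ k)) (eq (sym (δ-kind {o} h)))
              ... | inj₂ h = ℤP.≤-trans (0≤ 7) (δ-big {o} h)

              -- The vertex `t₀` of `T` forces `ρ(V) = -1`, so `O` has total charge `2 + 2|T|`; from
              -- three times this the payments `2 * 3|T|` are deducted.
              δ-sum : ∑ O δ ≡ + 6
              δ-sum = trans (∑-+ O _ _) (trans (cong₂ _+_ (∑-* O (+ 3) β) (∑-* O (ℤ.- + 2) _))
                  (δ-sum-arith (card T) (∑ V β) (∑ T β) (∑ O β) (ρ G ω V) (cross G O T) balance (∑-sub _ T⊆V) (Tight.ρ≡ t₀∈) (trans (∑-cong T βT) (∑-* T (ℤ.- + 2) _))
                    (trans (cross-comm G O T) (trans (∑-cong T crO) (∑-* T (+ 3) _)))))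
                where
                βT : ∀ t → t ∈ T → β t ≡ ℤ.- + 2 * 1ℤ
                βT t q = βT-arith μ (cr G t V) (pot (ω t)) (deg (cubicT t q)) (trans (cong pot (weight (cubicT t q))) pot-m)
                crO : ∀ t → t ∈ T → cr G t O ≡ + 3 * 1ℤ
                crO t q = crO-arith (cr G t V) (cr G t T) (cr G t O) (∑-sub _ T⊆V) (deg (cubicT t q)) (ℤP.≤-antisym (indep t q) (cr-nn G t T))

              kinds : ∀ o → o ∈ O → Kind o × β o ≡ + 2
              kinds o o∈ with classify o o∈
              ... | inj₁ k = k
              ... | inj₂ h = ⊥-elim (1≰0 (kinds-arith (∑ O δ) (δ o) (∑ (O -′ o) δ) δ-sum (∑-pt _ o∈) (δ-big {o} h) (∑-nn (O -′ o) λ v q → δ-nn v (-′-⊆ {A = O} o v q))))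

              final : Colorable G s ω V
              final = Final.EndGame.colour m 1≤m G ω V pos valid ih gap T T⊆V cubicT indep (λ o o∈ → slack-nn o∈ (proj₁ (kinds o o∈))) kind total
                where
                total : ∑ O (λ o → + 3 - cr G o T) ≤ + 3
                total = halve-≤ (ℤP.≤-trans (eq (trans (sym (∑-* O (+ 2) _)) (trans (∑-cong O λ o o∈ → sym (δ-kind {o} (proj₂ (kinds o o∈)))) δ-sum))) (+≤+ (ℕP.n≤1+n 6)))
                kind : ∀ o → o ∈ O → (ω o ≡ 1 × cr G o O ≡ + 3 - cr G o T + 1ℤ) ⊎ (ω o ≡ m ℕ.+ 1 × cr G o O ≡ + 3 - cr G o T)
                kind o o∈ with proj₁ (kinds o o∈)
                ... | inj₁ (h , c) = inj₁ (h , kind-arith (cr G o V) (cr G o T) (cr G o O) (∑-sub _ T⊆V) c)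
                ... | inj₂ (h , c) = inj₂ (h , kind-arith-2 (cr G o V) (cr G o T) (cr G o O) (∑-sub _ T⊆V) c)

            finish : Colorable G s ω V
            finish with find T
            ... | inj₁ (t , t∈) = final t∈
            ... | inj₂ none = ⊥-elim (empty none)

          stars : Colorable G s ω V
          stars with FinP.any? (λ w → (V w Data.Bool.≟ true) ×-dec ((ω w ℕ.≟ 1) ×-dec ((cr G w V ≤? + 4) ×-dec (+ 4 ≤? cr G w T))))
          ... | yes (w , w∈ , h , d , c) = star w∈ h d c
          ... | no none = finish λ w w∈ h d → stars-arith (cr G w T) (≰⇒+1≤ λ c → none (w , w∈ , h , d , c))

        adjacent : Colorable G s ω V
        adjacent with FinP.any? (λ t → (T t Data.Bool.≟ true) ×-dec FinP.any? (λ u → (T u Data.Bool.≟ true) ×-dec (1ℤ ≤? a G t u)))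
        ... | yes (t , t∈ , u , u∈ , h) = Adjacent.result (T⊆V t t∈) (T⊆V u u∈) (deg (cubicT t t∈)) (deg (cubicT u u∈)) (weight (cubicT t t∈)) (weight (cubicT u u∈)) h
        ... | no none = stars λ t u t∈ u∈ → noF-eq (a G t u) (≰⇒+1≤ λ h → none (t , t∈ , u , u∈ , h))

      reduce : Colorable G s ω V
      reduce with FinP.any? (λ u → (V u Data.Bool.≟ true) ×-dec (cr G u V ≤? + 2))
      ... | yes (u , u∈ , d) = few u∈ d
      ... | no none with FinP.any? (λ u → (V u Data.Bool.≟ true) ×-dec ((+ 2 * + ω u ≤? + s) ×-dec ((cr G u V ≤? + 3) ×-dec (+ 2 * + ω u * card (V ∩ Raise.Nb G ω u (ω u)) ≤? ρ G ω V + K + + 2 * + ω u))))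
      ...   | yes (u , u∈ , h , d , w) = Cubic.cubic u∈ h (ℤP.≤-antisym d (≰⇒+1≤ λ l → none (u , u∈ , l))) w
      ...   | no none′ = adjacent (λ v v∈ → ≰⇒+1≤ λ l → none (v , v∈ , l)) λ v v∈ h d w → none′ (v , v∈ , h , d , w)

    color : ∀ G ω V → Claim G ω V
    color G ω V pos valid ih with ≤⊎+1≤ (card V) (+ 2)
    ... | inj₁ le = small G ω V valid le
    ... | inj₂ 3≤V with Choice.dense-or-gap G ω V pos valid ih
    ...   | inj₁ c = c
    ...   | inj₂ gap = Irreducible.reduce G ω V pos valid ih gap 3≤V

    coloring : ∀ k G ω V → card V ≤ + k → Pos ω → Valid G ω V → Colorable G s ω V
    coloring = induct color

  -- From weighted instances to multigraphs

  private
    clear-denominators-arith : ∀ x b → b * (b * x) ≡ x * (b * 1ℤ * b)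
    clear-denominators-arith = solve-∀

    clear-denominators-arith-2 : ∀ a c b → (a * c * b + 1ℤ * (b * 1ℤ)) * 1ℤ ≡ b * (a * c + 1ℤ)
    clear-denominators-arith-2 = solve-∀

  -- The order on unnormalised rationals is an integer inequality by cross-multiplication; a common
  -- factor `suc d` is then cancelled. The result has the shape `ρ ≥ -1`.
  clear-denominators : ∀ x a c d → (x ℚ./ 1) ℚ.≤ (a ℚ./ suc d) ℚ.* (c ℚ./ 1) ℚ.+ (1ℤ ℚ./ suc d) → + suc d * x ≤ a * c + 1ℤ
  clear-denominators x a c d h = ℤP.*-cancelˡ-≤-pos _ _ (+ suc d) (ℤP.≤-trans (eq (clear-denominators-arith x (+ suc d))) (ℤP.≤-trans k (eq (clear-denominators-arith-2 a c (+ suc d)))))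
    where
    lhs = ℚᵘ.mkℚᵘ x 0
    rhs = ℚᵘ.mkℚᵘ a d ℚᵘ.* ℚᵘ.mkℚᵘ c 0 ℚᵘ.+ ℚᵘ.mkℚᵘ 1ℤ d
    conv : ∀ p → ℚ.toℚᵘ (ℚ.fromℚᵘ p) ℚᵘ.≃ p
    conv = ℚP.toℚᵘ-fromℚᵘ
    rhs≃ : ℚ.toℚᵘ ((a ℚ./ suc d) ℚ.* (c ℚ./ 1) ℚ.+ (1ℤ ℚ./ suc d)) ℚᵘ.≃ rhs
    rhs≃ = ℚᵘP.≃-trans (ℚP.toℚᵘ-homo-+ ((a ℚ./ suc d) ℚ.* (c ℚ./ 1)) (1ℤ ℚ./ suc d))
      (ℚᵘP.+-cong (ℚᵘP.≃-trans (ℚP.toℚᵘ-homo-* (a ℚ./ suc d) (c ℚ./ 1)) (ℚᵘP.*-cong (conv (ℚᵘ.mkℚᵘ a d)) (conv (ℚᵘ.mkℚᵘ c 0)))) (conv (ℚᵘ.mkℚᵘ 1ℤ d)))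
    k′ : lhs ℚᵘ.≤ rhs
    k′ = ℚᵘP.≤-respˡ-≃ (conv lhs) (ℚᵘP.≤-respʳ-≃ rhs≃ (ℚP.toℚᵘ-mono-≤ h))
    k : x * (+ suc d * 1ℤ * + suc d) ≤ (a * c * + suc d + 1ℤ * (+ suc d * 1ℤ)) * 1ℤ
    k = subst₂ (λ y z → x * y ≤ (a * c * + suc d + 1ℤ * z) * 1ℤ) (trans (ℤP.pos-* (suc d ℕ.* 1) (suc d)) (cong (_* + suc d) (ℤP.pos-* (suc d) 1))) (ℤP.pos-* (suc d) 1) (ℚᵘP.drop-*≤* k′)

  opaque
    unfolding ∑

    card-suc : ∀ {n} (A : Sub (suc n)) → card A ≡ ⟦ A zero ⟧ + card (A ∘ suc)
    card-suc A = refl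

    card-zero : ∀ (A : Sub 0) → card A ≡ 0ℤ
    card-zero A = refl

  private
    a-lookup-arith : ∀ x z y → z ≡ 1ℤ → 0ℤ ≤ x → 0ℤ ≤ y → 1ℤ ≤ x + (z + y)
    a-lookup-arith x z y w h h′ = by (h ⊞ h′ ⊞ eq′ w) (solve (x ∷ z ∷ y ∷ []))

    a-lookup-arith-2 : ∀ x y z → 1ℤ ≤ x → 0ℤ ≤ y → 0ℤ ≤ z → 1ℤ ≤ x + (y + z)
    a-lookup-arith-2 x y z h h′ h″ = by (h ⊞ h′ ⊞ h″) (solve (x ∷ y ∷ z ∷ []))

  module _ {N : ℕ} where

    empty : Graph N
    empty = record { a = λ _ _ → 0ℤ ; a-sym = λ _ _ → refl ; a-irr = λ _ → refl ; a-nn = λ _ _ → 0≤ 0 }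

    graph : (E : List (Fin N × Fin N)) → All (λ x → proj₁ x ≢ proj₂ x) E → Graph N
    graph [] All.[] = empty
    graph ((p , q) ∷ E) (n All.∷ ns) = addEdge (graph E ns) p q n

    inside-edges : Sub N → (E : List (Fin N × Fin N)) → Sub (length E)
    inside-edges A E i = A (proj₁ (List.lookup E i)) ∧ A (proj₂ (List.lookup E i))

    e-empty : ∀ A → e empty A ≡ 0ℤ
    e-empty A = ℤP.*-cancelˡ-≡ (+ 2) _ _ (trans (sym (2e empty A)) (∑-zero A λ u _ → ∑-zero A λ v _ → refl))

    e-graph : ∀ A E ns → e (graph E ns) A ≡ card (inside-edges A E)
    e-graph A [] All.[] = trans (e-empty A) (sym (card-zero _))
    e-graph A ((p , q) ∷ E) (n All.∷ ns) = trans (e-addEdge (graph E ns) p q n A) (trans (ℤP.+-comm (e (graph E ns) A) _)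
      (trans (cong (λ x → ⟦ A p ∧ A q ⟧ + x) (e-graph A E ns)) (sym (card-suc (inside-edges A ((p , q) ∷ E))))))

    inducedEdgeCount-e : ∀ (A : Sub N) E ns → + inducedEdgeCount (tabulate A) E ≡ e (graph E ns) A
    inducedEdgeCount-e A [] All.[] = sym (e-empty A)
    inducedEdgeCount-e A ((p , q) ∷ E) (n All.∷ ns) rewrite lookup∘tabulate A p | lookup∘tabulate A q = trans (go (A p ∧ A q)) (sym (e-addEdge (graph E ns) p q n A))
      where
      IH = inducedEdgeCount-e A E ns
      go : ∀ b → + (if b then suc (inducedEdgeCount (tabulate A) E) else inducedEdgeCount (tabulate A) E) ≡ e (graph E ns) A + ⟦ b ⟧
      go true = trans (ℤP.pos-+ 1 (inducedEdgeCount (tabulate A) E)) (trans (ℤP.+-comm 1ℤ (+ inducedEdgeCount (tabulate A) E)) (cong (_+ 1ℤ) IH))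
      go false = trans IH (sym (ℤP.+-identityʳ _))

    a-lookup : ∀ E ns i {p q} → List.lookup E i ≡ (p , q) → 1ℤ ≤ a (graph E ns) p q
    a-lookup ((p , q) ∷ E) (n All.∷ ns) zero refl = a-lookup-arith (a (graph E ns) p q) ⟦ (p == p) ∧ (q == q) ⟧ ⟦ (p == q) ∧ (q == p) ⟧
        (cong₂ (λ b c → ⟦ b ∧ c ⟧) (==-refl p) (==-refl q)) (a-nn (graph E ns) p q) (⟦⟧-nn ((p == q) ∧ (q == p)))
    a-lookup ((p′ , q′) ∷ E) (n All.∷ ns) (suc i) {p} {q} h = a-lookup-arith-2 (a (graph E ns) p q) ⟦ (p == p′) ∧ (q == q′) ⟧ ⟦ (p == q′) ∧ (q == p′) ⟧ (a-lookup E ns i h) (⟦⟧-nn ((p == p′) ∧ (q == q′))) (⟦⟧-nn ((p == q′) ∧ (q == p′)))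

    card-∪-≤ : ∀ (A B : Sub N) → card (A ∪ B) ≤ card A + card B
    card-∪-≤ A B = ℤP.≤-trans (eq (∑-split (A ∪ B) A _)) (eq (∑-set (∪∩ A B)) ⊞ ∑-⊆ (λ v q → go v (∪⁻ A B (proj₁ (∖⁻ (A ∪ B) A q))) (proj₂ (∖⁻ (A ∪ B) A q))) λ _ _ → 0≤ 1)
      where
      go : ∀ v → v ∈ A ⊎ v ∈ B → A v ≡ false → v ∈ B
      go v (inj₁ x) y = ⊥-elim (true≢false x y)
      go v (inj₂ x) _ = x

    image : ∀ {k} → (Fin k → Fin N) → Sub N
    image {zero} f = ∅
    image {suc k} f = ⁅ f zero ⁆ ∪ image (f ∘ suc)

    image-∈ : ∀ {k} (f : Fin k → Fin N) i → f i ∈ image f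
    image-∈ f zero = ∪ˡ ⁅ f zero ⁆ (image (f ∘ suc)) (==-refl (f zero))
    image-∈ f (suc i) = ∪ʳ ⁅ f zero ⁆ (image (f ∘ suc)) (image-∈ (f ∘ suc) i)

    image-⊆ : ∀ {k} (f : Fin k → Fin N) {S} → (∀ i → f i ∈ S) → image f ⊆ S
    image-⊆ {suc k} f {S} h v q with ∪⁻ ⁅ f zero ⁆ (image (f ∘ suc)) q
    ... | inj₁ x = subst (_∈ S) (sym (==⇒≡ x)) (h zero)
    ... | inj₂ x = image-⊆ (f ∘ suc) (h ∘ suc) v x

    card-image : ∀ {k} (f : Fin k → Fin N) → card (image f) ≤ + k
    card-image {zero} f = eq (∑-∅ λ _ → refl)
    card-image {suc k} f = ℤP.≤-trans (card-∪-≤ ⁅ f zero ⁆ (image (f ∘ suc))) (ℤP.≤-trans (eq (∑-⁅⁆ (f zero) _) ⊞ card-image (f ∘ suc)) (eq′ (ℤP.pos-+ 1 k)))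

  injective-card : ∀ {L} k (f : Fin k → Fin L) → Injective _≡_ _≡_ f → ∀ S → (∀ j → f j ∈ S) → + k ≤ card S
  injective-card zero f inj S h = card-nn S
  injective-card (suc k) f inj S h = ℤP.≤-trans (eq (ℤP.pos-+ 1 k)) (ℤP.≤-trans
    (ℤP.≤-refl {1ℤ} ⊞ injective-card k (f ∘ suc) (FinP.suc-injective ∘ inj) (S -′ f zero) (λ j → -′-intro {A = S} (h (suc j)) λ q → FinP.0≢1+n (sym (inj q))))
    (eq′ (∑-pt _ (h zero))))

  -- Cycles and components from edge counts.

  private
    acyclic-arith : ∀ x y z → x + 1ℤ ≤ y → y ≤ z → z ≤ x → 1ℤ ≤ 0ℤ
    acyclic-arith x y z h h′ h″ = ℤP.≤-trans {j = y - x} (by h (solve (x ∷ y ∷ []))) (by (h′ ⊞ h″) (solve (x ∷ y ∷ z ∷ [])))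

    reach-arith : ∀ c c′ e e′ k b r → c′ ≡ c + 1ℤ → e′ ≡ e + 0ℤ + k → k ≡ b + r → 1ℤ ≤ b → 0ℤ ≤ r → c ≤ e + 1ℤ → c′ ≤ e′ + 1ℤ
    reach-arith c _ e _ _ b r refl refl refl h h′ h″ = by (h ⊞ h′ ⊞ h″) (solve (c ∷ e ∷ b ∷ r ∷ []))

    bounded-arith : ∀ c e s → e + 1ℤ ≤ c → c ≤ s → s ≤ e → 1ℤ ≤ 0ℤ
    bounded-arith c e s h h′ h″ = ℤP.≤-trans {j = c - e} (by h (solve (c ∷ e ∷ []))) (by (h′ ⊞ h″) (solve (c ∷ e ∷ s ∷ [])))

  module FromColoring (D : ℕ) (G : Multigraph) (c : Sub (n G))
    (L : Light (graph (edges G) (loopless G)) (suc D) (λ _ → 1) ((λ _ → true) ∩ c)) (F : Forest (graph (edges G) (loopless G)) ((λ _ → true) ∖ c)) where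

    H : Graph (n G)
    H = graph (edges G) (loopless G)

    M : Subset (n G)
    M = tabulate c

    M-∈ : ∀ {v} → v ∈ₛ M → c v ≡ true
    M-∈ {v} h = trans (sym (lookup∘tabulate c v)) ([]=⇒lookup h)

    ∁M-∈ : ∀ {v} → v ∈ₛ ∁ M → c v ≡ false
    ∁M-∈ {v} h = ≢true λ q → x∈∁p⇒x∉p h (lookup⇒[]= v M (trans (lookup∘tabulate c v) q))

    inside⁺ : ∀ A i → proj₁ (endpoints G i) ∈ A → proj₂ (endpoints G i) ∈ A → i ∈ inside-edges A (edges G)
    inside⁺ A i = ∧-intro

    inside⁻ : ∀ A i → i ∈ inside-edges A (edges G) → proj₁ (endpoints G i) ∈ A × proj₂ (endpoints G i) ∈ A
    inside⁻ A i = ∧-true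

    joined : ∀ {i u v} (A : Sub (n G)) → Joins G i u v → u ∈ A → v ∈ A → i ∈ inside-edges A (edges G)
    joined A (inj₁ p) hu hv = ∧-intro (subst (λ z → A (proj₁ z) ≡ true) (sym p) hu) (subst (λ z → A (proj₂ z) ≡ true) (sym p) hv)
    joined A (inj₂ p) hu hv = ∧-intro (subst (λ z → A (proj₁ z) ≡ true) (sym p) hv) (subst (λ z → A (proj₂ z) ≡ true) (sym p) hu)

    -- A cycle of length `k + 2` has that many distinct edges, all spanned by a set of at most
    -- `k + 2` vertices.
    acyclic : ∀ {S} {A : Subset (n G)} → (∀ {v} → v ∈ₛ A → v ∈ S) → Forest H S → IsForestIn G A
    acyclic {S} in-S Fo cy = 1≰0 (acyclic-arith (e H I) (card I) (+ suc (suc k)) (Fo I (image-⊆ vs (in-S ∘ vs-in)) (vs zero , image-∈ vs zero)) (card-image vs)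
        (ℤP.≤-trans (injective-card (suc (suc k)) es es-inj (inside-edges I (edges G)) λ j → joined I (joins j) (image-∈ vs j) (image-∈ vs (cnext j))) (eq (sym (e-graph I (edges G) (loopless G))))))
      where
      open CycleIn cy
      I = image vs

    MS : Sub (n G)
    MS = (λ _ → true) ∩ c

    Connected : Vertex G → Sub (n G) → Set
    Connected v A = v ∈ A × A ⊆ MS × card A ≤ e H A + 1ℤ

    -- Connectedness is again a count: each new vertex of the walk brings at least one edge to the
    -- set built so far, which preserves `|A| ≤ e(A) + 1`.
    reach : ∀ {v x A} → Connected v A → Reach G M v x → ∃ λ A′ → Connected v A′ × A ⊆ A′ × x ∈ A′
    reach {A = A} C@(v∈ , _) (here _) = A , C , (λ _ q → q) , v∈
    reach {v} C (step {w} {x} i r j x∈) with reach C r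
    ... | A′ , C′@(v∈ , A⊆ , t) , A⊆A′ , w∈ with true⊎false (A′ x)
    ...   | inj₁ y = A′ , C′ , A⊆A′ , y
    ...   | inj₂ x∉ = A′ ∪ ⁅ x ⁆ , (∪ˡ A′ ⁅ x ⁆ v∈ , sub , tree) , (λ z q → ∪ˡ A′ ⁅ x ⁆ (A⊆A′ z q)) , ∪ʳ A′ ⁅ x ⁆ (==-refl x)
      where
      sub : A′ ∪ ⁅ x ⁆ ⊆ MS
      sub z q with ∪⁻ A′ ⁅ x ⁆ q
      ... | inj₁ p = A⊆ z p
      ... | inj₂ p = subst (_∈ MS) (sym (==⇒≡ p)) (M-∈ x∈)
      dj : ∀ z → z ∈ A′ → ⁅ x ⁆ z ≡ false
      dj z q = ≢⇒== λ { refl → true≢false q x∉ }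
      edge : 1ℤ ≤ a H x w
      edge = go j
        where
        go : Joins G i w x → 1ℤ ≤ a H x w
        go (inj₁ p) = subst (1ℤ ≤_) (a-sym H w x) (a-lookup (edges G) (loopless G) i p)
        go (inj₂ p) = a-lookup (edges G) (loopless G) i p
      tree : card (A′ ∪ ⁅ x ⁆) ≤ e H (A′ ∪ ⁅ x ⁆) + 1ℤ
      tree = reach-arith (card A′) _ (e H A′) _ (cr H x A′) (a H x w) (cr H x (A′ -′ w)) (trans (∑-∪ A′ ⁅ x ⁆ _ dj) (cong (λ z → card A′ + z) (∑-⁅⁆ x _)))
        (trans (e-∪ H A′ ⁅ x ⁆ dj) (cong₂ _+_ (cong (λ z → e H A′ + z) (e-⁅⁆ H x)) (trans (cross-comm H A′ ⁅ x ⁆) (∑-⁅⁆ x _)))) (∑-pt _ w∈) edge (cr-nn H x (A′ -′ w)) t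

    cover : ∀ {v} k (f : Fin k → EdgeId G) → (∀ j → EdgeInComponent G M v (f j)) → ∀ A → Connected v A →
      ∃ λ A′ → Connected v A′ × A ⊆ A′ × (∀ j → f j ∈ inside-edges A′ (edges G))
    cover zero f h A C = A , C , (λ _ q → q) , λ ()
    cover (suc k) f h A C with cover k (f ∘ suc) (h ∘ suc) A C
    ... | A₁ , C₁ , s₁ , i₁ with reach C₁ (proj₁ (h zero))
    ...   | A₂ , C₂ , s₂ , p∈ with reach C₂ (proj₂ (h zero))
    ...     | A₃ , C₃ , s₃ , q∈ = A₃ , C₃ , (λ z q → s₃ z (s₂ z (s₁ z q))) , λ where
                zero → inside⁺ A₃ (f zero) (s₃ _ p∈) q∈
                (suc j) → inside⁺ A₃ (f (suc j)) (s₃ _ (s₂ _ (proj₁ (inside⁻ A₁ (f (suc j)) (i₁ j))))) (s₃ _ (s₂ _ (proj₂ (inside⁻ A₁ (f (suc j)) (i₁ j)))))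

    -- The walks from `v` to all ends of `D + 1` edges fill a tree with at least `D + 2` vertices,
    -- whereas unit weights allow only `D + 1`.
    bounded : ComponentsHaveAtMost D G M
    bounded v v∈ f inj all with cover (suc D) f all ⁅ v ⁆ (==-refl v , (λ z q → subst (_∈ MS) (sym (==⇒≡ q)) (M-∈ v∈)) , eq (trans (∑-⁅⁆ v _) (sym (cong (_+ 1ℤ) (e-⁅⁆ H v)))))
    ... | A , (v∈A , A⊆ , t) , _ , ins = 1≰0 (bounded-arith (card A) (e H A) (+ suc D)
          (proj₁ l) (proj₂ l t)
          (ℤP.≤-trans (injective-card (suc D) f inj (inside-edges A (edges G)) ins) (eq (sym (e-graph A (edges G) (loopless G))))))
      where
      l = L A A⊆ (v , v∈A)

    result : DFColoring D G
    result = M , acyclic M-∈ (λ A A⊆ ne → proj₁ (L A A⊆ ne)) , bounded , acyclic (λ h → not-intro (∁M-∈ h)) F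

  -- Sparse multigraphs as valid instances with unit weights.

  size-card : ∀ {N} (A : Sub N) → + ∣ tabulate A ∣ ≡ card A
  size-card {zero} A = sym (card-zero A)
  size-card {suc N} A with A zero in p
  ... | true = trans (ℤP.pos-+ 1 ∣ tabulate (A ∘ suc) ∣) (trans (cong (λ x → 1ℤ + x) (size-card (A ∘ suc))) (sym (trans (card-suc A) (cong (λ b → ⟦ b ⟧ + card (A ∘ suc)) p))))
  ... | false = trans (size-card (A ∘ suc)) (sym (trans (card-suc A) (trans (cong (λ b → ⟦ b ⟧ + card (A ∘ suc)) p) (ℤP.+-identityˡ _))))

  sparse-bound : ∀ α d G → Sparse (α ℚ./ suc d) (1ℤ ℚ./ suc d) G → ∀ A → + 2 ≤ card A → + suc d * e (graph (edges G) (loopless G)) A ≤ α * card A + 1ℤ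
  sparse-bound α d G sp A 2≤ = subst₂ (λ x y → + suc d * x ≤ α * y + 1ℤ) (inducedEdgeCount-e A (edges G) (loopless G)) (size-card A)
    (clear-denominators _ α _ d (sp (tabulate A) (ℤP.drop‿+≤+ (subst (+ 2 ≤_) (sym (size-card A)) 2≤))))

  full : ∀ {N} → Sub N
  full _ = true

  private
    sparse-num : ∀ a c b k e p → p ≡ a * c → k ≡ b → b * e ≤ a * c + 1ℤ → ℤ.-1ℤ ≤ p - k * e
    sparse-num a c b _ e _ refl refl h = by h (solve (a ∷ c ∷ b ∷ e ∷ []))

    empty-num : ∀ k → ℤ.-1ℤ ≤ 0ℤ - k * 0ℤ
    empty-num k = by (0≤ 1) (solve (k ∷ []))

  module SparseValid (P : Params) (d : ℕ) (α : ℤ) (G : Multigraph) (K≡ : Params.K P ≡ + suc d) (pot≡ : Params.pot P 1 ≡ α) (sp : Sparse (α ℚ./ suc d) (1ℤ ℚ./ suc d) G) where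
    open Params P

    H : Graph (n G)
    H = graph (edges G) (loopless G)

    two-valid : ∀ A → + 2 ≤ card A → ℤ.-1ℤ ≤ Reduction.ρ P H (λ _ → 1) A
    two-valid A 2≤A = sparse-num α (card A) (+ suc d) K (e H A) (∑ A λ _ → pot 1)
      (trans (∑-cong A λ _ _ → trans pot≡ (sym (ℤP.*-identityʳ α))) (∑-* A α _)) K≡ (sparse-bound α d G sp A 2≤A)

    valid : Reduction.Valid P H (λ _ → 1) full
    valid A _ = go (find A)
      where
      nonempty : ∀ {v} → v ∈ A → Nonempty (A -′ v) ⊎ (∀ w → (A -′ v) w ≡ false) → ℤ.-1ℤ ≤ Reduction.ρ P H (λ _ → 1) A
      nonempty v∈ (inj₁ (w , w∈)) = two-valid A (Step.two-of P v∈ w∈)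
      nonempty v∈ (inj₂ none) = Reduction.single-valid P H v∈ none
      go : Nonempty A ⊎ (∀ v → A v ≡ false) → ℤ.-1ℤ ≤ Reduction.ρ P H (λ _ → 1) A
      go (inj₁ (v , v∈)) = nonempty v∈ (find (A -′ v))
      go (inj₂ none) = ℤP.≤-trans (empty-num K) (eq (sym (cong₂ (λ x y → x - K * y) (∑-∅ none) (e-∅ H none))))

  private
    unit-pot-eq : ∀ k → k + k + 1ℤ - + 2 * + 1 ≡ k + k - 1ℤ
    unit-pot-eq = solve-∀

  module Theorem (P : Params) (coloring : ∀ {N} k (G : Graph N) ω V → card V ≤ + k → Reduction.Pos P ω → Reduction.Valid P G ω V → Colorable G (Params.s P) ω V) where
    open Params P

    unit-pot : + 2 ≤ + s → pot 1 ≡ K + K - 1ℤ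
    unit-pot h = trans (pot-small 1 (s≤s z≤n) h) (unit-pot-eq K)

    sparse-coloring : ∀ D d α G → s ≡ suc D → + 2 ≤ + s → K ≡ + suc d → α ≡ K + K - 1ℤ → Sparse (α ℚ./ suc d) (1ℤ ℚ./ suc d) G → DFColoring D G
    sparse-coloring D d α G s≡ 2≤s K≡ α≡ sp with coloring ℤ.∣ card full ∣ (graph (edges G) (loopless G)) (λ _ → 1) full (eq′ (ℤP.0≤i⇒+∣i∣≡i (card-nn full))) (λ _ → s≤s z≤n)
        (SparseValid.valid P d α G K≡ (trans (unit-pot 2≤s) (sym α≡)) sp)
    ... | c , L , F = FromColoring.result D G c (subst (λ x → Light (graph (edges G) (loopless G)) x (λ _ → 1) (full ∩ c)) s≡ L) F

  private
    D≡′-eq : ∀ j → 1ℤ + j * + 2 ≡ + 2 * (1ℤ + j) - 1ℤ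
    D≡′-eq = solve-∀

    K≡-eq : ∀ m → + 2 + + 2 * (+ 2 * m - 1ℤ) ≡ + 4 * m
    K≡-eq = solve-∀

    α≡-eq : ∀ m → + 4 * (+ 2 * m - 1ℤ) + + 3 ≡ + 4 * m + + 4 * m - 1ℤ
    α≡-eq = solve-∀

  -- Odd `D` is the case of even `s`: with `D = 2j + 1` and `m = j + 1`, `s = D + 1 = 2m` and
  -- `K = 4m = 2D + 2`, and `4D + 3 = 2K - 1` is the potential of weight 1.
  odd-coloring : ∀ D → D ℕ.% 2 ≡ 1 → ∀ G → Sparse (+ (4 ℕ.* D ℕ.+ 3) ℚ./ (2 ℕ.+ 2 ℕ.* D)) (1ℤ ℚ./ (2 ℕ.+ 2 ℕ.* D)) G → DFColoring D G
  odd-coloring D odd G = Theorem.sparse-coloring (EvenParams.params m 1≤m) (EvenCase.coloring m 1≤m) D (1 ℕ.+ 2 ℕ.* D) (+ (4 ℕ.* D ℕ.+ 3)) G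
      (trans (ℕP.*-comm 2 m) (cong suc (sym D≡))) (+≤+ (ℕP.*-monoʳ-≤ 2 1≤m)) K≡ α≡
    where
    j = D ℕ./ 2
    m = suc j
    1≤m : 1 ℕ.≤ m
    1≤m = s≤s z≤n
    D≡ : D ≡ 1 ℕ.+ j ℕ.* 2
    D≡ = trans (m≡m%n+[m/n]*n D 2) (cong (ℕ._+ j ℕ.* 2) odd)
    D≡′ : + D ≡ + 2 * + m - 1ℤ
    D≡′ = trans (cong +_ D≡) (trans (ℤP.pos-+ 1 (j ℕ.* 2)) (trans (cong (λ x → 1ℤ + x) (ℤP.pos-* j 2)) (trans (D≡′-eq (+ j)) (cong (λ x → + 2 * x - 1ℤ) (sym (ℤP.pos-+ 1 j))))))
    K≡ : + 4 * + m ≡ + (2 ℕ.+ 2 ℕ.* D)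
    K≡ = sym (trans (ℤP.pos-+ 2 (2 ℕ.* D)) (trans (cong (λ x → + 2 + x) (ℤP.pos-* 2 D)) (trans (cong (λ x → + 2 + + 2 * x) D≡′) (K≡-eq (+ m)))))
    α≡ : + (4 ℕ.* D ℕ.+ 3) ≡ + 4 * + m + + 4 * + m - 1ℤ
    α≡ = trans (ℤP.pos-+ (4 ℕ.* D) 3) (trans (cong (λ x → x + + 3) (ℤP.pos-* 4 D)) (trans (cong (λ x → + 4 * x + + 3) D≡′) (α≡-eq (+ m))))

  private
    K≡-eq-2 : ∀ m → 1ℤ + + 2 * (m * + 2) ≡ + 4 * m + 1ℤ
    K≡-eq-2 = solve-∀

    α≡-eq-2 : ∀ m → + 4 * (m * + 2) + 1ℤ ≡ + 4 * m + 1ℤ + (+ 4 * m + 1ℤ) - 1ℤ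
    α≡-eq-2 = solve-∀

  -- Here `D = 2j`, `s = 2j + 1` and `K = 4j + 1 = 2D + 1`, with `4D + 1 = 2K - 1`. The bound on `D`
  -- gives `2 ≤ s`, which puts weight 1 into the range of `pot-small`.
  even-coloring : ∀ D → 2 ℕ.≤ D → D ℕ.% 2 ≡ 0 → ∀ G → Sparse (+ (4 ℕ.* D ℕ.+ 1) ℚ./ (1 ℕ.+ 2 ℕ.* D)) (1ℤ ℚ./ (1 ℕ.+ 2 ℕ.* D)) G → DFColoring D G
  even-coloring D 2≤D even G = Theorem.sparse-coloring (OddParams.params j) (OddCase.coloring (OddParams.params j) (OddParams.heavy j) (OddParams.light j)) D (2 ℕ.* D) (+ (4 ℕ.* D ℕ.+ 1)) G
      s≡ (subst (λ x → + 2 ≤ + x) (sym s≡) (+≤+ (ℕP.≤-trans 2≤D (ℕP.n≤1+n D)))) K≡ α≡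
    where
    j = D ℕ./ 2
    D≡ : D ≡ j ℕ.* 2
    D≡ = trans (m≡m%n+[m/n]*n D 2) (cong (ℕ._+ j ℕ.* 2) even)
    s≡ : 2 ℕ.* j ℕ.+ 1 ≡ suc D
    s≡ = trans (ℕP.+-comm (2 ℕ.* j) 1) (cong suc (trans (ℕP.*-comm 2 j) (sym D≡)))
    D≡′ : + D ≡ + j * + 2
    D≡′ = trans (cong +_ D≡) (ℤP.pos-* j 2)
    K≡ : + 4 * + j + 1ℤ ≡ + (1 ℕ.+ 2 ℕ.* D)
    K≡ = sym (trans (ℤP.pos-+ 1 (2 ℕ.* D)) (trans (cong (λ x → 1ℤ + x) (ℤP.pos-* 2 D)) (trans (cong (λ x → 1ℤ + + 2 * x) D≡′) (K≡-eq-2 (+ j)))))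
    α≡ : + (4 ℕ.* D ℕ.+ 1) ≡ + 4 * + j + 1ℤ + (+ 4 * + j + 1ℤ) - 1ℤ
    α≡ = trans (ℤP.pos-+ (4 ℕ.* D) 1) (trans (cong (λ x → x + 1ℤ) (ℤP.pos-* 4 D)) (trans (cong (λ x → + 4 * x + 1ℤ) D≡′) (α≡-eq-2 (+ j))))

open import Data.Nat using (ℕ; _≤_; _*_; _+_; _%_)
open import Data.Integer using (+_)
open import Data.Rational using (_/_)
open import Data.Product using (_×_; _,_)
open import Relation.Binary.PropositionalEquality using (_≡_)

theorem1p3 : ((D : ℕ) → 1 ≤ D → D % 2 ≡ 1 → (G : Multigraph) →
    Sparse (+ (4 * D + 3) / (2 + 2 * D)) (+ 1 / (2 + 2 * D)) G →
    DFColoring D G)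
    × ((D : ℕ) → 2 ≤ D → D % 2 ≡ 0 → (G : Multigraph) →
    Sparse (+ (4 * D + 1) / (1 + 2 * D)) (+ 1 / (1 + 2 * D)) G →
    DFColoring D G)
theorem1p3 = (λ D _ → WeightedColoring.odd-coloring D) , WeightedColoring.even-coloring
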